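{- Let $\Gamma=\{1324,123\}$. Define polynomials $U_{\Gamma,n}(y)$ by $U_{\Gamma,0}(y)=1$, $U_{\Gamma,j}(y)=0$ for $j<0$, $U_{\Gamma,1}(y)=-y$, and for $n\ge 2$ $$U_{\Gamma,n}(y)=-yU_{\Gamma,n-1}(y)-yU_{\Gamma,n-2}(y)+\sum_{k=2}^{\lfloor n/2\rfloor}(-y)^kC_{k-1}U_{\Gamma,n-2k}(y),$$ where $C_m=\frac{1}{m+1}\binom{2m}{m}$ is the $m$-th Catalan number. Let $U_\Gamma(t,y)=1+\sum_{n\ge1}U_{\Gamma,n}(y)\frac{t^n}{n!}$. Then $$\mathrm{NM}_\Gamma(t,x,y)=\left(\frac{1}{U_\Gamma(t,y)}\right)^x.$$
   Context: For $\sigma=\sigma_1\cdots\sigma_n$ in the symmetric group $\mathfrak S_n$, $i$ is a descent if $\sigma_i>\sigma_{i+1}$, and $\mathrm{des}(\sigma)$ is the number of descents; $\sigma_j$ is a left-to-right minimum if $\sigma_j<\sigma_i$ for all $i<j$, and $\mathrm{LRmin}(\sigma)$ is the number of left-to-right minima. For a sequence $\alpha=\alpha_1\cdots\alpha_m$ of distinct integers, $\mathrm{red}(\alpha)\in\mathfrak S_m$ is obtained by replacing the $i$-th smallest entry by $i$. For a set $\Gamma$ of permutations, $\sigma$ has a $\Gamma$-match starting at position $i$ if there is $j\ge1$ with $\mathrm{red}(\sigma_i\sigma_{i+1}\cdots\sigma_{i+j})\in\Gamma$; $\mathcal{NM}_n(\Gamma)$ is the set of $\sigma\in\mathfrak S_n$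 with no $\Gamma$-match. Define $\mathrm{NM}_\Gamma(t,x,y)=1+\sum_{n\ge1}\frac{t^n}{n!}\sum_{\sigma\in\mathcal{NM}_n(\Gamma)}x^{\mathrm{LRmin}(\sigma)}y^{1+\mathrm{des}(\sigma)}$ (the $n=0$ term is $1$). -}

module Defs where

open import Data.Bool using (Bool; true; false; if_then_else_; _∧_; _∨_; not)
open import Data.Nat as ℕ using (ℕ; zero; suc; _∸_; _≡ᵇ_; _<ᵇ_; ⌊_/2⌋; _!)
open import Data.Nat.Properties using (_!≢0)
open import Data.Nat.Combinatorics using (_C_)
open import Data.Integer as ℤ using (ℤ; +_)
open import Data.List as L using (List; []; _∷_; map; concatMap; length; inits; tails; filterᵇ; applyUpTo)
open import Data.Bool.ListAction using (any)
open import Data.Rational as ℚ using (ℚ; 0ℚ; 1ℚ; _+_; _*_; _-_; -_)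

-- Permutations of [n] in one-line notation σ₁ ⋯ σₙ (values 1..n)

words : ℕ → ℕ → List (List ℕ)
words n zero    = [] ∷ []
words n (suc l) = concatMap (λ v → map (v ∷_) (words n l)) (applyUpTo suc n)

memᵇ : ℕ → List ℕ → Bool
memᵇ x = any (x ≡ᵇ_)

distinctᵇ : List ℕ → Bool
distinctᵇ []       = true
distinctᵇ (x ∷ xs) = not (memᵇ x xs) ∧ distinctᵇ xs

Perms : ℕ → List (List ℕ)
Perms n = filterᵇ distinctᵇ (words n n)

des : List ℕ → ℕ
des []           = 0
des (x ∷ [])     = 0
des (x ∷ y ∷ xs) = (if y <ᵇ x then 1 else 0) ℕ.+ des (y ∷ xs)

lrminFrom : ℕ → List ℕ → ℕ
lrminFrom m []       = 0
lrminFrom m (x ∷ xs) = if x <ᵇ m then suc (lrminFrom x xs) else lrminFrom m xs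

LRmin : List ℕ → ℕ
LRmin []       = 0
LRmin (x ∷ xs) = suc (lrminFrom x xs)

red : List ℕ → List ℕ
red α = map (λ a → suc (length (filterᵇ (_<ᵇ a) α))) α

eqListᵇ : List ℕ → List ℕ → Bool
eqListᵇ []       []       = true
eqListᵇ (x ∷ xs) (y ∷ ys) = (x ≡ᵇ y) ∧ eqListᵇ xs ys
eqListᵇ _        _        = false

factors : List ℕ → List (List ℕ)
factors σ = concatMap (λ s → filterᵇ (λ f → 1 ℕ.<ᵇ length f) (inits s)) (tails σ)

hasMatchᵇ : List (List ℕ) → List ℕ → Bool
hasMatchᵇ Γ σ = any (λ f → any (eqListᵇ (red f)) Γ) (factors σ)

NM : List (List ℕ) → ℕ → List (List ℕ)
NM Γ n = filterᵇ (λ σ → not (hasMatchᵇ Γ σ)) (Perms n)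

Γ : List (List ℕ)
Γ = (1 ∷ 3 ∷ 2 ∷ 4 ∷ []) ∷ (1 ∷ 2 ∷ 3 ∷ []) ∷ []

-- Formal power series in t, x, y with rational coefficients, given by
-- their coefficient function:  F n a b = [t^n x^a y^b] F.

Series : Set
Series = ℕ → ℕ → ℕ → ℚ

Σ≤ : ℕ → (ℕ → ℚ) → ℚ
Σ≤ zero    f = f 0
Σ≤ (suc n) f = Σ≤ n f + f (suc n)

isZero : ℕ → Bool
isZero zero    = true
isZero (suc _) = false

const : ℚ → Series
const c n a b = if isZero n ∧ isZero a ∧ isZero b then c else 0ℚ

oneS : Series
oneS = const 1ℚ

X : Series
X n a b = if isZero n ∧ (a ≡ᵇ 1) ∧ isZero b then 1ℚ else 0ℚ

infixl 6 _⊕_ _⊖_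
infixl 7 _⊛_
_⊕_ : Series → Series → Series
(F ⊕ G) n a b = F n a b + G n a b

_⊖_ : Series → Series → Series
(F ⊖ G) n a b = F n a b - G n a b

_⊛_ : Series → Series → Series
(F ⊛ G) n a b =
  Σ≤ n λ i → Σ≤ a λ j → Σ≤ b λ k → F i j k * G (n ∸ i) (a ∸ j) (b ∸ k)

_^S_ : Series → ℕ → Series
F ^S zero  = oneS
F ^S suc k = F ⊛ (F ^S k)

fallingX : ℕ → Series
fallingX zero    = oneS
fallingX (suc k) = fallingX k ⊛ (X ⊖ const (ℤ.+ k ℚ./ 1))

binomX : ℕ → Series
binomX k = const ((+ 1 ℚ./ (k !)) {{k !≢0}}) ⊛ fallingX k

-- Reciprocal of a series F whose t⁰-part is 1:  1/F = Σ_{k≥0} (1 - F)^k.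
-- Since (1 - F) has no t⁰-term, (1-F)^k only contributes to t^n for k ≤ n,
-- so the coefficient of t^n is the finite sum below (exact, not a truncation).
inv : Series → Series
inv F n a b = Σ≤ n λ k → ((oneS ⊖ F) ^S k) n a b

-- G^x for a series G whose t⁰-part is 1:  G^x = Σ_{k≥0} (x choose k) (G - 1)^k.
-- Again only k ≤ n contributes to the coefficient of t^n.
powX : Series → Series
powX G n a b = Σ≤ n λ k → (binomX k ⊛ ((G ⊖ oneS) ^S k)) n a b

-- NM_Γ(t,x,y) = 1 + Σ_{n≥1} tⁿ/n! Σ_{σ∈𝒩ℳₙ(Γ)} x^{LRmin σ} y^{1+des σ}

NMSeries : List (List ℕ) → Series
NMSeries Γ zero    a b = const 1ℚ 0 a b
NMSeries Γ (suc n) a b =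
  (+ length (filterᵇ (λ σ → (LRmin σ ≡ᵇ a) ∧ (suc (des σ) ≡ᵇ b)) (NM Γ (suc n)))
    ℚ./ (suc n !)) {{suc n !≢0}}

-- Polynomials in y with integer coefficients: p b = [y^b] p

Poly : Set
Poly = ℕ → ℤ

zeroP : Poly
zeroP _ = + 0

oneP : Poly
oneP zero    = + 1
oneP (suc _) = + 0

infixl 6 _⊞_
_⊞_ : Poly → Poly → Poly
(p ⊞ q) b = p b ℤ.+ q b

negY : Poly → Poly
negY p zero    = + 0
negY p (suc b) = ℤ.- p b

negY^ : ℕ → Poly → Poly
negY^ zero    p = p
negY^ (suc k) p = negY (negY^ k p)

scaleP : ℕ → Poly → Poly
scaleP c p b = + c ℤ.* p b

catalan : ℕ → ℕ
catalan m = ((2 ℕ.* m) C m) ℕ./ suc m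

ΣP : ℕ → ℕ → (ℕ → Poly) → Poly
ΣP lo zero    f = if lo ≡ᵇ 0 then f 0 else zeroP
ΣP lo (suc h) f = if lo ℕ.<ᵇ suc (suc h) then ΣP lo h f ⊞ f (suc h) else zeroP

at : List Poly → ℕ → Poly
at []       _       = zeroP
at (p ∷ ps) zero    = p
at (p ∷ ps) (suc j) = at ps j

-- Us n = U_n ∷ U_{n-1} ∷ ⋯ ∷ U_0 ∷ []; in Us n, the polynomial U_{n-j} sits
-- at position j, and positions beyond the list give U_j = 0 for j < 0.
Us : ℕ → List Poly
Us zero          = oneP ∷ []
Us (suc zero)    = negY oneP ∷ Us zero
Us (suc (suc m)) =
  let n = suc (suc m)
      L = Us (suc m)
      Un = negY (at L 0) ⊞ negY (at L 1)
           ⊞ ΣP 2 ⌊ n /2⌋ (λ k → negY^ k (scaleP (catalan (k ∸ 1)) (at L (2 ℕ.* k ∸ 1))))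
  in Un ∷ L

U : ℕ → Poly
U n = at (Us n) 0

USeries : Series
USeries zero    a b = const 1ℚ 0 a b
USeries (suc n) zero    b = (U (suc n) b ℚ./ (suc n !)) {{suc n !≢0}}
USeries (suc n) (suc a) b = 0ℚ

{-# OPTIONS --safe #-}
module Submission where

-- Call a single letter, or two consecutive letters forming an ascent, a brick
-- (f , l) with first letter f and last letter l, and write (f , l) ≺ (f′ , l′)
-- when f < f′ and l < l′.  A word avoids 123 and 1324 exactly when its ascending
-- runs are bricks no two consecutive of which are related by ≺, and 1 + des is
-- the number of runs.  As in the theorem of Carlitz, Scoville and Vaughan, the
-- generating function by number of bricks of such words is therefore reciprocal
-- to the signed one of the words read as bricks all consecutive pairs of which
-- are related by ≺.  Reading the values of the latter in increasing order, each
-- value is a single, opens a pair or closes the earliest open pair; cutting this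
-- lattice path at its first return to height 0 gives the Catalan recurrence for U.
--
-- Since both patterns start with their least letter, cutting a word before its
-- minimum is multiplicative for the weight x^LRmin y^(1 + des).  Hence the
-- logarithmic derivative of NM(t, x, y) is x times that of NM(t, 1, y) = 1/U,
-- which is the differential equation satisfied by the binomial series (1/U)^x.

open import Defs
open import Data.Nat using (ℕ)
open import Relation.Binary.PropositionalEquality using (_≡_)

open import Algebra.Bundles using (CommutativeRing)
open import Data.Bool using (Bool; true; false; not; _∧_; _∨_; if_then_else_)
import Data.Bool.Properties as Boolₚ
open import Data.Empty using (⊥-elim)
open import Data.List using (List; []; _∷_; _++_; [_]; map; concatMap; length; filterᵇ; applyUpTo)
open import Data.List.Properties using (length-applyUpTo)
open import Data.List.Relation.Binary.Permutation.Propositional using (_↭_; prep; swap; ↭-refl; ↭-sym; ↭-trans; ↭⇒↭ₛ)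
open import Data.List.Relation.Binary.Permutation.Propositional.Properties using (All-resp-↭; ↭-length)
import Data.List.Relation.Binary.Permutation.Setoid.Properties as Permₛ
open import Data.List.Relation.Binary.Sublist.Propositional using (_⊆_; []; _∷_; _∷ʳ_; ⊆-refl)
open import Data.List.Relation.Binary.Sublist.Propositional.Properties using (All-resp-⊆; length-mono-≤)
open import Data.List.Relation.Unary.All as All using (All; []; _∷_)
import Data.List.Relation.Unary.All.Properties as Allₚ
open import Data.List.Relation.Unary.AllPairs as AllPairs using (AllPairs; []; _∷_)
import Data.List.Relation.Unary.AllPairs.Properties as AllPairsₚ
open import Data.List.Relation.Unary.Any as Any using (Any; here; there)
open import Data.Nat as ℕ using (zero; suc; _∸_; _<ᵇ_; _≡ᵇ_; _<_; _≤_; z≤n; s≤s)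
import Data.Nat.Properties as ℕₚ
open import Data.Product using (_×_; _,_; proj₁; uncurry)
open import Data.Sum using (inj₁; inj₂)
open import Function using (_∘_)
open import Function.Bundles using (Equivalence)
open import Level using (0ℓ)
open import Relation.Binary.Definitions using (tri<; tri≈; tri>)
open import Relation.Binary.PropositionalEquality as ≡ using (_≢_; _≗_)
import Relation.Binary.Reasoning.Setoid as SetoidReasoning

-- Everything is counted over an arbitrary finite set of letters, not only over 1, ..., n, because
-- cutting a word leaves words over subsets that are no initial segment. The sums turn out to depend
-- only on the size of the set, and a sum over the splittings of a set into two parts is then a
-- product of exponential generating functions. Each unknown sum is pinned down by a convolution
-- equation whose known factor has constant term 1. `egf` multiplies coefficients by factorials
-- instead of dividing counts, so this combinatorics works in any commutative ring; fractions appear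
-- only when the series of the statement are compared with it. On the analytic side `inv` and `powX`
-- are finite sums in each degree, and no logarithm or exponential is at hand. Reciprocal and power
-- are therefore handled through truncations whose remainders have high order, and the power is used
-- only through its differential equation and its constant term. The sentinel brick (0 , 0) links
-- the two kinds of sequences of bricks: it is ≺-below all bricks of positive letters, so it
-- constrains no chain and excludes every nonempty antichain.

private
  variable
    A B : Set

-- Power series over a commutative ring

Ring₀ : Set₁
Ring₀ = CommutativeRing 0ℓ 0ℓ

module FiniteSums (R : Ring₀) where
  open CommutativeRing R

  -- Same bracketing as Σ≤ of Defs.
  ∑ : ℕ → (ℕ → Carrier) → Carrier
  ∑ zero    f = f 0
  ∑ (suc n) f = ∑ n f + f (suc n)

  ∑-head : ∀ n (f : ℕ → Carrier) → ∑ (suc n) f ≈ f 0 + ∑ n (f ∘ suc)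
  ∑-head zero    f = refl
  ∑-head (suc n) f = trans (+-congʳ (∑-head n f)) (+-assoc _ _ _)

module PowerSeries (R : Ring₀) where
  open CommutativeRing R
  open SetoidReasoning setoid
  open FiniteSums R
  open import Algebra.Solver.Ring.NaturalCoefficients.Default commutativeSemiring using (solve; _:+_; _:*_; _:=_)

  PS : Set
  PS = ℕ → Carrier

  infix  4 _≋_
  infixl 7 _·_

  _≋_ : PS → PS → Set
  F ≋ G = ∀ n → F n ≈ G n

  one : PS
  one zero    = 1#
  one (suc _) = 0#

  -- Peeling off the first coefficient of the left factor turns the ring laws into inductions on the
  -- degree; `·-∑` recovers the usual convolution.
  _·_ : PS → PS → PS
  (F · G) zero    = F 0 * G 0
  (F · G) (suc n) = F 0 * G (suc n) + ((F ∘ suc) · G) n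

  ·-∑ : ∀ F G n → (F · G) n ≈ ∑ n (λ i → F i * G (n ∸ i))
  ·-∑ F G zero    = refl
  ·-∑ F G (suc n) = trans (+-congˡ (·-∑ (F ∘ suc) G n)) (sym (∑-head n _))

  ·-cong≤ : ∀ {F F′ G G′} n → (∀ i → i ℕ.≤ n → F i ≈ F′ i) → (∀ i → i ℕ.≤ n → G i ≈ G′ i) →
            (F · G) n ≈ (F′ · G′) n
  ·-cong≤ zero    p q = *-cong (p 0 ℕ.z≤n) (q 0 ℕ.z≤n)
  ·-cong≤ (suc n) p q = +-cong (*-cong (p 0 ℕ.z≤n) (q (suc n) ℕₚ.≤-refl))
    (·-cong≤ n (λ i i≤n → p (suc i) (ℕ.s≤s i≤n)) (λ i i≤n → q i (ℕₚ.m≤n⇒m≤1+n i≤n)))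

  ·-cong : ∀ {F F′ G G′} → F ≋ F′ → G ≋ G′ → (F · G) ≋ (F′ · G′)
  ·-cong p q n = ·-cong≤ n (λ i _ → p i) (λ i _ → q i)

  ·-zeroˡ : ∀ F → (λ _ → 0#) · F ≋ (λ _ → 0#)
  ·-zeroˡ F zero    = zeroˡ _
  ·-zeroˡ F (suc n) = trans (+-cong (zeroˡ _) (·-zeroˡ F n)) (+-identityˡ _)

  ·-distribʳ : ∀ F G H → (λ n → G n + H n) · F ≋ (λ n → (G · F) n + (H · F) n)
  ·-distribʳ F G H zero    = distribʳ _ _ _
  ·-distribʳ F G H (suc n) = trans (+-congˡ (·-distribʳ F (G ∘ suc) (H ∘ suc) n))
    (solve 5 (λ g h f p q → (g :+ h) :* f :+ (p :+ q) := (g :* f :+ p) :+ (h :* f :+ q)) refl _ _ _ _ _)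

  ·-scaleˡ : ∀ c F G → (λ n → c * F n) · G ≋ (λ n → c * (F · G) n)
  ·-scaleˡ c F G zero    = *-assoc _ _ _
  ·-scaleˡ c F G (suc n) = trans (+-congˡ (·-scaleˡ c (F ∘ suc) G n))
    (solve 4 (λ c f g p → (c :* f) :* g :+ c :* p := c :* (f :* g :+ p)) refl _ _ _ _)

  ·-suc′ : ∀ F G n → (F · G) (suc n) ≈ (F · (G ∘ suc)) n + F (suc n) * G 0
  ·-suc′ F G zero    = refl
  ·-suc′ F G (suc n) = trans (+-congˡ (·-suc′ (F ∘ suc) G n)) (sym (+-assoc _ _ _))

  ·-comm : ∀ F G → F · G ≋ G · F
  ·-comm F G zero    = *-comm _ _
  ·-comm F G (suc n) = begin
    F 0 * G (suc n) + ((F ∘ suc) · G) n ≈⟨ +-comm _ _ ⟩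
    ((F ∘ suc) · G) n + F 0 * G (suc n) ≈⟨ +-cong (·-comm (F ∘ suc) G n) (*-comm _ _) ⟩
    (G · (F ∘ suc)) n + G (suc n) * F 0 ≈⟨ ·-suc′ G F n ⟨
    (G · F) (suc n)                     ∎

  ·-assoc : ∀ F G H → (F · G) · H ≋ F · (G · H)
  ·-assoc F G H zero    = *-assoc _ _ _
  ·-assoc F G H (suc n) = begin
    (F 0 * G 0) * H (suc n) + ((λ i → F 0 * G (suc i) + ((F ∘ suc) · G) i) · H) n
      ≈⟨ +-congˡ (·-distribʳ H (λ i → F 0 * G (suc i)) ((F ∘ suc) · G) n) ⟩
    (F 0 * G 0) * H (suc n) + (((λ i → F 0 * G (suc i)) · H) n + (((F ∘ suc) · G) · H) n)
      ≈⟨ +-congˡ (+-cong (·-scaleˡ (F 0) (G ∘ suc) H n) (·-assoc (F ∘ suc) G H n)) ⟩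
    (F 0 * G 0) * H (suc n) + (F 0 * ((G ∘ suc) · H) n + ((F ∘ suc) · (G · H)) n)
      ≈⟨ solve 5 (λ f g h p q → (f :* g) :* h :+ (f :* p :+ q) := f :* (g :* h :+ p) :+ q) refl _ _ _ _ _ ⟩
    F 0 * (G 0 * H (suc n) + ((G ∘ suc) · H) n) + ((F ∘ suc) · (G · H)) n ∎

  ·-identityˡ : ∀ F → one · F ≋ F
  ·-identityˡ F zero    = *-identityˡ _
  ·-identityˡ F (suc n) = trans (+-cong (*-identityˡ _) (·-zeroˡ F n)) (+-identityʳ _)

  commutativeRing : Ring₀
  commutativeRing = record
    { Carrier = PS
    ; _≈_     = _≋_
    ; _+_     = λ F G n → F n + G n
    ; _*_     = _·_
    ; -_      = λ F n → - F n
    ; 0#      = λ _ → 0#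
    ; 1#      = one
    ; isCommutativeRing = record
      { isRing = record
        { +-isAbelianGroup = record
          { isGroup = record
            { isMonoid = record
              { isSemigroup = record
                { isMagma = record
                  { isEquivalence = record
                    { refl  = λ _ → refl
                    ; sym   = λ p n → sym (p n)
                    ; trans = λ p q n → trans (p n) (q n)
                    }
                  ; ∙-cong = λ p q n → +-cong (p n) (q n)
                  }
                ; assoc = λ F G H n → +-assoc _ _ _
                }
              ; identity = (λ F n → +-identityˡ _) , (λ F n → +-identityʳ _)
              }
            ; inverse = (λ F n → -‿inverseˡ _) , (λ F n → -‿inverseʳ _)
            ; ⁻¹-cong = λ p n → -‿cong (p n)
            }
          ; comm = λ F G n → +-comm _ _
          }
        ; *-cong     = ·-cong
        ; *-assoc    = ·-assoc
        ; *-identity = ·-identityˡ , (λ F n → trans (·-comm F one n) (·-identityˡ F n))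
        ; distrib    = (λ F G H n → trans (·-comm F _ n) (trans (·-distribʳ F G H n)
                          (+-cong (·-comm G F n) (·-comm H F n))))
                     , ·-distribʳ
        }
      ; *-comm = ·-comm
      }
    }

-- Derivations, reciprocals and binomial series

module NaturalMultiples (R : Ring₀) where
  open CommutativeRing R

  nat : ℕ → Carrier
  nat zero    = 0#
  nat (suc n) = 1# + nat n

module Exponential (K : Ring₀) where
  open CommutativeRing K
  open FiniteSums K
  open PowerSeries K
  open NaturalMultiples K
  open NaturalMultiples commutativeRing using () renaming (nat to natₛ)
  open import Algebra.Solver.Ring.NaturalCoefficients.Default commutativeSemiring using (solve; _:+_; _:*_; _:=_; con)
  module S = CommutativeRing commutativeRing
  module SSolver where
    open import Algebra.Solver.Ring.NaturalCoefficients.Default S.commutativeSemiring public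

  -- The Euler operator t d/dt preserves degrees, so its Leibniz rule follows the recursion of
  -- `_·_`. The rule for `D` is the same identity read one degree higher.
  θ : PS → PS
  θ F n = nat n * F n

  D : PS → PS
  D F = θ F ∘ suc

  θ-· : ∀ F G → θ (F · G) ≋ θ F · G S.+ F · θ G
  θ-· F G zero    = solve 2 (λ f g → con 0 :* (f :* g) := con 0 :* f :* g :+ f :* (con 0 :* g)) refl _ _
  θ-· F G (suc n) = begin
    (1# + nat n) * (F 0 * G (suc n) + F′G)
      ≈⟨ solve 4 (λ k f g p → (con 1 :+ k) :* (f :* g :+ p) := f :* ((con 1 :+ k) :* g) :+ (p :+ k :* p)) refl _ _ _ _ ⟩
    F 0 * θ G (suc n) + (F′G + nat n * F′G)
      ≈⟨ +-congˡ (+-congˡ (θ-· F′ G n)) ⟩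
    F 0 * θ G (suc n) + (F′G + ((θ F′ · G) n + (F′ · θ G) n))
      ≈⟨ solve 5 (λ f g p q r → f :* g :+ (p :+ (q :+ r)) := con 0 :* f :* g :+ (p :+ q) :+ (f :* g :+ r)) refl _ _ _ _ _ ⟩
    0# * F 0 * θ G (suc n) + (F′G + (θ F′ · G) n) + (F 0 * θ G (suc n) + (F′ · θ G) n)
      ≈⟨ +-congʳ (+-cong lem (trans (sym (S.distribʳ G F′ (θ F′) n))
           (·-cong (λ i → solve 2 (λ k f → f :+ k :* f := (con 1 :+ k) :* f) refl _ _) (λ _ → refl) n))) ⟩
    0# * F 0 * G (suc n) + ((θ F ∘ suc) · G) n + (F 0 * θ G (suc n) + (F′ · θ G) n) ∎
    where
    open SetoidReasoning setoid
    F′ = F ∘ suc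
    F′G = (F′ · G) n
    lem = solve 3 (λ f g h → con 0 :* f :* g := con 0 :* f :* h) refl (F 0) (θ G (suc n)) (G (suc n))

  D-· : ∀ F G → D (F · G) ≋ D F · G S.+ F · D G
  D-· F G n = begin
    θ (F · G) (suc n)                               ≈⟨ θ-· F G (suc n) ⟩
    (θ F · G) (suc n) + (F · θ G) (suc n)           ≈⟨ +-congˡ (·-suc′ F (θ G) n) ⟩
    0# * F 0 * G (suc n) + (D F · G) n + ((F · D G) n + F (suc n) * (0# * G 0))
      ≈⟨ solve 6 (λ a b c d p q → con 0 :* a :* b :+ p :+ (q :+ c :* (con 0 :* d)) := p :+ q) refl _ _ _ _ _ _ ⟩
    (D F · G) n + (F · D G) n                       ∎
    where open SetoidReasoning setoid

  D-+ : ∀ F G → D (F S.+ G) ≋ D F S.+ D G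
  D-+ F G n = distribˡ _ _ _

  D-cong : ∀ {F G} → F ≋ G → D F ≋ D G
  D-cong p n = *-congˡ (p (suc n))

  D-one : D one ≋ S.0#
  D-one n = zeroʳ _

  infixr 8 _^_
  _^_ : PS → ℕ → PS
  F ^ zero  = one
  F ^ suc k = F · F ^ k

  D-^ : ∀ F k → D (F ^ suc k) ≋ natₛ (suc k) · (F ^ k · D F)
  D-^ F zero    = begin
    D (F · one)                              ≈⟨ D-cong (S.*-identityʳ F) ⟩
    D F                                      ≈⟨ SSolver.solve 1 (λ d → d SSolver.:= (SSolver.con 1 SSolver.:+ SSolver.con 0) SSolver.:* (SSolver.con 1 SSolver.:* d)) S.refl (D F) ⟩
    natₛ 1 · (one · D F) ∎
    where open SetoidReasoning S.setoid
  D-^ F (suc k) = begin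
    D (F · F ^ suc k)                                          ≈⟨ D-· F (F ^ suc k) ⟩
    D F · F ^ suc k S.+ F · D (F ^ suc k)                      ≈⟨ S.+-congˡ (·-cong (S.refl {F}) (D-^ F k)) ⟩
    D F · (F · F ^ k) S.+ F · (natₛ (suc k) · (F ^ k · D F))
      ≈⟨ solve′ 4 (λ d f p m → d :*′ (f :*′ p) :+′ f :*′ (m :*′ (p :*′ d)) :=′ (con′ 1 :+′ m) :*′ ((f :*′ p) :*′ d)) S.refl _ _ _ _ ⟩
    natₛ (2 ℕ.+ k) · (F ^ suc k · D F)                         ∎
    where
    open SetoidReasoning S.setoid
    open SSolver using () renaming (solve to solve′; _:*_ to _:*′_; _:+_ to _:+′_; _:=_ to _:=′_; con to con′)

  Ord : ℕ → PS → Set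
  Ord k F = ∀ n → n ℕ.< k → F n ≈ 0#

  ord-·ʳ : ∀ {k} F {G} → Ord k G → Ord k (F · G)
  ord-·ʳ F o n n<k = trans (·-cong≤ n (λ _ _ → refl) (λ i i≤n → o i (ℕₚ.≤-<-trans i≤n n<k))) (S.zeroʳ F n)

  ord-·ˡ : ∀ {k F} G → Ord k F → Ord k (F · G)
  ord-·ˡ {F = F} G o n n<k = trans (·-comm F G n) (ord-·ʳ G o n n<k)

  ord-·-suc : ∀ {k F G} → F 0 ≈ 0# → Ord k G → Ord (suc k) (F · G)
  ord-·-suc z o zero    _ = trans (*-congʳ z) (zeroˡ _)
  ord-·-suc {F = F} z o (suc n) (ℕ.s≤s n<k) =
    trans (+-cong (trans (*-congʳ z) (zeroˡ _)) (ord-·ʳ (F ∘ suc) o n n<k)) (+-identityʳ _)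

  ord-^ : ∀ {F} → F 0 ≈ 0# → ∀ k → Ord k (F ^ k)
  ord-^ z zero    _ ()
  ord-^ z (suc k) = ord-·-suc z (ord-^ z k)

  partial : (ℕ → PS) → ℕ → PS
  partial f N n = ∑ N (λ k → f k n)

  -- When `f k` has order at least k, the summands after index n do not reach degree n, so this
  -- diagonal is the whole infinite sum. It has the shape of `inv` and `powX`.
  total : (ℕ → PS) → PS
  total f n = partial f n n

  partial-total : ∀ f → (∀ k → Ord k (f k)) → ∀ N n → n ℕ.≤ N → partial f N n ≈ total f n
  partial-total f o zero    zero ℕ.z≤n = refl
  partial-total f o (suc N) n n≤1+N with ℕₚ.m≤n⇒m<n∨m≡n n≤1+N
  ... | inj₁ n<1+N  = trans (+-cong (partial-total f o N n (ℕₚ.≤-pred n<1+N)) (o (suc N) n n<1+N)) (+-identityʳ _)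
  ... | inj₂ ≡.refl = refl

  module _ {U : PS} (U₀ : U 0 ≈ 1#) where
    private
      H : PS
      H = one S.+ (S.- U)

    geometric : PS
    geometric = total (H ^_)

    private
      H₀ : H 0 ≈ 0#
      H₀ = trans (+-congˡ (-‿cong U₀)) (-‿inverseʳ 1#)

      U+H : U S.+ H ≋ one
      U+H n = begin
        U n + (one n + - U n) ≈⟨ solve 3 (λ u o v → u :+ (o :+ v) := o :+ (u :+ v)) refl _ _ _ ⟩
        one n + (U n + - U n) ≈⟨ +-congˡ (-‿inverseʳ _) ⟩
        one n + 0#            ≈⟨ +-identityʳ _ ⟩
        one n                 ∎
        where open SetoidReasoning setoid

      -- Telescoping with U = 1 - H; the remainder H^(N + 1) is kept on the left.
      partial-geometric : ∀ N → U · partial (H ^_) N S.+ H ^ suc N ≋ one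
      partial-geometric zero    = S.trans (S.sym (S.distribʳ one U H)) (S.trans (S.*-identityʳ (U S.+ H)) U+H)
      partial-geometric (suc N) = begin
        U · (partial (H ^_) N S.+ H ^ suc N) S.+ H · H ^ suc N
          ≈⟨ solve′ 4 (λ u h p q → u :*′ (p :+′ q) :+′ h :*′ q :=′ u :*′ p :+′ (u :+′ h) :*′ q) S.refl U H _ _ ⟩
        U · partial (H ^_) N S.+ (U S.+ H) · H ^ suc N
          ≈⟨ S.+-congˡ {U · partial (H ^_) N} (S.trans (·-cong U+H (S.refl {H ^ suc N})) (·-identityˡ (H ^ suc N))) ⟩
        U · partial (H ^_) N S.+ H ^ suc N
          ≈⟨ partial-geometric N ⟩
        one ∎
        where
        open SetoidReasoning S.setoid
        open SSolver using () renaming (solve to solve′; _:*_ to _:*′_; _:+_ to _:+′_; _:=_ to _:=′_)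

    geometric-inverse : U · geometric ≋ one
    geometric-inverse n = begin
      (U · geometric) n
        ≈⟨ ·-cong≤ n (λ _ _ → refl) (λ i i≤n → sym (partial-total (H ^_) (ord-^ H₀) n i i≤n)) ⟩
      (U · partial (H ^_) n) n
        ≈⟨ +-identityʳ _ ⟨
      (U · partial (H ^_) n) n + 0#
        ≈⟨ +-congˡ (ord-^ H₀ (suc n) n ℕₚ.≤-refl) ⟨
      (U · partial (H ^_) n) n + (H ^ suc n) n
        ≈⟨ partial-geometric n n ⟩
      one n ∎
      where open SetoidReasoning setoid

  -- The binomial coefficients β k = (X choose k) enter only through
  -- (k + 1) β (k + 1) = (X - k) β k, stated without subtraction.
  module Binomial
    (X : PS) (β : ℕ → PS) (β₀ : β 0 ≋ one) (Dβ : ∀ k → D (β k) ≋ S.0#)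
    (β-rec : ∀ k → natₛ (suc k) · β (suc k) S.+ natₛ k · β k ≋ X · β k)
    {B : PS} (B₀ : B 0 ≈ 1#)
    where
    private
      H : PS
      H = B S.+ (S.- one)

      term : ℕ → PS
      term k = β k · H ^ k

    power : PS
    power = total term

    private
      H₀ : H 0 ≈ 0#
      H₀ = trans (+-congʳ B₀) (-‿inverseʳ 1#)

      B≋1+H : B ≋ one S.+ H
      B≋1+H n = sym (begin
        one n + (B n + - one n) ≈⟨ solve 3 (λ u o v → u :+ (o :+ v) := o :+ (u :+ v)) refl _ _ _ ⟩
        B n + (one n + - one n) ≈⟨ +-congˡ (-‿inverseʳ _) ⟩
        B n + 0#                ≈⟨ +-identityʳ _ ⟩
        B n                     ∎)
        where open SetoidReasoning setoid

      DB≋DH : D B ≋ D H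
      DB≋DH = begin
        D B               ≈⟨ D-cong B≋1+H ⟩
        D (one S.+ H)     ≈⟨ D-+ one H ⟩
        D one S.+ D H     ≈⟨ S.+-congʳ {D H} D-one ⟩
        S.0# S.+ D H      ≈⟨ S.+-identityˡ (D H) ⟩
        D H               ∎
        where open SetoidReasoning S.setoid

      ord-term : ∀ k → Ord k (term k)
      ord-term k = ord-·ʳ (β k) (ord-^ H₀ k)

      D-term : ∀ k → D (term k) ≋ β k · D (H ^ k)
      D-term k = begin
        D (β k · H ^ k)                       ≈⟨ D-· (β k) (H ^ k) ⟩
        D (β k) · H ^ k S.+ β k · D (H ^ k)   ≈⟨ S.+-congʳ {β k · D (H ^ k)} (S.trans (·-cong (Dβ k) (S.refl {H ^ k})) (S.zeroˡ (H ^ k))) ⟩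
        S.0# S.+ β k · D (H ^ k)              ≈⟨ S.+-identityˡ (β k · D (H ^ k)) ⟩
        β k · D (H ^ k)                       ∎
        where open SetoidReasoning S.setoid

      remainder : ℕ → PS
      remainder N = (natₛ (suc N) · β (suc N)) · H ^ N · D H

      ord-remainder : ∀ N → Ord N (remainder N)
      ord-remainder N = ord-·ˡ (D H) (ord-·ʳ (natₛ (suc N) · β (suc N)) (ord-^ H₀ N))

      open SSolver using () renaming (solve to solve′; _:*_ to _:*′_; _:+_ to _:+′_; _:=_ to _:=′_; con to con′)

      -- By `β-rec` both sides have the same multiple of H^k H′ for every k ≤ N, provided that (N +
      -- 1) β (N + 1) H^N H′ is added on the left: it would come from the derivative of the first
      -- omitted term.
      partial-ode : ∀ N → (one S.+ H) · D (partial term N) S.+ remainder N ≋ X · D H · partial term N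
      partial-ode zero = begin
        (one S.+ H) · D (term 0) S.+ remainder 0
          ≈⟨ S.+-congʳ {remainder 0} (·-cong (S.refl {one S.+ H}) (S.trans (D-term 0)
               (S.trans (·-cong (S.refl {β 0}) D-one) (S.zeroʳ (β 0))))) ⟩
        (one S.+ H) · S.0# S.+ (natₛ 1 · β 1) · one · D H
          ≈⟨ solve′ 4 (λ h p q d → (con′ 1 :+′ h) :*′ con′ 0 :+′ p :*′ con′ 1 :*′ d :=′ (p :+′ con′ 0 :*′ q) :*′ d) S.refl H (natₛ 1 · β 1) (β 0) (D H) ⟩
        (natₛ 1 · β 1 S.+ natₛ 0 · β 0) · D H
          ≈⟨ ·-cong (β-rec 0) (S.refl {D H}) ⟩
        X · β 0 · D H
          ≈⟨ solve′ 3 (λ x b d → x :*′ b :*′ d :=′ x :*′ d :*′ (b :*′ con′ 1)) S.refl X (β 0) (D H) ⟩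
        X · D H · (β 0 · one) ∎
        where open SetoidReasoning S.setoid
      partial-ode (suc N) = begin
        (one S.+ H) · D (partial term N S.+ term (suc N)) S.+ remainder (suc N)
          ≈⟨ S.+-congʳ {remainder (suc N)} (·-cong (S.refl {one S.+ H}) (S.trans (D-+ (partial term N) (term (suc N)))
               (S.+-congˡ {D (partial term N)} (S.trans (D-term (suc N)) (·-cong (S.refl {β (suc N)}) (D-^ H N)))))) ⟩
        (one S.+ H) · (D (partial term N) S.+ β (suc N) · (natₛ (suc N) · (H ^ N · D H))) S.+ remainder (suc N)
          ≈⟨ solve′ 7 (λ h s b n p d r → (con′ 1 :+′ h) :*′ (s :+′ b :*′ (n :*′ (p :*′ d))) :+′ r :*′ (h :*′ p) :*′ d
                 :=′ ((con′ 1 :+′ h) :*′ s :+′ n :*′ b :*′ p :*′ d) :+′ (r :+′ n :*′ b) :*′ ((h :*′ p) :*′ d)) S.refl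
                 H (D (partial term N)) (β (suc N)) (natₛ (suc N)) (H ^ N) (D H) (natₛ (2 ℕ.+ N) · β (2 ℕ.+ N)) ⟩
        ((one S.+ H) · D (partial term N) S.+ remainder N)
          S.+ (natₛ (2 ℕ.+ N) · β (2 ℕ.+ N) S.+ natₛ (suc N) · β (suc N)) · (H ^ suc N · D H)
          ≈⟨ S.+-cong (partial-ode N) (·-cong (β-rec (suc N)) (S.refl {H ^ suc N · D H})) ⟩
        X · D H · partial term N S.+ X · β (suc N) · (H ^ suc N · D H)
          ≈⟨ solve′ 5 (λ x d s b p → x :*′ d :*′ s :+′ x :*′ b :*′ (p :*′ d) :=′ x :*′ d :*′ (s :+′ b :*′ p)) S.refl
                 X (D H) (partial term N) (β (suc N)) (H ^ suc N) ⟩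
        X · D H · partial term (suc N) ∎
        where open SetoidReasoning S.setoid

    power-ode : B · D power ≋ X · D B · power
    power-ode n = begin
      (B · D power) n
        -- `D` reads one degree higher, so the truncation has to agree with `power` up to degree n +
        -- 1. The remainder of index n + 1 is then invisible in degree n.
        ≈⟨ ·-cong≤ n (λ i _ → B≋1+H i) (λ i i≤n → *-congˡ (sym (agree (suc i) (ℕ.s≤s i≤n)))) ⟩
      ((one S.+ H) · D (partial term (suc n))) n
        ≈⟨ +-identityʳ _ ⟨
      ((one S.+ H) · D (partial term (suc n))) n + 0#
        ≈⟨ +-congˡ (ord-remainder (suc n) n ℕₚ.≤-refl) ⟨
      ((one S.+ H) · D (partial term (suc n))) n + remainder (suc n) n
        ≈⟨ partial-ode (suc n) n ⟩
      (X · D H · partial term (suc n)) n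
        ≈⟨ ·-cong≤ n (λ i _ → ·-cong (S.refl {X}) (S.sym DB≋DH) i) (λ i i≤n → agree i (ℕₚ.m≤n⇒m≤1+n i≤n)) ⟩
      (X · D B · power) n ∎
      where
      open SetoidReasoning setoid
      agree : ∀ i → i ℕ.≤ suc n → partial term (suc n) i ≈ power i
      agree = partial-total term ord-term (suc n)

    power-log-derivative : ∀ {U} → U · B ≋ one → D power ≋ X · (U · D B) · power
    power-log-derivative {U} UB = begin
      D power                 ≈⟨ ·-identityˡ (D power) ⟨
      one · D power           ≈⟨ ·-cong UB (S.refl {D power}) ⟨
      U · B · D power         ≈⟨ ·-assoc U B (D power) ⟩
      U · (B · D power)       ≈⟨ ·-cong (S.refl {U}) power-ode ⟩
      U · (X · D B · power)   ≈⟨ solve′ 4 (λ u x d p → u :*′ (x :*′ d :*′ p) :=′ x :*′ (u :*′ d) :*′ p) S.refl U X (D B) power ⟩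
      X · (U · D B) · power   ∎
      where open SetoidReasoning S.setoid

-- Arrangements of finite sets

ins : A → List A → List (List A)
ins m []      = [ m ] ∷ []
ins m (h ∷ t) = (m ∷ h ∷ t) ∷ map (h ∷_) (ins m t)

-- The head is inserted last. For an ascending list, the least letter thus enters a finished
-- arrangement of the larger ones, which is the induction behind the counts below.
arr : List A → List (List A)
arr []      = [] ∷ []
arr (m ∷ S) = concatMap (ins m) (arr S)

cuts : List A → List (List A × List A)
cuts []      = ([] , []) ∷ []
cuts (h ∷ t) = ([] , h ∷ t) ∷ map (λ (a , b) → h ∷ a , b) (cuts t)

splits : List A → List (List A × List A)
splits []      = ([] , []) ∷ []
splits (x ∷ S) = map (λ (T , T′) → x ∷ T , T′) (splits S) ++ map (λ (T , T′) → T , x ∷ T′) (splits S)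

ins-↭ : ∀ (m : A) w → All (λ z → z ↭ m ∷ w) (ins m w)
ins-↭ m []      = ↭-refl ∷ []
ins-↭ m (h ∷ t) = ↭-refl ∷ Allₚ.map⁺ (All.map (λ p → ↭-trans (prep h p) (swap h m ↭-refl)) (ins-↭ m t))

arr-↭ : ∀ (S : List A) → All (_↭ S) (arr S)
arr-↭ []      = ↭-refl ∷ []
arr-↭ (m ∷ S) = Allₚ.concat⁺ (Allₚ.map⁺ (All.map (λ {w} p → All.map (λ q → ↭-trans q (prep m p)) (ins-↭ m w)) (arr-↭ S)))

splits-⊆ : ∀ (S : List A) → All (λ (T , T′) → T ⊆ S × T′ ⊆ S) (splits S)
splits-⊆ []      = ([] , []) ∷ []
splits-⊆ (x ∷ S) = Allₚ.++⁺
  (Allₚ.map⁺ (All.map (λ (p , q) → ≡.refl ∷ p , x ∷ʳ q) (splits-⊆ S)))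
  (Allₚ.map⁺ (All.map (λ (p , q) → x ∷ʳ p , ≡.refl ∷ q) (splits-⊆ S)))

module ListSums (R : Ring₀) where
  open CommutativeRing R
  open SetoidReasoning setoid
  open import Algebra.Solver.Ring.NaturalCoefficients.Default commutativeSemiring using (solve; _:+_; _:*_; _:=_; con)

  ⟦_⟧ : Bool → Carrier
  ⟦ b ⟧ = if b then 1# else 0#

  ⟦not-∨⟧ : ∀ p q → ⟦ not (p ∨ q) ⟧ ≈ ⟦ not p ⟧ * ⟦ not q ⟧
  ⟦not-∨⟧ true  q = sym (zeroˡ _)
  ⟦not-∨⟧ false q = sym (*-identityˡ _)

  ⟦∧⟧ : ∀ p q → ⟦ p ∧ q ⟧ ≈ ⟦ p ⟧ * ⟦ q ⟧
  ⟦∧⟧ true  q = sym (*-identityˡ _)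
  ⟦∧⟧ false q = sym (zeroˡ _)

  sumL : List A → (A → Carrier) → Carrier
  sumL []       f = 0#
  sumL (x ∷ xs) f = f x + sumL xs f

  sumL-congᴬ : ∀ {xs : List A} {f g : A → Carrier} → All (λ x → f x ≈ g x) xs → sumL xs f ≈ sumL xs g
  sumL-congᴬ []       = refl
  sumL-congᴬ (p ∷ ps) = +-cong p (sumL-congᴬ ps)

  sumL-cong : ∀ (xs : List A) {f g : A → Carrier} → (∀ x → f x ≈ g x) → sumL xs f ≈ sumL xs g
  sumL-cong xs e = sumL-congᴬ (All.universal e xs)

  sumL-0ᴬ : ∀ {xs : List A} {f : A → Carrier} → All (λ x → f x ≈ 0#) xs → sumL xs f ≈ 0#
  sumL-0ᴬ []       = refl
  sumL-0ᴬ (p ∷ ps) = trans (+-cong p (sumL-0ᴬ ps)) (+-identityʳ _)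

  sumL-map : ∀ (xs : List A) (h : A → B) f → sumL (map h xs) f ≈ sumL xs (f ∘ h)
  sumL-map []       h f = refl
  sumL-map (x ∷ xs) h f = +-congˡ (sumL-map xs h f)

  sumL-++ : ∀ (xs ys : List A) f → sumL (xs ++ ys) f ≈ sumL xs f + sumL ys f
  sumL-++ []       ys f = sym (+-identityˡ _)
  sumL-++ (x ∷ xs) ys f = trans (+-congˡ (sumL-++ xs ys f)) (sym (+-assoc _ _ _))

  sumL-filterᵇ : ∀ (p : A → Bool) xs f → sumL (filterᵇ p xs) f ≈ sumL xs (λ x → ⟦ p x ⟧ * f x)
  sumL-filterᵇ p []       f = refl
  sumL-filterᵇ p (x ∷ xs) f with p x
  ... | true  = +-cong (sym (*-identityˡ _)) (sumL-filterᵇ p xs f)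
  ... | false = trans (sumL-filterᵇ p xs f) (trans (sym (+-identityˡ _)) (+-congʳ (sym (zeroˡ _))))

  sumL-concatMap : ∀ (xs : List A) (h : A → List B) f → sumL (concatMap h xs) f ≈ sumL xs (λ x → sumL (h x) f)
  sumL-concatMap []       h f = refl
  sumL-concatMap (x ∷ xs) h f = trans (sumL-++ (h x) _ f) (+-congˡ (sumL-concatMap xs h f))

  sumL-+ : ∀ (xs : List A) f g → sumL xs (λ x → f x + g x) ≈ sumL xs f + sumL xs g
  sumL-+ []       f g = sym (+-identityˡ _)
  sumL-+ (x ∷ xs) f g = trans (+-congˡ (sumL-+ xs f g))
    (solve 4 (λ a b p q → (a :+ b) :+ (p :+ q) := (a :+ p) :+ (b :+ q)) refl _ _ _ _)

  sumL-*ˡ : ∀ (xs : List A) c f → sumL xs (λ x → c * f x) ≈ c * sumL xs f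
  sumL-*ˡ []       c f = sym (zeroʳ c)
  sumL-*ˡ (x ∷ xs) c f = trans (+-congˡ (sumL-*ˡ xs c f)) (sym (distribˡ _ _ _))

  sumL-*ʳ : ∀ (xs : List A) c f → sumL xs (λ x → f x * c) ≈ sumL xs f * c
  sumL-*ʳ xs c f = trans (sumL-cong xs (λ x → *-comm (f x) c)) (trans (sumL-*ˡ xs c f) (*-comm c _))

  sumL-swap : ∀ (xs : List A) (ys : List B) (f : A → B → Carrier) →
              sumL xs (λ x → sumL ys (f x)) ≈ sumL ys (λ y → sumL xs (λ x → f x y))
  sumL-swap []       ys f = sym (sumL-0ᴬ (All.universal (λ _ → refl) ys))
  sumL-swap (x ∷ xs) ys f = trans (+-congˡ (sumL-swap xs ys f)) (sym (sumL-+ ys _ _))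

  sumL-product : ∀ (xs : List A) (ys : List B) (f : A → Carrier) (g : B → Carrier) →
                 sumL xs (λ x → sumL ys (λ y → f x * g y)) ≈ sumL xs f * sumL ys g
  sumL-product xs ys f g = trans (sumL-cong xs (λ x → sumL-*ˡ ys (f x) g)) (sumL-*ʳ xs (sumL ys g) f)

  -- Inserting and then cutting is the same as cutting and then inserting on one of the two sides.
  sum-ins-cuts : ∀ (m : A) w (F : List A → List A → Carrier) →
    sumL (ins m w) (λ z → sumL (cuts z) (uncurry F)) ≈
    sumL (cuts w) (λ (a , b) → sumL (ins m a) (λ a′ → F a′ b) + sumL (ins m b) (F a))
  sum-ins-cuts m [] F =
    solve 2 (λ p q → (p :+ (q :+ con 0)) :+ con 0 := ((q :+ con 0) :+ (p :+ con 0)) :+ con 0) refl _ _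
  sum-ins-cuts m (h ∷ t) F = begin
    F [] (m ∷ h ∷ t) + (F [ m ] (h ∷ t) + sumL (map _ (map _ (cuts t))) (uncurry F))
      + sumL (map (h ∷_) (ins m t)) (λ z → sumL (cuts z) (uncurry F))
      ≈⟨ +-cong (+-congˡ (+-congˡ (trans (sumL-map (map (λ (a , b) → h ∷ a , b) (cuts t)) (λ (a , b) → m ∷ a , b) (uncurry F))
             (sumL-map (cuts t) (λ (a , b) → h ∷ a , b) (λ (a , b) → F (m ∷ a) b))))) (trans (sumL-map (ins m t) _ _)
           (trans (sumL-+ (ins m t) _ _) (+-congˡ (sumL-cong (ins m t) λ z → sumL-map (cuts z) _ _)))) ⟩
    F [] (m ∷ h ∷ t) + (F [ m ] (h ∷ t) + sumL (cuts t) (λ (a , b) → F (m ∷ h ∷ a) b))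
      + (sumL (ins m t) (λ z → F [] (h ∷ z)) + sumL (ins m t) (λ z → sumL (cuts z) (λ (a , b) → F (h ∷ a) b)))
      ≈⟨ +-congˡ (+-congˡ (sum-ins-cuts m t (λ a b → F (h ∷ a) b))) ⟩
    F [] (m ∷ h ∷ t) + (F [ m ] (h ∷ t) + sumL (cuts t) (λ (a , b) → F (m ∷ h ∷ a) b))
      + (sumL (ins m t) (λ z → F [] (h ∷ z))
         + sumL (cuts t) (λ (a , b) → sumL (ins m a) (λ a′ → F (h ∷ a′) b) + sumL (ins m b) (F (h ∷ a))))
      ≈⟨ solve 5 (λ p q r s u → p :+ (q :+ r) :+ (s :+ u) := (q :+ con 0) :+ (p :+ s) :+ (r :+ u)) refl _ _ _ _ _ ⟩
    (F [ m ] (h ∷ t) + 0#) + (F [] (m ∷ h ∷ t) + sumL (ins m t) (λ z → F [] (h ∷ z)))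
      + (sumL (cuts t) (λ (a , b) → F (m ∷ h ∷ a) b)
         + sumL (cuts t) (λ (a , b) → sumL (ins m a) (λ a′ → F (h ∷ a′) b) + sumL (ins m b) (F (h ∷ a))))
      ≈⟨ +-cong (+-congˡ (+-congˡ (sym (sumL-map (ins m t) _ _)))) (trans (sym (sumL-+ (cuts t) _ _))
           (trans (sumL-cong (cuts t) (λ (a , b) → trans (sym (+-assoc _ _ _)) (+-congʳ (+-congˡ (sym (sumL-map (ins m a) _ _))))))
             (sym (sumL-map (cuts t) _ _)))) ⟩
    sumL (cuts (h ∷ t)) (λ (a , b) → sumL (ins m a) (λ a′ → F a′ b) + sumL (ins m b) (F a)) ∎

  sum-ins : ∀ (m : A) w G → sumL (ins m w) G ≈ sumL (cuts w) (λ (a , b) → G (a ++ m ∷ b))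
  sum-ins m []      G = refl
  sum-ins m (h ∷ t) G = +-congˡ (trans (sumL-map (ins m t) _ _) (trans (sum-ins m t _) (sym (sumL-map (cuts t) _ _))))

  sum-splits : ∀ (x : A) S G → sumL (splits (x ∷ S)) (uncurry G) ≈
    sumL (splits S) (λ (T , T′) → G (x ∷ T) T′) + sumL (splits S) (λ (T , T′) → G T (x ∷ T′))
  sum-splits x S G = trans (sumL-++ (map _ (splits S)) _ _) (+-cong (sumL-map (splits S) _ _) (sumL-map (splits S) _ _))

  -- Each inserted letter chooses its side of the cut, so a cut arrangement amounts to a splitting
  -- of the set together with an arrangement of each part.
  sum-arr-cuts : ∀ (S : List A) (F : List A → List A → Carrier) →
    sumL (arr S) (λ w → sumL (cuts w) (uncurry F)) ≈
    sumL (splits S) (λ (T , T′) → sumL (arr T) (λ τ → sumL (arr T′) (F τ)))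
  sum-arr-cuts []      F = +-congʳ (solve 1 (λ p → p :+ con 0 := (p :+ con 0) :+ con 0) refl _)
  sum-arr-cuts (m ∷ S) F = begin
    sumL (arr (m ∷ S)) (λ w → sumL (cuts w) (uncurry F))
      ≈⟨ sumL-concatMap (arr S) (ins m) _ ⟩
    sumL (arr S) (λ w → sumL (ins m w) (λ z → sumL (cuts z) (uncurry F)))
      ≈⟨ sumL-cong (arr S) (λ w → trans (sum-ins-cuts m w F) (sumL-+ (cuts w) _ _)) ⟩
    sumL (arr S) (λ w → sumL (cuts w) (λ (a , b) → sumL (ins m a) (λ a′ → F a′ b)) + sumL (cuts w) (λ (a , b) → sumL (ins m b) (F a)))
      ≈⟨ sumL-+ (arr S) _ _ ⟩
    _ ≈⟨ +-cong (sum-arr-cuts S _) (sum-arr-cuts S _) ⟩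
    sumL (splits S) (λ (T , T′) → sumL (arr T) (λ a → sumL (arr T′) (λ b → sumL (ins m a) (λ a′ → F a′ b))))
    + sumL (splits S) (λ (T , T′) → sumL (arr T) (λ a → sumL (arr T′) (λ b → sumL (ins m b) (F a))))
      ≈⟨ +-cong
           (sumL-cong (splits S) (λ (T , T′) → trans (sumL-cong (arr T) (λ a → sumL-swap (arr T′) (ins m a) _))
             (sym (sumL-concatMap (arr T) (ins m) _))))
           (sumL-cong (splits S) (λ (T , T′) → sumL-cong (arr T) (λ a → sym (sumL-concatMap (arr T′) (ins m) _)))) ⟩
    sumL (splits S) (λ (T , T′) → sumL (arr (m ∷ T)) (λ τ → sumL (arr T′) (F τ)))
    + sumL (splits S) (λ (T , T′) → sumL (arr T) (λ τ → sumL (arr (m ∷ T′)) (F τ)))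
      ≈⟨ sum-splits m S (λ T T′ → sumL (arr T) (λ τ → sumL (arr T′) (F τ))) ⟨
    sumL (splits (m ∷ S)) (λ (T , T′) → sumL (arr T) (λ τ → sumL (arr T′) (F τ))) ∎

  sum-arr-∷ : ∀ (m : A) S G → sumL (arr (m ∷ S)) G ≈
    sumL (splits S) (λ (T , T′) → sumL (arr T) (λ τ → sumL (arr T′) (λ σ → G (τ ++ m ∷ σ))))
  sum-arr-∷ m S G = trans (sumL-concatMap (arr S) (ins m) G)
    (trans (sumL-cong (arr S) (λ w → sum-ins m w G)) (sum-arr-cuts S (λ a b → G (a ++ m ∷ b))))

  -- Isolates the term T = [], which makes set functions with a common
  -- convolution equation unique.
  sum-splits-top : ∀ (g : ℕ → Carrier) (S : List A) (δ : List A → Carrier) →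
    (∀ T → T ⊆ S → length T ℕ.< length S → δ T ≈ 0#) →
    sumL (splits S) (λ (T , T′) → g (length T) * δ T′) ≈ g 0 * δ S
  sum-splits-top g []      δ z = +-identityʳ _
  sum-splits-top g (x ∷ S) δ z = begin
    sumL (splits (x ∷ S)) (λ (T , T′) → g (length T) * δ T′)
      ≈⟨ sum-splits x S (λ T T′ → g (length T) * δ T′) ⟩
    sumL (splits S) (λ (T , T′) → g (suc (length T)) * δ T′) + sumL (splits S) (λ (T , T′) → g (length T) * δ (x ∷ T′))
      ≈⟨ +-cong
           (sumL-0ᴬ (All.map (λ (_ , T′⊆S) → trans (*-congˡ (z _ (x ∷ʳ T′⊆S) (ℕ.s≤s (length-mono-≤ T′⊆S)))) (zeroʳ _)) (splits-⊆ S)))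
           (sum-splits-top g S (δ ∘ (x ∷_)) (λ T T⊆S l → z (x ∷ T) (≡.refl ∷ T⊆S) (ℕ.s≤s l))) ⟩
    0# + g 0 * δ (x ∷ S) ≈⟨ +-identityˡ _ ⟩
    g 0 * δ (x ∷ S) ∎

-- Exponential generating functions and splittings of a set

module EgfProducts (K : Ring₀) where
  open CommutativeRing K
  open PowerSeries K
  open NaturalMultiples K
  open Exponential K
  open ListSums K
  open SetoidReasoning setoid

  factorial : ℕ → Carrier
  factorial zero    = 1#
  factorial (suc n) = factorial n * nat (suc n)

  egf : PS → ℕ → Carrier
  egf F n = factorial n * F n

  egf-suc : ∀ F n → egf F (suc n) ≈ egf (D F) n
  egf-suc F n = *-assoc _ _ _

  egf-cong : ∀ {F G} → F ≋ G → ∀ n → egf F n ≈ egf G n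
  egf-cong p n = *-congˡ (p n)

  -- The head joins one of the two parts just as `D` falls on one of the two factors, and `D` is the
  -- shift of `egf`. The Leibniz rule thus replaces binomial coefficients.
  sum-splits-egf : ∀ (S : List A) F G →
    sumL (splits S) (λ (T , T′) → egf F (length T) * egf G (length T′)) ≈ egf (F · G) (length S)
  sum-splits-egf []      F G = begin
    1# * F 0 * (1# * G 0) + 0# ≈⟨ +-identityʳ _ ⟩
    1# * F 0 * (1# * G 0)      ≈⟨ *-cong (*-identityˡ _) (*-identityˡ _) ⟩
    F 0 * G 0                  ≈⟨ *-identityˡ _ ⟨
    1# * (F 0 * G 0)           ∎
  sum-splits-egf (x ∷ S) F G = begin
    sumL (splits (x ∷ S)) (λ (T , T′) → egf F (length T) * egf G (length T′))
      ≈⟨ sum-splits x S (λ T T′ → egf F (length T) * egf G (length T′)) ⟩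
    sumL (splits S) (λ (T , T′) → egf F (suc (length T)) * egf G (length T′))
    + sumL (splits S) (λ (T , T′) → egf F (length T) * egf G (suc (length T′)))
      ≈⟨ +-cong (sumL-cong (splits S) (λ (T , T′) → *-congʳ (egf-suc F (length T))))
                (sumL-cong (splits S) (λ (T , T′) → *-congˡ (egf-suc G (length T′)))) ⟩
    sumL (splits S) (λ (T , T′) → egf (D F) (length T) * egf G (length T′))
    + sumL (splits S) (λ (T , T′) → egf F (length T) * egf (D G) (length T′))
      ≈⟨ +-cong (sum-splits-egf S (D F) G) (sum-splits-egf S F (D G)) ⟩
    egf (D F · G) (length S) + egf (F · D G) (length S)
      ≈⟨ distribˡ _ _ _ ⟨
    egf (λ n → (D F · G) n + (F · D G) n) (length S)
      ≈⟨ egf-cong (D-· F G) (length S) ⟨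
    egf (D (F · G)) (length S)
      ≈⟨ egf-suc (F · G) (length S) ⟨
    egf (F · G) (suc (length S)) ∎

-- Words and consecutive patterns

module ConsecutivePatterns where
  open import Data.Bool.ListAction using (any)
  open import Data.List using (inits; module Inits)
  open import Data.List.Properties using (length-map; map-cong)
  open import Data.Nat using (_+_)
  open ≡ using (refl; sym; trans; cong; cong₂)

  <ᵇ-true : ∀ {a b} → a < b → (a <ᵇ b) ≡ true
  <ᵇ-true p = Equivalence.to Boolₚ.T-≡ (ℕₚ.<⇒<ᵇ p)

  <ᵇ-true⁻¹ : ∀ a b → (a <ᵇ b) ≡ true → a < b
  <ᵇ-true⁻¹ a b e = ℕₚ.<ᵇ⇒< a b (Equivalence.from Boolₚ.T-≡ e)

  >ᵇ-false : ∀ {a b} → b < a → (a <ᵇ b) ≡ false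
  >ᵇ-false {a} {b} p = Boolₚ.¬-not (λ e → ℕₚ.<-asym p (<ᵇ-true⁻¹ a b e))

  -- Whether a prefix has pattern 123 or 1324, by direct comparison of letters; `any-inits`
  -- reconciles this with the test through `red`.
  startsᵇ : List ℕ → Bool
  startsᵇ (a ∷ b ∷ c ∷ d ∷ _) = ((a <ᵇ b) ∧ (b <ᵇ c)) ∨ ((a <ᵇ c) ∧ (c <ᵇ b) ∧ (b <ᵇ d))
  startsᵇ (a ∷ b ∷ c ∷ [])    = (a <ᵇ b) ∧ (b <ᵇ c)
  startsᵇ _                   = false

  matchesᵇ : List ℕ → Bool
  matchesᵇ []      = false
  matchesᵇ (v ∷ w) = startsᵇ (v ∷ w) ∨ matchesᵇ w

  -- Both patterns begin with an ascent; in 1324 the first letter lies below the third, which lies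
  -- below the second.
  starts-descent : ∀ {s d} w → d < s → startsᵇ (s ∷ d ∷ w) ≡ false
  starts-descent         []          p = refl
  starts-descent         (_ ∷ [])    p rewrite >ᵇ-false p = refl
  starts-descent {s} {d} (e ∷ g ∷ w) p rewrite >ᵇ-false p with s <ᵇ e in s<e | e <ᵇ d in e<d
  ... | false | _     = refl
  ... | true  | false = refl
  ... | true  | true  with () ← ℕₚ.<-asym p (ℕₚ.<-trans (<ᵇ-true⁻¹ s e s<e) (<ᵇ-true⁻¹ e d e<d))

  -- All letters of an occurrence are at least its first letter `a`, so none can reach as far as
  -- `m`, and cutting before `m` loses nothing.
  starts-++-min : ∀ {m} a u w → m < a → All (m <_) u → startsᵇ (a ∷ u ++ m ∷ w) ≡ startsᵇ (a ∷ u)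
  starts-++-min a []              w           m<a _ = starts-descent w m<a
  starts-++-min a (b ∷ [])        []          m<a (m<b ∷ _) rewrite >ᵇ-false m<b = Boolₚ.∧-zeroʳ _
  starts-++-min a (b ∷ [])        (d ∷ w)     m<a (m<b ∷ _) rewrite >ᵇ-false m<b | >ᵇ-false m<a | Boolₚ.∧-zeroʳ (a <ᵇ b) = refl
  starts-++-min a (b ∷ c ∷ [])    w           m<a (m<b ∷ _) rewrite >ᵇ-false m<b | Boolₚ.∧-zeroʳ (c <ᵇ b) | Boolₚ.∧-zeroʳ (a <ᵇ c) = Boolₚ.∨-identityʳ _
  starts-++-min a (b ∷ c ∷ d ∷ u) w           m<a _ = refl

  matches-++-min : ∀ {m} u w → All (m <_) u → matchesᵇ (u ++ m ∷ w) ≡ matchesᵇ u ∨ matchesᵇ (m ∷ w)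
  matches-++-min     []      w _ = refl
  matches-++-min {m} (a ∷ u) w (m<a ∷ m<u) = trans
    (cong₂ _∨_ (starts-++-min a u w m<a m<u) (matches-++-min u w m<u))
    (sym (Boolₚ.∨-assoc (startsᵇ (a ∷ u)) (matchesᵇ u) (matchesᵇ (m ∷ w))))

  des-++-min : ∀ {m} a u w → All (m <_) (a ∷ u) → des (a ∷ u ++ m ∷ w) ≡ des (a ∷ u) + suc (des (m ∷ w))
  des-++-min a []      w (m<a ∷ _) rewrite <ᵇ-true m<a = refl
  des-++-min a (b ∷ u) w (_ ∷ m<u) = trans
    (cong ((if b <ᵇ a then 1 else 0) +_) (des-++-min b u w m<u))
    (sym (ℕₚ.+-assoc (if b <ᵇ a then 1 else 0) _ _))

  lrminFrom-above : ∀ {k} w → All (k <_) w → lrminFrom k w ≡ 0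
  lrminFrom-above []      _ = refl
  lrminFrom-above (x ∷ w) (k<x ∷ p) rewrite >ᵇ-false k<x = lrminFrom-above w p

  lrminFrom-++-min : ∀ {m k} u w → m < k → All (m <_) u → All (m <_) w → lrminFrom k (u ++ m ∷ w) ≡ suc (lrminFrom k u)
  lrminFrom-++-min []      w m<k _ m<w rewrite <ᵇ-true m<k = cong suc (lrminFrom-above w m<w)
  lrminFrom-++-min {m} {k} (x ∷ u) w m<k (m<x ∷ m<u) m<w with x <ᵇ k
  ... | true  = cong suc (lrminFrom-++-min u w m<x m<u m<w)
  ... | false = lrminFrom-++-min u w m<k m<u m<w

  LRmin-++-min : ∀ {m} u w → All (m <_) u → All (m <_) w → LRmin (u ++ m ∷ w) ≡ suc (LRmin u)
  LRmin-++-min []      w _ m<w = cong suc (lrminFrom-above w m<w)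
  LRmin-++-min (a ∷ u) w (m<a ∷ m<u) m<w = cong suc (lrminFrom-++-min u w m<a m<u m<w)

  <ᵇ-irrefl : ∀ a → (a <ᵇ a) ≡ false
  <ᵇ-irrefl a = Boolₚ.¬-not (λ e → ℕₚ.<-irrefl refl (<ᵇ-true⁻¹ a a e))

  ∧-false : ∀ x {y} → y ≡ false → x ∧ y ≡ false
  ∧-false x refl = Boolₚ.∧-zeroʳ x

  bit : Bool → ℕ
  bit b = if b then 1 else 0

  -- Each test is a summand, so rewriting with known comparisons evaluates a rank.
  countᵇ : (ℕ → Bool) → List ℕ → ℕ
  countᵇ p []       = 0
  countᵇ p (x ∷ xs) = bit (p x) + countᵇ p xs

  length-filterᵇ : ∀ p xs → length (filterᵇ p xs) ≡ countᵇ p xs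
  length-filterᵇ p []       = refl
  length-filterᵇ p (x ∷ xs) with p x
  ... | true  = cong suc (length-filterᵇ p xs)
  ... | false = length-filterᵇ p xs

  ranks : List ℕ → List ℕ
  ranks α = map (λ a → suc (countᵇ (_<ᵇ a) α)) α

  red-ranks : ∀ α → red α ≡ ranks α
  red-ranks α = map-cong (λ a → cong suc (length-filterᵇ (_<ᵇ a) α)) α

  -- A failed comparison spoils a rank: without b < c at most one letter lies below `c`, and with b
  -- < c but not a < b none lies below `b`.
  ranks-123 : ∀ a b c → eqListᵇ (ranks (a ∷ b ∷ c ∷ [])) (1 ∷ 2 ∷ 3 ∷ []) ≡ (a <ᵇ b) ∧ (b <ᵇ c)
  ranks-123 a b c = by-cases (a <ᵇ b) (b <ᵇ c) refl refl
    where
    α : List ℕ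
    α = a ∷ b ∷ c ∷ []

    at-c : (b <ᵇ c) ≡ false → (countᵇ (_<ᵇ c) α ≡ᵇ 2) ≡ false
    at-c b≮c rewrite b≮c | <ᵇ-irrefl c with a <ᵇ c
    ... | true  = refl
    ... | false = refl

    at-b : (a <ᵇ b) ≡ false → b < c → (countᵇ (_<ᵇ b) α ≡ᵇ 1) ≡ false
    at-b a≮b b<c rewrite a≮b | <ᵇ-irrefl b | >ᵇ-false b<c = refl

    ordered : a < b → b < c → a < c → eqListᵇ (ranks α) (1 ∷ 2 ∷ 3 ∷ []) ≡ true
    ordered a<b b<c a<c rewrite <ᵇ-irrefl a | <ᵇ-irrefl b | <ᵇ-irrefl c
      | <ᵇ-true a<b | <ᵇ-true b<c | <ᵇ-true a<c | >ᵇ-false a<b | >ᵇ-false b<c | >ᵇ-false a<c = refl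

    by-cases : ∀ p q → (a <ᵇ b) ≡ p → (b <ᵇ c) ≡ q → eqListᵇ (ranks α) (1 ∷ 2 ∷ 3 ∷ []) ≡ p ∧ q
    by-cases p     false _   b≮c = trans (∧-false (countᵇ (_<ᵇ a) α ≡ᵇ 0) (∧-false (countᵇ (_<ᵇ b) α ≡ᵇ 1)
      (trans (Boolₚ.∧-identityʳ _) (at-c b≮c)))) (sym (Boolₚ.∧-zeroʳ p))
    by-cases false true  a≮b b<c = ∧-false (countᵇ (_<ᵇ a) α ≡ᵇ 0)
      (cong (_∧ ((countᵇ (_<ᵇ c) α ≡ᵇ 2) ∧ true)) (at-b a≮b (<ᵇ-true⁻¹ b c b<c)))
    by-cases true  true  a<b b<c = ordered (<ᵇ-true⁻¹ a b a<b) (<ᵇ-true⁻¹ b c b<c)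
      (ℕₚ.<-trans (<ᵇ-true⁻¹ a b a<b) (<ᵇ-true⁻¹ b c b<c))

  -- As for 123, the letters being examined from the greatest downwards: `d` needs three letters
  -- below it, then `b` two, then `c` one.
  ranks-1324 : ∀ a b c d → eqListᵇ (ranks (a ∷ b ∷ c ∷ d ∷ [])) (1 ∷ 3 ∷ 2 ∷ 4 ∷ []) ≡ (a <ᵇ c) ∧ (c <ᵇ b) ∧ (b <ᵇ d)
  ranks-1324 a b c d = by-cases (a <ᵇ c) (c <ᵇ b) (b <ᵇ d) refl refl refl
    where
    α : List ℕ
    α = a ∷ b ∷ c ∷ d ∷ []

    at-d : (b <ᵇ d) ≡ false → (countᵇ (_<ᵇ d) α ≡ᵇ 3) ≡ false
    at-d b≮d rewrite b≮d | <ᵇ-irrefl d with a <ᵇ d | c <ᵇ d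
    ... | true  | true  = refl
    ... | true  | false = refl
    ... | false | true  = refl
    ... | false | false = refl

    at-b : (c <ᵇ b) ≡ false → b < d → (countᵇ (_<ᵇ b) α ≡ᵇ 2) ≡ false
    at-b c≮b b<d rewrite c≮b | <ᵇ-irrefl b | >ᵇ-false b<d with a <ᵇ b
    ... | true  = refl
    ... | false = refl

    at-c : (a <ᵇ c) ≡ false → c < b → c < d → (countᵇ (_<ᵇ c) α ≡ᵇ 1) ≡ false
    at-c a≮c c<b c<d rewrite a≮c | <ᵇ-irrefl c | >ᵇ-false c<b | >ᵇ-false c<d = refl

    ordered : a < c → c < b → b < d → a < b → a < d → c < d → eqListᵇ (ranks α) (1 ∷ 3 ∷ 2 ∷ 4 ∷ []) ≡ true
    ordered a<c c<b b<d a<b a<d c<d rewrite <ᵇ-irrefl a | <ᵇ-irrefl b | <ᵇ-irrefl c | <ᵇ-irrefl d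
      | <ᵇ-true a<c | <ᵇ-true c<b | <ᵇ-true b<d | <ᵇ-true a<b | <ᵇ-true a<d | <ᵇ-true c<d
      | >ᵇ-false a<c | >ᵇ-false c<b | >ᵇ-false b<d | >ᵇ-false a<b | >ᵇ-false a<d | >ᵇ-false c<d = refl

    by-cases : ∀ p q r → (a <ᵇ c) ≡ p → (c <ᵇ b) ≡ q → (b <ᵇ d) ≡ r →
               eqListᵇ (ranks α) (1 ∷ 3 ∷ 2 ∷ 4 ∷ []) ≡ p ∧ q ∧ r
    by-cases p q false _ _ b≮d = trans
      (∧-false (countᵇ (_<ᵇ a) α ≡ᵇ 0) (∧-false (countᵇ (_<ᵇ b) α ≡ᵇ 2) (∧-false (countᵇ (_<ᵇ c) α ≡ᵇ 1)
        (trans (Boolₚ.∧-identityʳ _) (at-d b≮d)))))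
      (sym (∧-false p (Boolₚ.∧-zeroʳ q)))
    by-cases p false true _ c≮b b<d = trans
      (∧-false (countᵇ (_<ᵇ a) α ≡ᵇ 0)
        (cong (_∧ ((countᵇ (_<ᵇ c) α ≡ᵇ 1) ∧ (countᵇ (_<ᵇ d) α ≡ᵇ 3) ∧ true)) (at-b c≮b (<ᵇ-true⁻¹ b d b<d))))
      (sym (Boolₚ.∧-zeroʳ p))
    by-cases false true true a≮c c<b b<d =
      ∧-false (countᵇ (_<ᵇ a) α ≡ᵇ 0) (∧-false (countᵇ (_<ᵇ b) α ≡ᵇ 2)
        (cong (_∧ ((countᵇ (_<ᵇ d) α ≡ᵇ 3) ∧ true))
          (at-c a≮c (<ᵇ-true⁻¹ c b c<b) (ℕₚ.<-trans (<ᵇ-true⁻¹ c b c<b) (<ᵇ-true⁻¹ b d b<d)))))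
    by-cases true true true e₁ e₂ e₃ =
      ordered a<c c<b b<d (ℕₚ.<-trans a<c c<b) (ℕₚ.<-trans a<c (ℕₚ.<-trans c<b b<d)) (ℕₚ.<-trans c<b b<d)
      where
      a<c = <ᵇ-true⁻¹ a c e₁
      c<b = <ᵇ-true⁻¹ c b e₂
      b<d = <ᵇ-true⁻¹ b d e₃

  red-123 : ∀ a b c → eqListᵇ (red (a ∷ b ∷ c ∷ [])) (1 ∷ 2 ∷ 3 ∷ []) ≡ (a <ᵇ b) ∧ (b <ᵇ c)
  red-123 a b c = trans (cong (λ r → eqListᵇ r (1 ∷ 2 ∷ 3 ∷ [])) (red-ranks (a ∷ b ∷ c ∷ []))) (ranks-123 a b c)

  red-1324 : ∀ a b c d → eqListᵇ (red (a ∷ b ∷ c ∷ d ∷ [])) (1 ∷ 3 ∷ 2 ∷ 4 ∷ []) ≡ (a <ᵇ c) ∧ (c <ᵇ b) ∧ (b <ᵇ d)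
  red-1324 a b c d = trans (cong (λ r → eqListᵇ r (1 ∷ 3 ∷ 2 ∷ 4 ∷ [])) (red-ranks (a ∷ b ∷ c ∷ d ∷ []))) (ranks-1324 a b c d)

  eqListᵇ-length : ∀ xs ys → length xs ≢ length ys → eqListᵇ xs ys ≡ false
  eqListᵇ-length []       []       l = ⊥-elim (l refl)
  eqListᵇ-length []       (y ∷ ys) l = refl
  eqListᵇ-length (x ∷ xs) []       l = refl
  eqListᵇ-length (x ∷ xs) (y ∷ ys) l rewrite eqListᵇ-length xs ys (l ∘ cong suc) = Boolₚ.∧-zeroʳ _

  red-length : ∀ f ys → length f ≢ length ys → eqListᵇ (red f) ys ≡ false
  red-length f ys l = eqListᵇ-length (red f) ys (λ e → l (trans (sym (length-map _ f)) e))

  isΓᵇ : List ℕ → Bool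
  isΓᵇ f = any (eqListᵇ (red f)) Γ

  any-++ : ∀ {A : Set} (p : A → Bool) xs ys → any p (xs ++ ys) ≡ any p xs ∨ any p ys
  any-++ p []       ys = refl
  any-++ p (x ∷ xs) ys = trans (cong (p x ∨_) (any-++ p xs ys)) (sym (Boolₚ.∨-assoc (p x) _ _))

  any-filterᵇ-false : ∀ {A : Set} (p q : A → Bool) {xs} → All (λ x → p x ≡ false) xs → any p (filterᵇ q xs) ≡ false
  any-filterᵇ-false p q [] = refl
  any-filterᵇ-false p q {x ∷ xs} (e ∷ es) with q x
  ... | true  = cong₂ _∨_ e (any-filterᵇ-false p q es)
  ... | false = any-filterᵇ-false p q es

  isΓᵇ-≡ : ∀ f {p q} → eqListᵇ (red f) (1 ∷ 3 ∷ 2 ∷ 4 ∷ []) ≡ p → eqListᵇ (red f) (1 ∷ 2 ∷ 3 ∷ []) ≡ q → isΓᵇ f ≡ p ∨ q ∨ false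
  isΓᵇ-≡ f = cong₂ (λ x y → x ∨ y ∨ false)

  isΓᵇ-short : ∀ a b → isΓᵇ (a ∷ b ∷ []) ≡ false
  isΓᵇ-short a b = isΓᵇ-≡ (a ∷ b ∷ []) (red-length (a ∷ b ∷ []) (1 ∷ 3 ∷ 2 ∷ 4 ∷ []) (λ ())) (red-length (a ∷ b ∷ []) (1 ∷ 2 ∷ 3 ∷ []) (λ ()))

  isΓᵇ-three : ∀ a b c → isΓᵇ (a ∷ b ∷ c ∷ []) ≡ (a <ᵇ b) ∧ (b <ᵇ c)
  isΓᵇ-three a b c = trans
    (isΓᵇ-≡ (a ∷ b ∷ c ∷ []) (red-length (a ∷ b ∷ c ∷ []) (1 ∷ 3 ∷ 2 ∷ 4 ∷ []) (λ ())) (red-123 a b c))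
    (Boolₚ.∨-identityʳ _)

  isΓᵇ-four : ∀ a b c d → isΓᵇ (a ∷ b ∷ c ∷ d ∷ []) ≡ (a <ᵇ c) ∧ (c <ᵇ b) ∧ (b <ᵇ d)
  isΓᵇ-four a b c d = trans
    (isΓᵇ-≡ (a ∷ b ∷ c ∷ d ∷ []) (red-1324 a b c d) (red-length (a ∷ b ∷ c ∷ d ∷ []) (1 ∷ 2 ∷ 3 ∷ []) (λ ())))
    (Boolₚ.∨-identityʳ _)

  isΓᵇ-long : ∀ a b c d e w → isΓᵇ (a ∷ b ∷ c ∷ d ∷ e ∷ w) ≡ false
  isΓᵇ-long a b c d e w = isΓᵇ-≡ f (red-length f (1 ∷ 3 ∷ 2 ∷ 4 ∷ []) (λ ())) (red-length f (1 ∷ 2 ∷ 3 ∷ []) (λ ()))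
    where
    f : List ℕ
    f = a ∷ b ∷ c ∷ d ∷ e ∷ w

  nonempty-inits : ∀ {P : List ℕ → Set} → (∀ e w → P (e ∷ w)) → ∀ w → All P (Inits.tail w)
  nonempty-inits p []      = []
  nonempty-inits p (x ∷ w) = p x [] ∷ Allₚ.map⁺ (nonempty-inits (λ e w′ → p x (e ∷ w′)) w)

  -- Prefixes of length two or more than four have the wrong length for either pattern, which leaves
  -- those of length three and four.
  any-inits : ∀ w → any isΓᵇ (filterᵇ (λ f → 1 <ᵇ length f) (inits w)) ≡ startsᵇ w
  any-inits []                  = refl
  any-inits (a ∷ [])            = refl
  any-inits (a ∷ b ∷ [])        = trans (Boolₚ.∨-identityʳ _) (isΓᵇ-short a b)
  any-inits (a ∷ b ∷ c ∷ [])    =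
    trans (cong₂ (λ x y → x ∨ y ∨ false) (isΓᵇ-short a b) (isΓᵇ-three a b c)) (Boolₚ.∨-identityʳ _)
  any-inits (a ∷ b ∷ c ∷ d ∷ w) = trans
    (cong₂ _∨_ (isΓᵇ-short a b) (cong₂ _∨_ (isΓᵇ-three a b c) (cong₂ _∨_ (isΓᵇ-four a b c d)
      (any-filterᵇ-false isΓᵇ (λ f → 1 <ᵇ length f) (Allₚ.map⁺ (Allₚ.map⁺ (Allₚ.map⁺ (Allₚ.map⁺
        (nonempty-inits (isΓᵇ-long a b c d) w)))))))))
    (cong (((a <ᵇ b) ∧ (b <ᵇ c)) ∨_) (Boolₚ.∨-identityʳ _))

  hasMatch-matches : ∀ w → hasMatchᵇ Γ w ≡ matchesᵇ w
  hasMatch-matches []      = refl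
  hasMatch-matches (v ∷ w) = trans (any-++ isΓᵇ (filterᵇ (λ f → 1 <ᵇ length f) (inits (v ∷ w))) (factors w))
    (cong₂ _∨_ (any-inits (v ∷ w)) (hasMatch-matches w))

open ConsecutivePatterns

-- Words as sequences of bricks

module Bricks (K : Ring₀) (y : CommutativeRing.Carrier K) where
  open CommutativeRing K
  open ListSums K
  open SetoidReasoning setoid
  open import Algebra.Solver.Ring.NaturalCoefficients.Default commutativeSemiring using (solve; _:+_; _:*_; _:=_; con)
  open import Algebra.Properties.Semiring.Exp semiring using (_^_; ^-homo-*)

  -- A brick (f , l) is a single letter f = l or an ascent f < l.
  _,_≺ᵇ_,_ : ℕ → ℕ → ℕ → ℕ → Bool
  f , l ≺ᵇ f′ , l′ = (f <ᵇ f′) ∧ (l <ᵇ l′)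

  -- Signed sum over the ways to read a word as bricks such that, with (f , l)
  -- in front, consecutive bricks are related by ≺.
  chain : ℕ → ℕ → List ℕ → Carrier
  chain f l []          = 1#
  chain f l (s ∷ [])    = ⟦ f , l ≺ᵇ s , s ⟧ * (- y * 1#)
  chain f l (s ∷ d ∷ w) = ⟦ f , l ≺ᵇ s , s ⟧ * (- y * chain s s (d ∷ w))
                          + ⟦ s <ᵇ d ⟧ * (⟦ f , l ≺ᵇ s , d ⟧ * (- y * chain s d w))

  -- The same with consecutive bricks never related by ≺ and no signs.
  antichain : ℕ → ℕ → List ℕ → Carrier
  antichain f l []          = 1#
  antichain f l (s ∷ [])    = ⟦ not (f , l ≺ᵇ s , s) ⟧ * (y * 1#)
  antichain f l (s ∷ d ∷ w) = ⟦ not (f , l ≺ᵇ s , s) ⟧ * (y * antichain s s (d ∷ w))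
                              + ⟦ s <ᵇ d ⟧ * (⟦ not (f , l ≺ᵇ s , d) ⟧ * (y * antichain s d w))

  -- There is no brick in front, so the first one is free. For distinct letters at most one reading
  -- survives, the one by ascending runs.
  runs : List ℕ → Carrier
  runs []          = 1#
  runs (s ∷ [])    = y * 1#
  runs (s ∷ d ∷ w) = y * antichain s s (d ∷ w) + ⟦ s <ᵇ d ⟧ * (y * antichain s d w)

  y-y : ∀ z → y * z + - y * z ≈ 0#
  y-y z = trans (sym (distribʳ z y (- y))) (trans (*-congʳ (-‿inverseʳ y)) (zeroˡ z))

  complement : ∀ b z → y * z + ⟦ b ⟧ * (- y * z) ≈ ⟦ not b ⟧ * (y * z)
  complement true  z = trans (+-congˡ (*-identityˡ _)) (trans (y-y z) (sym (zeroˡ _)))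
  complement false z = solve 2 (λ p q → p :+ con 0 :* q := con 1 :* p) refl _ _

  -- Everything cancels except the term with empty chain whose first run is not
  -- ≺-above (f , l): moving the first run to the end of the chain flips the sign.
  chain-runs : ∀ f l w → sumL (cuts w) (λ (τ , σ) → chain f l τ * runs σ) ≈ antichain f l w
  chain-runs f l [] = trans (+-identityʳ _) (*-identityˡ _)
  chain-runs f l (s ∷ []) = begin
    1# * (y * 1#) + (⟦ r ⟧ * (- y * 1#) * 1# + 0#)
      ≈⟨ solve 3 (λ a b c → con 1 :* (a :* con 1) :+ (b :* (c :* con 1) :* con 1 :+ con 0) := a :* con 1 :+ b :* (c :* con 1)) refl _ _ _ ⟩
    y * 1# + ⟦ r ⟧ * (- y * 1#)
      ≈⟨ complement r 1# ⟩
    ⟦ not r ⟧ * (y * 1#) ∎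
    where r = f , l ≺ᵇ s , s
  chain-runs f l (s ∷ d ∷ w) = begin
    1# * runs (s ∷ d ∷ w) + (⟦ r ⟧ * (- y * 1#) * runs (d ∷ w) + sumL (map _ (map _ (cuts w))) g)
      ≈⟨ +-congˡ (+-congˡ (trans (sumL-map (map (λ (a , b) → d ∷ a , b) (cuts w)) (λ (a , b) → s ∷ a , b) g)
           (trans (sumL-map (cuts w) (λ (a , b) → d ∷ a , b) (λ (a , b) → g (s ∷ a , b)))
             (sumL-cong (cuts w) (λ (a , b) →
               solve 7 (λ r n c i r′ c′ ρ → (r :* (n :* c) :+ i :* (r′ :* (n :* c′))) :* ρ := r :* n :* (c :* ρ) :+ i :* (r′ :* n) :* (c′ :* ρ)) refl
                 ⟦ r ⟧ (- y) (chain s s (d ∷ a)) ⟦ s <ᵇ d ⟧ ⟦ r′ ⟧ (chain s d a) (runs b)))))) ⟩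
    1# * runs (s ∷ d ∷ w) + (⟦ r ⟧ * (- y * 1#) * runs (d ∷ w)
      + sumL (cuts w) (λ (a , b) → ⟦ r ⟧ * - y * (chain s s (d ∷ a) * runs b) + ⟦ s <ᵇ d ⟧ * (⟦ r′ ⟧ * - y) * (chain s d a * runs b)))
      ≈⟨ +-congˡ (+-congˡ (trans (sumL-+ (cuts w) _ _) (+-cong (sumL-*ˡ (cuts w) _ _) (sumL-*ˡ (cuts w) _ _)))) ⟩
    1# * runs (s ∷ d ∷ w) + (⟦ r ⟧ * (- y * 1#) * runs (d ∷ w)
      + (⟦ r ⟧ * - y * sumL (cuts w) (λ (a , b) → chain s s (d ∷ a) * runs b)
         + ⟦ s <ᵇ d ⟧ * (⟦ r′ ⟧ * - y) * sumL (cuts w) (λ (a , b) → chain s d a * runs b)))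
      -- The cut right after `s` supplies the empty-chain term that completes the sum over the cuts
      -- of `d ∷ w`.
      ≈⟨ solve 8 (λ ρ r n ρ′ c i r′ c′ → con 1 :* ρ :+ (r :* (n :* con 1) :* ρ′ :+ (r :* n :* c :+ i :* (r′ :* n) :* c′))
            := ρ :+ (r :* n :* (con 1 :* ρ′ :+ c) :+ i :* (r′ :* n) :* c′)) refl _ _ _ _ _ _ _ _ ⟩
    runs (s ∷ d ∷ w)
      + (⟦ r ⟧ * - y * (1# * runs (d ∷ w) + sumL (cuts w) (λ (a , b) → chain s s (d ∷ a) * runs b))
         + ⟦ s <ᵇ d ⟧ * (⟦ r′ ⟧ * - y) * sumL (cuts w) (λ (a , b) → chain s d a * runs b))
      ≈⟨ +-congˡ (+-cong (*-congˡ (trans (+-congˡ (sym (sumL-map (cuts w) _ _))) (chain-runs s s (d ∷ w))))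
                         (*-congˡ (chain-runs s d w))) ⟩
    y * antichain s s (d ∷ w) + ⟦ s <ᵇ d ⟧ * (y * antichain s d w)
      + (⟦ r ⟧ * - y * antichain s s (d ∷ w) + ⟦ s <ᵇ d ⟧ * (⟦ r′ ⟧ * - y) * antichain s d w)
      ≈⟨ solve 7 (λ y p i q r n r′ → y :* p :+ i :* (y :* q) :+ (r :* n :* p :+ i :* (r′ :* n) :* q)
            := (y :* p :+ r :* (n :* p)) :+ i :* (y :* q :+ r′ :* (n :* q))) refl _ _ _ _ _ _ _ ⟩
    (y * antichain s s (d ∷ w) + ⟦ r ⟧ * (- y * antichain s s (d ∷ w)))
      + ⟦ s <ᵇ d ⟧ * (y * antichain s d w + ⟦ r′ ⟧ * (- y * antichain s d w))
      ≈⟨ +-cong (complement r _) (*-congˡ (complement r′ _)) ⟩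
    antichain f l (s ∷ d ∷ w) ∎
    where
    r  = f , l ≺ᵇ s , s
    r′ = f , l ≺ᵇ s , d
    g : List ℕ × List ℕ → Carrier
    g (τ , σ) = chain f l τ * runs σ

  -- The sentinel (0 , 0) is ≺-below every brick of positive letters. Hence the sum in `chain-runs`
  -- vanishes at it for every nonempty word of such letters, which is the reciprocity.
  antichain-0 : ∀ s w → All (0 <_) (s ∷ w) → antichain 0 0 (s ∷ w) ≈ 0#
  antichain-0 zero    w           (() ∷ _)
  antichain-0 (suc s) []          _            = zeroˡ _
  antichain-0 (suc s) (zero ∷ w)  (_ ∷ () ∷ _)
  antichain-0 (suc s) (suc d ∷ w) _            = solve 3 (λ p i q → con 0 :* p :+ i :* (con 0 :* q) := con 0) refl _ _ _

  -- If s < d, every brick starting with `d` also ends above `s` and is excluded. If d < s, no brick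
  -- starting with `d` is ≺-above (s , s), so the constraint disappears.
  antichain-single : ∀ s d w → s ≢ d → antichain s s (d ∷ w) ≈ ⟦ d <ᵇ s ⟧ * runs (d ∷ w)
  antichain-single s d w s≢d with ℕₚ.<-cmp s d
  ... | tri≈ _ e _ = ⊥-elim (s≢d e)
  ... | tri> _ _ d<s = below w
    where
    below : ∀ w → antichain s s (d ∷ w) ≈ ⟦ d <ᵇ s ⟧ * runs (d ∷ w)
    below [] rewrite >ᵇ-false d<s | <ᵇ-true d<s = refl
    below (e ∷ w) rewrite >ᵇ-false d<s | <ᵇ-true d<s =
      solve 3 (λ p i q → con 1 :* p :+ i :* (con 1 :* q) := con 1 :* (p :+ i :* q)) refl _ _ _
  ... | tri< s<d _ _ = above w
    where
    above : ∀ w → antichain s s (d ∷ w) ≈ ⟦ d <ᵇ s ⟧ * runs (d ∷ w)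
    above [] rewrite >ᵇ-false s<d | <ᵇ-true s<d = refl
    above (e ∷ w) rewrite >ᵇ-false s<d | <ᵇ-true s<d with d <ᵇ e in d<e
    ... | false = solve 3 (λ p q r → con 0 :* p :+ con 0 :* q := con 0 :* r) refl _ _ _
    ... | true rewrite <ᵇ-true (ℕₚ.<-trans s<d (<ᵇ-true⁻¹ d e d<e)) =
      solve 3 (λ p q r → con 0 :* p :+ con 1 :* (con 0 :* q) := con 0 :* r) refl _ _ _

  -- If d < e, the pattern 123 is present and every brick starting with `e` is ≺-above (s , d). If e
  -- < d, the only brick that can be excluded is a pair (e , g) with s < e and d < g, that is, a
  -- 1324.
  antichain-pair : ∀ s d e w → s < d → d ≢ e → AllPairs _≢_ (e ∷ w) →
    antichain s d (e ∷ w) ≈ ⟦ not (startsᵇ (s ∷ d ∷ e ∷ w)) ⟧ * (⟦ e <ᵇ d ⟧ * runs (e ∷ w))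
  antichain-pair s d e w s<d d≢e u with ℕₚ.<-cmp d e
  ... | tri≈ _ e≡ _ = ⊥-elim (d≢e e≡)
  ... | tri< d<e _ _ = above w
    where
    above : ∀ w → antichain s d (e ∷ w) ≈ ⟦ not (startsᵇ (s ∷ d ∷ e ∷ w)) ⟧ * (⟦ e <ᵇ d ⟧ * runs (e ∷ w))
    above [] rewrite <ᵇ-true s<d | <ᵇ-true d<e | <ᵇ-true (ℕₚ.<-trans s<d d<e) = trans (zeroˡ _) (sym (zeroˡ _))
    above (g ∷ w) rewrite <ᵇ-true s<d | <ᵇ-true d<e | <ᵇ-true (ℕₚ.<-trans s<d d<e) with e <ᵇ g in e<g
    ... | false = solve 3 (λ p q r → con 0 :* p :+ con 0 :* q := con 0 :* r) refl _ _ _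
    ... | true rewrite <ᵇ-true (ℕₚ.<-trans d<e (<ᵇ-true⁻¹ e g e<g)) =
      solve 3 (λ p q r → con 0 :* p :+ con 1 :* (con 0 :* q) := con 0 :* r) refl _ _ _
  ... | tri> _ _ e<d = below w u
    where
    below : ∀ w → AllPairs _≢_ (e ∷ w) →
      antichain s d (e ∷ w) ≈ ⟦ not (startsᵇ (s ∷ d ∷ e ∷ w)) ⟧ * (⟦ e <ᵇ d ⟧ * runs (e ∷ w))
    below [] _ rewrite >ᵇ-false e<d | <ᵇ-true e<d | <ᵇ-true s<d | Boolₚ.∧-zeroʳ (s <ᵇ e) = *-congˡ (sym (*-identityˡ _))
    below (g ∷ w) ((e≢g ∷ _) ∷ _) rewrite >ᵇ-false e<d | <ᵇ-true e<d | <ᵇ-true s<d | Boolₚ.∧-zeroʳ (s <ᵇ e)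
      with (s <ᵇ e) ∧ (d <ᵇ g) in r
    ... | false = solve 3 (λ p i q → con 1 :* p :+ i :* (con 1 :* q) := con 1 :* (con 1 :* (p :+ i :* q))) refl _ _ _
    -- Here e < d < g. The pair (e , g) is excluded, and reading `e` as a single fails as well
    -- because a larger letter follows it.
    ... | true = begin
      1# * (y * antichain e e (g ∷ w)) + ⟦ e <ᵇ g ⟧ * (0# * (y * antichain e g w))
        ≈⟨ +-congʳ (*-congˡ (*-congˡ (antichain-single e g w e≢g))) ⟩
      1# * (y * (⟦ g <ᵇ e ⟧ * runs (g ∷ w))) + ⟦ e <ᵇ g ⟧ * (0# * (y * antichain e g w))
        ≡⟨ ≡.cong (λ b → 1# * (y * (⟦ b ⟧ * runs (g ∷ w))) + ⟦ e <ᵇ g ⟧ * (0# * (y * antichain e g w)))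
             (>ᵇ-false (ℕₚ.<-trans e<d (<ᵇ-true⁻¹ d g (Boolₚ.∧-conicalʳ (s <ᵇ e) (d <ᵇ g) r)))) ⟩
      1# * (y * (0# * runs (g ∷ w))) + ⟦ e <ᵇ g ⟧ * (0# * (y * antichain e g w))
        ≈⟨ solve 5 (λ y p i q r → con 1 :* (y :* (con 0 :* p)) :+ i :* (con 0 :* (y :* q)) := con 0 :* r) refl _ _ _ _ _ ⟩
      0# * _ ∎

  avoiding : List ℕ → Carrier
  avoiding []      = 1#
  avoiding (s ∷ w) = ⟦ not (matchesᵇ (s ∷ w)) ⟧ * y ^ suc (des (s ∷ w))

  -- Bricks none of which is ≺-below the next are exactly the ascending runs of a
  -- word without matches of 123 and 1324.
  runs-avoiding : ∀ w → AllPairs _≢_ w → runs w ≈ avoiding w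
  runs-avoiding []       _ = refl
  runs-avoiding (s ∷ []) _ = sym (*-identityˡ _)
  runs-avoiding (s ∷ d ∷ w) ((s≢d ∷ _) ∷ u) with ℕₚ.<-cmp s d
  ... | tri≈ _ e _ = ⊥-elim (s≢d e)
  ... | tri> _ _ d<s = begin
    y * antichain s s (d ∷ w) + ⟦ s <ᵇ d ⟧ * (y * antichain s d w)
      ≈⟨ +-congʳ (*-congˡ (trans (antichain-single s d w s≢d) (*-congˡ (runs-avoiding (d ∷ w) u)))) ⟩
    y * (⟦ d <ᵇ s ⟧ * avoiding (d ∷ w)) + ⟦ s <ᵇ d ⟧ * (y * antichain s d w)
      ≈⟨ step ⟩
    avoiding (s ∷ d ∷ w) ∎
    where
    step : y * (⟦ d <ᵇ s ⟧ * avoiding (d ∷ w)) + ⟦ s <ᵇ d ⟧ * (y * antichain s d w) ≈ avoiding (s ∷ d ∷ w)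
    step rewrite >ᵇ-false d<s | <ᵇ-true d<s | starts-descent w d<s =
      solve 4 (λ y p q r → y :* (con 1 :* (p :* q)) :+ con 0 :* r := p :* (y :* q)) refl _ _ _ _
  ... | tri< s<d _ _ = ascent w u
    where
    simplify : ∀ w → y * antichain s s (d ∷ w) + ⟦ s <ᵇ d ⟧ * (y * antichain s d w) ≈ y * antichain s d w
    simplify w = trans (+-congʳ (*-congˡ (antichain-single s d w s≢d))) step
      where
      step : y * (⟦ d <ᵇ s ⟧ * runs (d ∷ w)) + ⟦ s <ᵇ d ⟧ * (y * antichain s d w) ≈ y * antichain s d w
      step rewrite <ᵇ-true s<d | >ᵇ-false s<d = solve 3 (λ y p q → y :* (con 0 :* p) :+ con 1 :* q := q) refl _ _ _

    ascent : ∀ w → AllPairs _≢_ (d ∷ w) →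
      y * antichain s s (d ∷ w) + ⟦ s <ᵇ d ⟧ * (y * antichain s d w) ≈ avoiding (s ∷ d ∷ w)
    ascent [] _ = trans (simplify []) lem
      where
      lem : y * 1# ≈ avoiding (s ∷ d ∷ [])
      lem rewrite >ᵇ-false s<d = sym (*-identityˡ _)
    ascent (e ∷ w) ((d≢e ∷ _) ∷ u) = begin
      y * antichain s s (d ∷ e ∷ w) + ⟦ s <ᵇ d ⟧ * (y * antichain s d (e ∷ w))
        ≈⟨ simplify (e ∷ w) ⟩
      y * antichain s d (e ∷ w)
        ≈⟨ *-congˡ (trans (antichain-pair s d e w s<d d≢e u) (*-congˡ (*-congˡ (runs-avoiding (e ∷ w) u)))) ⟩
      y * (⟦ not (startsᵇ (s ∷ d ∷ e ∷ w)) ⟧ * (⟦ e <ᵇ d ⟧ * avoiding (e ∷ w)))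
        ≈⟨ step ⟩
      avoiding (s ∷ d ∷ e ∷ w) ∎
      where
      starts-ascent : ∀ w → d < e → startsᵇ (s ∷ d ∷ e ∷ w) ≡ true
      starts-ascent []      d<e rewrite <ᵇ-true s<d | <ᵇ-true d<e = ≡.refl
      starts-ascent (_ ∷ _) d<e rewrite <ᵇ-true s<d | <ᵇ-true d<e = ≡.refl

      step : y * (⟦ not (startsᵇ (s ∷ d ∷ e ∷ w)) ⟧ * (⟦ e <ᵇ d ⟧ * avoiding (e ∷ w))) ≈ avoiding (s ∷ d ∷ e ∷ w)
      step with ℕₚ.<-cmp d e
      ... | tri≈ _ e≡ _ = ⊥-elim (d≢e e≡)
      ... | tri< d<e _ _ rewrite starts-ascent w d<e =
        solve 3 (λ y p q → y :* (con 0 :* p) := con 0 :* q) refl _ _ _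
      ... | tri> _ _ e<d rewrite >ᵇ-false s<d | <ᵇ-true e<d | starts-descent w e<d
        with startsᵇ (s ∷ d ∷ e ∷ w)
      ...   | true  = solve 3 (λ y p q → y :* (con 0 :* p) := con 0 :* q) refl _ _ _
      ...   | false = solve 3 (λ y p q → y :* (con 1 :* (con 1 :* (p :* q))) := p :* (y :* q)) refl _ _ _

  avoiding-++-min : ∀ {m} u w → All (m <_) u → avoiding (u ++ m ∷ w) ≈ avoiding u * avoiding (m ∷ w)
  avoiding-++-min         []      w _   = sym (*-identityˡ _)
  avoiding-++-min {m} (a ∷ u) w m<u = begin
    ⟦ not (matchesᵇ (a ∷ u ++ m ∷ w)) ⟧ * y ^ suc (des (a ∷ u ++ m ∷ w))
      ≡⟨ ≡.cong₂ (λ p q → ⟦ not p ⟧ * y ^ suc q) (matches-++-min (a ∷ u) w m<u) (des-++-min a u w m<u) ⟩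
    ⟦ not (matchesᵇ (a ∷ u) ∨ matchesᵇ (m ∷ w)) ⟧ * y ^ (suc (des (a ∷ u)) ℕ.+ suc (des (m ∷ w)))
      ≈⟨ *-cong (⟦not-∨⟧ (matchesᵇ (a ∷ u)) (matchesᵇ (m ∷ w))) (^-homo-* y (suc (des (a ∷ u))) _) ⟩
    (⟦ not (matchesᵇ (a ∷ u)) ⟧ * ⟦ not (matchesᵇ (m ∷ w)) ⟧) * (y ^ suc (des (a ∷ u)) * y ^ suc (des (m ∷ w)))
      ≈⟨ solve 4 (λ a b c d → (a :* b) :* (c :* d) := (a :* c) :* (b :* d)) refl _ _ _ _ ⟩
    avoiding (a ∷ u) * avoiding (m ∷ w) ∎

  weight : Carrier → List ℕ → Carrier
  weight ξ w = ξ ^ LRmin w * avoiding w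

  weight-++-min : ∀ ξ {m} u w → All (m <_) u → All (m <_) w → weight ξ (u ++ m ∷ w) ≈ weight ξ u * (ξ * avoiding (m ∷ w))
  weight-++-min ξ {m} u w m<u m<w = begin
    ξ ^ LRmin (u ++ m ∷ w) * avoiding (u ++ m ∷ w)
      ≈⟨ *-cong (reflexive (≡.cong (ξ ^_) (LRmin-++-min u w m<u m<w))) (avoiding-++-min u w m<u) ⟩
    (ξ * ξ ^ LRmin u) * (avoiding u * avoiding (m ∷ w))
      ≈⟨ solve 4 (λ x p a b → (x :* p) :* (a :* b) := (p :* a) :* (x :* b)) refl _ _ _ _ ⟩
    weight ξ u * (ξ * avoiding (m ∷ w)) ∎

arr-All : ∀ {P : ℕ → Set} {S} → All P S → All (All P) (arr S)
arr-All {S = S} p = All.map (λ e → All-resp-↭ (↭-sym e) p) (arr-↭ S)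

ins-Any : ∀ {P : ℕ → Set} {m} → P m → ∀ w → All (Any P) (ins m w)
ins-Any p []      = here p ∷ []
ins-Any p (h ∷ t) = here p ∷ Allₚ.map⁺ (All.map there (ins-Any p t))

-- Signed chains of bricks as lattice paths

module ChainCount (K : Ring₀) (y : CommutativeRing.Carrier K) where
  open CommutativeRing K
  open ListSums K
  open Bricks K y
  open SetoidReasoning setoid
  open import Algebra.Solver.Ring.NaturalCoefficients.Default commutativeSemiring using (solve; _:+_; _:*_; _:=_; con)

  private
    vanish : ∀ f l s d {p q} → (f < s → p ≈ 0#) → (f < s → ∀ b → ⟦ s <ᵇ d ⟧ * (⟦ b ⟧ * q) ≈ 0#) →
      ⟦ f , l ≺ᵇ s , s ⟧ * p + ⟦ s <ᵇ d ⟧ * (⟦ f , l ≺ᵇ s , d ⟧ * q) ≈ 0#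
    vanish f l s d p≈0 q≈0 with f <ᵇ s in f<s
    ... | true  = trans (+-cong (trans (*-congˡ (p≈0 (<ᵇ-true⁻¹ f s f<s))) (zeroʳ _)) (q≈0 (<ᵇ-true⁻¹ f s f<s) (l <ᵇ d)))
                    (+-identityʳ _)
    ... | false = solve 3 (λ p i q → con 0 :* p :+ i :* (con 0 :* q) := con 0) refl _ _ _

  mutual
    -- First letters increase along a chain and no brick ends below its first letter, so all later
    -- letters have to exceed `f`.
    chain-below : ∀ f l w → Any (_< f) w → chain f l w ≈ 0#
    chain-below f l (s ∷ [])    (here s<f) rewrite >ᵇ-false s<f = zeroˡ _
    chain-below f l (s ∷ d ∷ w) (here s<f) rewrite >ᵇ-false s<f =
      solve 3 (λ p i q → con 0 :* p :+ i :* (con 0 :* q) := con 0) refl _ _ _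
    chain-below f l (s ∷ d ∷ w) (there p) = vanish f l s d
      (λ f<s → trans (*-congˡ (chain-below s s (d ∷ w) (Any.map (λ x<f → ℕₚ.<-trans x<f f<s) p))) (zeroʳ _))
      (λ f<s → second s d w (Any.map (λ x<f → ℕₚ.<-trans x<f f<s) p))

    second : ∀ s d w → Any (_< s) (d ∷ w) → ∀ b → ⟦ s <ᵇ d ⟧ * (⟦ b ⟧ * (- y * chain s d w)) ≈ 0#
    second s d w (here d<s) b rewrite >ᵇ-false d<s = zeroˡ _
    second s d w (there p)  b = begin
      ⟦ s <ᵇ d ⟧ * (⟦ b ⟧ * (- y * chain s d w)) ≈⟨ *-congˡ (*-congˡ (*-congˡ (chain-below s d w p))) ⟩
      ⟦ s <ᵇ d ⟧ * (⟦ b ⟧ * (- y * 0#))          ≈⟨ solve 3 (λ i r n → i :* (r :* (n :* con 0)) := con 0) refl _ _ _ ⟩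
      0# ∎

  chain-∷-below : ∀ f l c w → Any (_< c) w → chain f l (c ∷ w) ≈ 0#
  chain-∷-below f l c (d ∷ w) p = trans (+-cong
    (trans (*-congˡ (trans (*-congˡ (chain-below c c (d ∷ w) p)) (zeroʳ _))) (zeroʳ _))
    (second c d w p (f , l ≺ᵇ c , d))) (+-identityʳ _)

  -- Behind `c`, the letter `m` would lie below the first letter of an earlier or of its own brick;
  -- only insertion at the front can contribute.
  sum-chain-∷-ins : ∀ f l {m} c t → m < c → sumL (map (c ∷_) (ins m t)) (chain f l) ≈ 0#
  sum-chain-∷-ins f l {m} c t m<c = trans (sumL-map (ins m t) (c ∷_) (chain f l))
    (sumL-0ᴬ (All.map (λ {z} → chain-∷-below f l c z) (ins-Any m<c t)))

  -- Chains whose first d bricks have already lost their smaller letters (all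
  -- below the letters of the word).
  pending : ℕ → ℕ → ℕ → List ℕ → Carrier
  pending zero    f l w       = chain f l w
  pending (suc d) f l []      = 0#
  pending (suc d) f l (c ∷ w) = ⟦ l <ᵇ c ⟧ * pending d f c w

  -- Last letters increase along the chain, so a letter below `l` can neither close a pair nor be a
  -- single. It can only open a pair, which then waits behind the `d` pairs already open.
  sum-ins-pending-above : ∀ d f l {m} w → f < m → m < l → All (m <_) w →
    sumL (ins m w) (pending d f l) ≈ - y * pending (suc d) m l w
  sum-ins-pending-above zero f l [] f<m m<l _ rewrite <ᵇ-true f<m | >ᵇ-false m<l =
    solve 2 (λ p q → con 0 :* p :+ con 0 := q :* con 0) refl _ _
  sum-ins-pending-above zero f l {m} (c ∷ t) f<m m<l (m<c ∷ _) =
    trans (+-congˡ (sum-chain-∷-ins f l c t m<c)) lem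
    where
    lem : chain f l (m ∷ c ∷ t) + 0# ≈ - y * (⟦ l <ᵇ c ⟧ * chain m c t)
    lem rewrite <ᵇ-true f<m | >ᵇ-false m<l | <ᵇ-true m<c =
      solve 4 (λ p r n q → con 0 :* p :+ con 1 :* (r :* (n :* q)) :+ con 0 := n :* (r :* q)) refl _ _ _ _
  sum-ins-pending-above (suc d) f l [] f<m m<l _ rewrite >ᵇ-false m<l =
    solve 2 (λ p q → con 0 :* p :+ con 0 := q :* con 0) refl _ _
  sum-ins-pending-above (suc d) f l {m} (c ∷ t) f<m m<l (m<c ∷ m<t) rewrite >ᵇ-false m<l = begin
    0# * pending d f m (c ∷ t) + sumL (map (c ∷_) (ins m t)) (pending (suc d) f l)
      ≈⟨ +-cong (zeroˡ _) (trans (sumL-map (ins m t) (c ∷_) _) (sumL-*ˡ (ins m t) _ _)) ⟩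
    0# + ⟦ l <ᵇ c ⟧ * sumL (ins m t) (pending d f c)
      ≈⟨ +-congˡ (*-congˡ (sum-ins-pending-above d f c t f<m m<c m<t)) ⟩
    0# + ⟦ l <ᵇ c ⟧ * (- y * pending (suc d) m c t)
      ≈⟨ solve 3 (λ i n p → con 0 :+ i :* (n :* p) := n :* (i :* p)) refl _ _ _ ⟩
    - y * (⟦ l <ᵇ c ⟧ * pending (suc d) m c t) ∎

  -- The least letter is a single brick, or opens a pair …
  sum-ins-chain : ∀ f l {m} w → f < m → l < m → All (m <_) w →
    sumL (ins m w) (chain f l) ≈ - y * chain m m w + - y * pending 1 m l w
  sum-ins-chain f l [] f<m l<m _ rewrite <ᵇ-true f<m | <ᵇ-true l<m =
    solve 1 (λ p → con 1 :* (p :* con 1) :+ con 0 := p :* con 1 :+ p :* con 0) refl _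
  sum-ins-chain f l {m} (c ∷ t) f<m l<m (m<c ∷ _) = trans (+-congˡ (sum-chain-∷-ins f l c t m<c)) lem
    where
    lem : chain f l (m ∷ c ∷ t) + 0# ≈ - y * chain m m (c ∷ t) + - y * (⟦ l <ᵇ c ⟧ * chain m c t)
    lem rewrite <ᵇ-true f<m | <ᵇ-true l<m | <ᵇ-true m<c =
      solve 4 (λ n p r q → con 1 :* (n :* p) :+ con 1 :* (r :* (n :* q)) :+ con 0 := n :* p :+ n :* (r :* q)) refl _ _ _ _

  -- … or closes the earliest open pair.
  sum-ins-pending : ∀ d f l {m} w → f < m → l < m → All (m <_) w →
    sumL (ins m w) (pending (suc d) f l) ≈ pending d f m w + - y * pending (suc (suc d)) m l w
  sum-ins-pending d f l [] f<m l<m _ rewrite <ᵇ-true l<m =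
    solve 2 (λ p n → con 1 :* p :+ con 0 := p :+ n :* con 0) refl _ _
  sum-ins-pending d f l {m} (c ∷ t) f<m l<m (m<c ∷ m<t) rewrite <ᵇ-true l<m = begin
    1# * pending d f m (c ∷ t) + sumL (map (c ∷_) (ins m t)) (pending (suc d) f l)
      ≈⟨ +-cong (*-identityˡ _) (trans (sumL-map (ins m t) (c ∷_) _) (sumL-*ˡ (ins m t) _ _)) ⟩
    pending d f m (c ∷ t) + ⟦ l <ᵇ c ⟧ * sumL (ins m t) (pending d f c)
      ≈⟨ +-congˡ (*-congˡ (sum-ins-pending-above d f c t f<m m<c m<t)) ⟩
    pending d f m (c ∷ t) + ⟦ l <ᵇ c ⟧ * (- y * pending (suc d) m c t)
      ≈⟨ +-congˡ (solve 3 (λ i n p → i :* (n :* p) := n :* (i :* p)) refl _ _ _) ⟩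
    pending d f m (c ∷ t) + - y * (⟦ l <ᵇ c ⟧ * pending (suc d) m c t) ∎

  -- Weighted lattice paths of n steps from height d, the number of open pairs, to height 0.
  -- Up-steps and level steps start a brick and weigh -y, down-steps weigh 1. Level steps occur at
  -- height 0 only: a single met while a pair is open would have to end above a letter still to
  -- come.
  paths : ℕ → ℕ → Carrier
  paths zero    zero    = 1#
  paths (suc d) zero    = 0#
  paths zero    (suc n) = - y * paths 0 n + - y * paths 1 n
  paths (suc d) (suc n) = paths d n + - y * paths (suc (suc d)) n

  -- Removing the least letter turns the insertion rules into the steps of `paths`. The letters `f`
  -- and `l` lie below all others and leave no trace in the total, so the induction hypothesis
  -- applies to whatever replaces them.
  sum-pending : ∀ d f l S → AllPairs _<_ S → All (f <_) S → All (l <_) S →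
    sumL (arr S) (pending d f l) ≈ paths d (length S)
  sum-pending zero    f l [] _ _ _ = +-identityʳ _
  sum-pending (suc d) f l [] _ _ _ = +-identityʳ _
  sum-pending zero f l (m ∷ S) (m<S ∷ asc) (f<m ∷ _) (l<m ∷ _) = begin
    sumL (arr (m ∷ S)) (chain f l)
      ≈⟨ sumL-concatMap (arr S) (ins m) (chain f l) ⟩
    sumL (arr S) (λ w → sumL (ins m w) (chain f l))
      ≈⟨ sumL-congᴬ (All.map (λ {w} → sum-ins-chain f l w f<m l<m) (arr-All m<S)) ⟩
    sumL (arr S) (λ w → - y * chain m m w + - y * pending 1 m l w)
      ≈⟨ trans (sumL-+ (arr S) _ _) (+-cong (sumL-*ˡ (arr S) _ _) (sumL-*ˡ (arr S) _ _)) ⟩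
    - y * sumL (arr S) (chain m m) + - y * sumL (arr S) (pending 1 m l)
      ≈⟨ +-cong (*-congˡ (sum-pending 0 m m S asc m<S m<S))
                (*-congˡ (sum-pending 1 m l S asc m<S (All.map (ℕₚ.<-trans l<m) m<S))) ⟩
    paths 0 (suc (length S)) ∎
  sum-pending (suc d) f l (m ∷ S) (m<S ∷ asc) (f<m ∷ f<S) (l<m ∷ _) = begin
    sumL (arr (m ∷ S)) (pending (suc d) f l)
      ≈⟨ sumL-concatMap (arr S) (ins m) (pending (suc d) f l) ⟩
    sumL (arr S) (λ w → sumL (ins m w) (pending (suc d) f l))
      ≈⟨ sumL-congᴬ (All.map (λ {w} → sum-ins-pending d f l w f<m l<m) (arr-All m<S)) ⟩
    sumL (arr S) (λ w → pending d f m w + - y * pending (suc (suc d)) m l w)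
      ≈⟨ trans (sumL-+ (arr S) _ _) (+-congˡ (sumL-*ˡ (arr S) _ _)) ⟩
    sumL (arr S) (pending d f m) + - y * sumL (arr S) (pending (suc (suc d)) m l)
      ≈⟨ +-cong (sum-pending d f m S asc f<S m<S)
                (*-congˡ (sum-pending (suc (suc d)) m l S asc m<S (All.map (ℕₚ.<-trans l<m) m<S))) ⟩
    paths (suc d) (suc (length S)) ∎

-- Generating functions of the words over a set

AllPairs-resp-⊆ : ∀ {R : A → A → Set} {T S} → T ⊆ S → AllPairs R S → AllPairs R T
AllPairs-resp-⊆ []           []       = []
AllPairs-resp-⊆ (_ ∷ʳ p)     (_ ∷ rs) = AllPairs-resp-⊆ p rs
AllPairs-resp-⊆ (≡.refl ∷ p) (r ∷ rs) = All-resp-⊆ p r ∷ AllPairs-resp-⊆ p rs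

arr-distinct : ∀ {S : List ℕ} → AllPairs _≢_ S → All (AllPairs _≢_) (arr S)
arr-distinct {S} u = All.map (λ e → Permₛ.Unique-resp-↭ (≡.setoid ℕ) (↭⇒↭ₛ (↭-sym e)) u) (arr-↭ S)

-- Permutations as arrangements

picks : List A → List (A × List A)
picks []      = []
picks (x ∷ S) = (x , S) ∷ map (λ (v , T) → v , x ∷ T) (picks S)

picks-All : ∀ {P : A → Set} {S} → All P S → All (P ∘ proj₁) (picks S)
picks-All []       = []
picks-All (p ∷ ps) = p ∷ Allₚ.map⁺ (picks-All ps)

picks-⊆ : ∀ (S : List A) → All (λ (v , T) → T ⊆ S × length S ≡ suc (length T)) (picks S)
picks-⊆ []      = []
picks-⊆ (x ∷ S) = (x ∷ʳ ⊆-refl , ≡.refl) ∷ Allₚ.map⁺ (All.map (λ (p , e) → ≡.refl ∷ p , ≡.cong suc e) (picks-⊆ S))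

wordsOver : List ℕ → ℕ → List (List ℕ)
wordsOver S zero    = [] ∷ []
wordsOver S (suc l) = concatMap (λ v → map (v ∷_) (wordsOver S l)) S

words-wordsOver : ∀ n l → words n l ≡ wordsOver (applyUpTo suc n) l
words-wordsOver n zero    = ≡.refl
words-wordsOver n (suc l) = ≡.cong (λ W → concatMap (λ v → map (v ∷_) W) (applyUpTo suc n)) (words-wordsOver n l)

≡ᵇ-refl : ∀ n → (n ≡ᵇ n) ≡ true
≡ᵇ-refl zero    = ≡.refl
≡ᵇ-refl (suc n) = ≡ᵇ-refl n

≢⇒≡ᵇ-false : ∀ m n → m ≢ n → (m ≡ᵇ n) ≡ false
≢⇒≡ᵇ-false zero    zero    p = ⊥-elim (p ≡.refl)
≢⇒≡ᵇ-false zero    (suc n) p = ≡.refl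
≢⇒≡ᵇ-false (suc m) zero    p = ≡.refl
≢⇒≡ᵇ-false (suc m) (suc n) p = ≢⇒≡ᵇ-false m n (p ∘ ≡.cong suc)

module WordSums (K : Ring₀) where
  open CommutativeRing K
  open ListSums K
  open SetoidReasoning setoid

  sum-picks : ∀ (S : List A) f → sumL (picks S) (f ∘ proj₁) ≈ sumL S f
  sum-picks []      f = refl
  sum-picks (x ∷ S) f = +-congˡ (trans (sumL-map (picks S) _ _) (sum-picks S f))

  -- Passes from the enumeration by insertion to the one by first letters, which `words` uses.
  -- Either `m` itself comes first, or it is inserted behind the first letter of an arrangement of
  -- the others.
  sum-arr-picks : ∀ (m : A) S G →
    sumL (arr (m ∷ S)) G ≈ sumL (picks (m ∷ S)) (λ (v , T) → sumL (arr T) (G ∘ (v ∷_)))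
  sum-arr-picks {A} m S G = begin
    sumL (arr (m ∷ S)) G
      ≈⟨ sumL-concatMap (arr S) (ins m) G ⟩
    sumL (arr S) (λ w → sumL (ins m w) G)
      ≈⟨ sumL-cong (arr S) front ⟩
    sumL (arr S) (λ w → G (m ∷ w) + later w)
      ≈⟨ sumL-+ (arr S) _ _ ⟩
    sumL (arr S) (G ∘ (m ∷_)) + sumL (arr S) later
      ≈⟨ +-congˡ (trans (rec S) (sym (sumL-map (picks S) _ _))) ⟩
    sumL (picks (m ∷ S)) (λ (v , T) → sumL (arr T) (G ∘ (v ∷_))) ∎
    where
    later : List A → Carrier
    later []      = 0#
    later (h ∷ t) = sumL (ins m t) (G ∘ (h ∷_))

    front : ∀ w → sumL (ins m w) G ≈ G (m ∷ w) + later w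
    front []      = refl
    front (h ∷ t) = +-congˡ (sumL-map (ins m t) _ _)

    rec : ∀ S → sumL (arr S) later ≈ sumL (picks S) (λ (v , T) → sumL (arr (m ∷ T)) (G ∘ (v ∷_)))
    rec []      = +-identityʳ _
    rec (x ∷ S) = trans (sum-arr-picks x S later)
      (sumL-cong (picks (x ∷ S)) (λ (v , T) → sym (sumL-concatMap (arr T) (ins m) _)))

  -- Deletion of `v` expressed through sums over letters, the form in which `sum-words-without`
  -- applies it at each position.
  Removes : ℕ → List ℕ → List ℕ → Set
  Removes v S T = ∀ h → sumL S (λ u → ⟦ not (v ≡ᵇ u) ⟧ * h u) ≈ sumL T h

  removes-head : ∀ {v S} → All (v ≢_) S → Removes v S S
  removes-head {v} all h = sumL-congᴬ (All.map (λ {u} v≢u →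
    trans (*-congʳ (reflexive (≡.cong (⟦_⟧ ∘ not) (≢⇒≡ᵇ-false v u v≢u)))) (*-identityˡ _)) all)

  picks-remove : ∀ {S} → AllPairs _≢_ S → All (λ (v , T) → Removes v S T) (picks S)
  picks-remove []                  = []
  picks-remove {x ∷ S} (x∉S ∷ u) =
    (λ h → trans (+-cong (trans (*-congʳ (reflexive (≡.cong (⟦_⟧ ∘ not) (≡ᵇ-refl x)))) (zeroˡ _)) (removes-head x∉S h)) (+-identityˡ _))
    ∷ Allₚ.map⁺ (All.zipWith
        (λ {(v , T)} (x≢v , r) h → +-cong
          (trans (*-congʳ (reflexive (≡.cong (⟦_⟧ ∘ not) (≢⇒≡ᵇ-false v x (x≢v ∘ ≡.sym))))) (*-identityˡ _)) (r h))
        (picks-All x∉S , picks-remove u))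

  sum-wordsOver : ∀ S l (G : List ℕ → Carrier) → sumL (wordsOver S (suc l)) G ≈ sumL S (λ v → sumL (wordsOver S l) (G ∘ (v ∷_)))
  sum-wordsOver S l G = trans (sumL-concatMap S _ G) (sumL-cong S (λ v → sumL-map (wordsOver S l) _ _))

  sum-words-without : ∀ v {S T} → Removes v S T → ∀ l G →
    sumL (wordsOver S l) (λ w → ⟦ not (memᵇ v w) ⟧ * G w) ≈ sumL (wordsOver T l) G
  sum-words-without v r zero    G = +-congʳ (*-identityˡ _)
  sum-words-without v {S} {T} r (suc l) G = begin
    sumL (wordsOver S (suc l)) (λ w → ⟦ not (memᵇ v w) ⟧ * G w)
      ≈⟨ sum-wordsOver S l _ ⟩
    sumL S (λ u → sumL (wordsOver S l) (λ w → ⟦ not ((v ≡ᵇ u) ∨ memᵇ v w) ⟧ * G (u ∷ w)))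
      ≈⟨ sumL-cong S (λ u → trans
           (sumL-cong (wordsOver S l) (λ w → trans (*-congʳ (⟦not-∨⟧ (v ≡ᵇ u) (memᵇ v w))) (*-assoc _ _ _)))
           (trans (sumL-*ˡ (wordsOver S l) _ _) (*-congˡ (sum-words-without v r l (G ∘ (u ∷_)))))) ⟩
    sumL S (λ u → ⟦ not (v ≡ᵇ u) ⟧ * sumL (wordsOver T l) (G ∘ (u ∷_)))
      ≈⟨ r _ ⟩
    sumL T (λ u → sumL (wordsOver T l) (G ∘ (u ∷_)))
      ≈⟨ sum-wordsOver T l G ⟨
    sumL (wordsOver T (suc l)) G ∎

  sum-distinct-words : ∀ l S → AllPairs _≢_ S → length S ≡ l → ∀ G →
    sumL (wordsOver S l) (λ w → ⟦ distinctᵇ w ⟧ * G w) ≈ sumL (arr S) G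
  sum-distinct-words zero    []      _ _ G = +-congʳ (*-identityˡ _)
  sum-distinct-words (suc l) S@(m ∷ S₀) u e G = begin
    sumL (wordsOver S (suc l)) (λ w → ⟦ distinctᵇ w ⟧ * G w)
      ≈⟨ sum-wordsOver S l _ ⟩
    sumL S (λ v → sumL (wordsOver S l) (λ w → ⟦ not (memᵇ v w) ∧ distinctᵇ w ⟧ * G (v ∷ w)))
      ≈⟨ sumL-cong S (λ v → sumL-cong (wordsOver S l) (λ w →
           trans (*-congʳ (⟦∧⟧ (not (memᵇ v w)) (distinctᵇ w))) (*-assoc _ _ _))) ⟩
    sumL S (λ v → sumL (wordsOver S l) (λ w → ⟦ not (memᵇ v w) ⟧ * (⟦ distinctᵇ w ⟧ * G (v ∷ w))))
      ≈⟨ sum-picks S _ ⟨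
    sumL (picks S) (λ (v , T) → sumL (wordsOver S l) (λ w → ⟦ not (memᵇ v w) ⟧ * (⟦ distinctᵇ w ⟧ * G (v ∷ w))))
      ≈⟨ sumL-congᴬ (All.zipWith (λ {(v , T)} (r , T⊆S , len) →
           trans (sum-words-without v r l (λ w → ⟦ distinctᵇ w ⟧ * G (v ∷ w)))
             (sum-distinct-words l T (AllPairs-resp-⊆ T⊆S u) (ℕₚ.suc-injective (≡.trans (≡.sym len) e)) (G ∘ (v ∷_))))
           (picks-remove u , picks-⊆ S)) ⟩
    sumL (picks S) (λ (v , T) → sumL (arr T) (G ∘ (v ∷_)))
      ≈⟨ sum-arr-picks m S₀ G ⟨
    sumL (arr S) G ∎

  sum-Perms : ∀ n G → sumL (Perms n) G ≈ sumL (arr (applyUpTo suc n)) G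
  sum-Perms n G = begin
    sumL (Perms n) G
      ≈⟨ sumL-filterᵇ distinctᵇ (words n n) G ⟩
    sumL (words n n) (λ w → ⟦ distinctᵇ w ⟧ * G w)
      ≡⟨ ≡.cong (λ W → sumL W (λ w → ⟦ distinctᵇ w ⟧ * G w)) (words-wordsOver n n) ⟩
    sumL (wordsOver (applyUpTo suc n) n) (λ w → ⟦ distinctᵇ w ⟧ * G w)
      ≈⟨ sum-distinct-words n (applyUpTo suc n)
           (AllPairsₚ.applyUpTo⁺₁ suc n (λ i<j _ e → ℕₚ.<⇒≢ i<j (ℕₚ.suc-injective e))) (length-applyUpTo suc n) G ⟩
    sumL (arr (applyUpTo suc n)) G ∎

-- Solving the convolution equations

Ascending : List ℕ → Set
Ascending S = AllPairs _<_ S × All (0 <_) S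

ascending-⊆ : ∀ {T S} → T ⊆ S → Ascending S → Ascending T
ascending-⊆ p (a , b) = AllPairs-resp-⊆ p a , All-resp-⊆ p b

module Counting
  (K : Ring₀) (y ξ : CommutativeRing.Carrier K)
  where
  open CommutativeRing K
  open PowerSeries K
  open Exponential K
  open EgfProducts K
  open ListSums K
  open Bricks K y
  open ChainCount K y
  open import Algebra.Properties.Group +-group using (x∙y⁻¹≈ε⇒x≈y)
  open import Algebra.Solver.Ring.NaturalCoefficients.Default commutativeSemiring using (solve; _:*_; _:=_)

  -- By induction on the size, the difference of `a` and `b` vanishes on all smaller sets, and then
  -- only the splitting with empty first part remains. The predicate `P` is hereditary so that the
  -- induction stays within the sets considered.
  convolution-cancel : (P : List ℕ → Set) → (∀ {T S} → T ⊆ S → P S → P T) →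
    ∀ (g : ℕ → Carrier) → g 0 ≈ 1# → (a b : List ℕ → Carrier) →
    (∀ S → P S → sumL (splits S) (λ (T , T′) → g (length T) * a T′) ≈ sumL (splits S) (λ (T , T′) → g (length T) * b T′)) →
    ∀ S → P S → a S ≈ b S
  convolution-cancel P P-⊆ g g₀ a b e S₀ PS₀ = x∙y⁻¹≈ε⇒x≈y _ _ (go (length S₀) S₀ ℕₚ.≤-refl PS₀)
    where
    open SetoidReasoning setoid
    δ : List ℕ → Carrier
    δ T = a T + - b T

    go : ∀ n S → length S ≤ n → P S → δ S ≈ 0#
    smaller : ∀ n S → length S ≤ n → P S → ∀ T → T ⊆ S → length T < length S → δ T ≈ 0#
    smaller zero    S l p T T⊆S T<S with () ← ℕₚ.<-≤-trans T<S l
    smaller (suc n) S l p T T⊆S T<S = go n T (ℕₚ.≤-pred (ℕₚ.<-≤-trans T<S l)) (P-⊆ T⊆S p)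
    go n S l p = begin
      δ S
        ≈⟨ trans (*-congʳ g₀) (*-identityˡ _) ⟨
      g 0 * δ S
        ≈⟨ sum-splits-top g S δ (smaller n S l p) ⟨
      sumL (splits S) (λ (T , T′) → g (length T) * (a T′ + - b T′))
        ≈⟨ trans (sumL-cong (splits S) (λ _ → distribˡ _ _ _)) (sumL-+ (splits S) _ _) ⟩
      sumL (splits S) (λ (T , T′) → g (length T) * a T′) + sumL (splits S) (λ (T , T′) → g (length T) * - b T′)
        ≈⟨ +-congʳ (e S p) ⟩
      sumL (splits S) (λ (T , T′) → g (length T) * b T′) + sumL (splits S) (λ (T , T′) → g (length T) * - b T′)
        ≈⟨ sumL-+ (splits S) _ _ ⟨
      sumL (splits S) (λ (T , T′) → g (length T) * b T′ + g (length T) * - b T′)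
        ≈⟨ sumL-0ᴬ (All.universal (λ _ → trans (sym (distribˡ _ _ _)) (trans (*-congˡ (-‿inverseʳ _)) (zeroʳ _))) (splits S)) ⟩
      0# ∎

  sum-arr-min : ∀ {m S} (f g : List ℕ → Carrier) → All (m <_) S →
    (∀ τ σ → All (m <_) τ → All (m <_) σ → f (τ ++ m ∷ σ) ≈ f τ * g σ) →
    sumL (arr (m ∷ S)) f ≈ sumL (splits S) (λ (T , T′) → sumL (arr T) f * sumL (arr T′) g)
  sum-arr-min {m} {S} f g m<S mult = trans (sum-arr-∷ m S f) (sumL-congᴬ (All.map
    (λ {(T , T′)} (T⊆S , T′⊆S) → trans
      (sumL-congᴬ (All.map (λ {τ} m<τ → sumL-congᴬ (All.map (λ {σ} m<σ → mult τ σ m<τ m<σ) (arr-All (All-resp-⊆ T′⊆S m<S))))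
        (arr-All (All-resp-⊆ T⊆S m<S))))
      (sumL-product (arr T) (arr T′) f g))
    (splits-⊆ S)))

  module _
    {U B F X : PS} (U-paths : ∀ n → egf U n ≈ paths 0 n) (U·B : U · B ≋ one)
    (F₀ : F 0 ≈ 1#) (F′ : D F ≋ X · (U · D B) · F) (X-const : ∀ G → X · G ≋ (λ n → ξ * G n))
    where

    sum-chain : ∀ S → Ascending S → sumL (arr S) (chain 0 0) ≈ egf U (length S)
    sum-chain S (asc , pos) = trans (sum-pending 0 0 0 S asc pos pos) (sym (U-paths (length S)))

    sum-runs : ∀ S → Ascending S → sumL (arr S) runs ≈ sumL (arr S) avoiding
    sum-runs S (asc , _) = sumL-congᴬ (All.map (λ {w} → runs-avoiding w) (arr-distinct (AllPairs.map ℕₚ.<⇒≢ asc)))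

    sum-antichain : ∀ S → Ascending S → sumL (arr S) (antichain 0 0) ≈ egf one (length S)
    sum-antichain []      _         = trans (+-identityʳ _) (sym (*-identityˡ _))
    sum-antichain (m ∷ S) (_ , pos) = trans
      (sumL-0ᴬ (All.zipWith (λ {w} (e , p) → vanish w (↭-length e) p) (arr-↭ (m ∷ S) , arr-All pos)))
      (sym (zeroʳ _))
      where
      vanish : ∀ w → length w ≡ suc (length S) → All (0 <_) w → antichain 0 0 w ≈ 0#
      vanish (s ∷ w) _ p = antichain-0 s w p

    -- Convolved with `egf U`, the words avoiding the patterns become cut words, a chain followed by
    -- runs. `chain-runs` collapses these to antichains behind the sentinel, whose series is 1 = U
    -- B.
    sum-avoiding : ∀ S → Ascending S → sumL (arr S) avoiding ≈ egf B (length S)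
    sum-avoiding = convolution-cancel Ascending ascending-⊆ (egf U) (U-paths 0) (λ T → sumL (arr T) avoiding) (egf B ∘ length) equation
      where
      open SetoidReasoning setoid
      equation : ∀ S → Ascending S → sumL (splits S) (λ (T , T′) → egf U (length T) * sumL (arr T′) avoiding)
                                   ≈ sumL (splits S) (λ (T , T′) → egf U (length T) * egf B (length T′))
      equation S asc = begin
        sumL (splits S) (λ (T , T′) → egf U (length T) * sumL (arr T′) avoiding)
          ≈⟨ sumL-congᴬ (All.map (λ {(T , T′)} (T⊆S , T′⊆S) → trans
               (*-cong (sym (sum-chain T (ascending-⊆ T⊆S asc))) (sym (sum-runs T′ (ascending-⊆ T′⊆S asc))))
               (sym (sumL-product (arr T) (arr T′) (chain 0 0) runs))) (splits-⊆ S)) ⟩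
        sumL (splits S) (λ (T , T′) → sumL (arr T) (λ τ → sumL (arr T′) (λ σ → chain 0 0 τ * runs σ)))
          ≈⟨ sum-arr-cuts S (λ τ σ → chain 0 0 τ * runs σ) ⟨
        sumL (arr S) (λ w → sumL (cuts w) (λ (τ , σ) → chain 0 0 τ * runs σ))
          ≈⟨ sumL-cong (arr S) (chain-runs 0 0) ⟩
        sumL (arr S) (antichain 0 0)
          ≈⟨ sum-antichain S asc ⟩
        egf one (length S)
          ≈⟨ egf-cong U·B (length S) ⟨
        egf (U · B) (length S)
          ≈⟨ sum-splits-egf S U B ⟨
        sumL (splits S) (λ (T , T′) → egf U (length T) * egf B (length T′)) ∎

    private
      -- Since B = 1/U, this is the logarithmic derivative B′/B.
      Q : PS
      Q = U · D B

      B·Q : B · Q ≋ D B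
      B·Q = S.trans (S.sym (·-assoc B U (D B))) (S.trans (·-cong (S.trans (·-comm B U) U·B) (S.refl {D B})) (·-identityˡ (D B)))

    -- Splitting a word before its least letter writes B′ as B times the series of the words that
    -- start with their least letter. The quotient B′/B solves the same equation, and the factor B
    -- cancels.
    sum-avoiding-min : ∀ m S → Ascending (m ∷ S) → sumL (arr S) (avoiding ∘ (m ∷_)) ≈ egf Q (length S)
    sum-avoiding-min m S₀ asc₀ = convolution-cancel (λ S → Ascending (m ∷ S)) (λ p → ascending-⊆ (≡.refl ∷ p))
        (egf B) B₀ (λ T → sumL (arr T) (avoiding ∘ (m ∷_))) (egf Q ∘ length) equation S₀ asc₀
      where
      open SetoidReasoning setoid
      B₀ : egf B 0 ≈ 1#
      B₀ = trans (sym (sum-avoiding [] ([] , []))) (+-identityʳ _)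

      equation : ∀ S → Ascending (m ∷ S) →
        sumL (splits S) (λ (T , T′) → egf B (length T) * sumL (arr T′) (avoiding ∘ (m ∷_)))
        ≈ sumL (splits S) (λ (T , T′) → egf B (length T) * egf Q (length T′))
      equation S asc@(m<S ∷ asc′ , _ ∷ pos) = begin
        sumL (splits S) (λ (T , T′) → egf B (length T) * sumL (arr T′) (avoiding ∘ (m ∷_)))
          ≈⟨ sumL-congᴬ (All.map (λ {(T , T′)} (T⊆S , _) → *-congʳ (sym (sum-avoiding T (ascending-⊆ T⊆S (asc′ , pos))))) (splits-⊆ S)) ⟩
        sumL (splits S) (λ (T , T′) → sumL (arr T) avoiding * sumL (arr T′) (avoiding ∘ (m ∷_)))
          ≈⟨ sum-arr-min avoiding (avoiding ∘ (m ∷_)) m<S (λ τ σ m<τ _ → avoiding-++-min τ σ m<τ) ⟨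
        sumL (arr (m ∷ S)) avoiding
          ≈⟨ sum-avoiding (m ∷ S) asc ⟩
        egf B (suc (length S))
          ≈⟨ egf-suc B (length S) ⟩
        egf (D B) (length S)
          ≈⟨ egf-cong B·Q (length S) ⟨
        egf (B · Q) (length S)
          ≈⟨ sum-splits-egf S B Q ⟨
        sumL (splits S) (λ (T , T′) → egf B (length T) * egf Q (length T′)) ∎

    -- The least letter is a left-to-right minimum and no letter behind it is one, whence a single
    -- factor `ξ` and the recursion F′ = ξ Q F. The bound `n` carries the induction, since `T` is a
    -- sublist of the tail and not a structural part.
    sum-weight≤ : ∀ n S → length S ≤ n → Ascending S → sumL (arr S) (weight ξ) ≈ egf F (length S)
    sum-weight≤ n       []      _       _ = trans (+-identityʳ _) (*-congˡ (sym F₀))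
    sum-weight≤ (suc n) (m ∷ S) (s≤s l) asc@(m<S ∷ asc′ , _ ∷ pos) = begin
      sumL (arr (m ∷ S)) (weight ξ)
        ≈⟨ sum-arr-min (weight ξ) (λ σ → ξ * avoiding (m ∷ σ)) m<S (weight-++-min ξ) ⟩
      sumL (splits S) (λ (T , T′) → sumL (arr T) (weight ξ) * sumL (arr T′) (λ σ → ξ * avoiding (m ∷ σ)))
        ≈⟨ sumL-congᴬ (All.map (λ {(T , T′)} (T⊆S , T′⊆S) → *-cong
             (sum-weight≤ n T (ℕₚ.≤-trans (length-mono-≤ T⊆S) l) (ascending-⊆ T⊆S (asc′ , pos)))
             (trans (sumL-*ˡ (arr T′) ξ _) (*-congˡ (sum-avoiding-min m T′ (ascending-⊆ (≡.refl ∷ T′⊆S) asc)))))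
             (splits-⊆ S)) ⟩
      sumL (splits S) (λ (T , T′) → egf F (length T) * (ξ * egf Q (length T′)))
        ≈⟨ trans (sumL-cong (splits S) (λ _ → solve 3 (λ f x q → f :* (x :* q) := x :* (f :* q)) refl _ _ _)) (sumL-*ˡ (splits S) _ _) ⟩
      ξ * sumL (splits S) (λ (T , T′) → egf F (length T) * egf Q (length T′))
        ≈⟨ *-congˡ (sum-splits-egf S F Q) ⟩
      ξ * egf (F · Q) (length S)
        ≈⟨ solve 3 (λ x f p → x :* (f :* p) := f :* (x :* p)) refl _ _ _ ⟩
      factorial (length S) * (ξ * (F · Q) (length S))
        ≈⟨ *-congˡ (*-congˡ (·-comm F Q (length S))) ⟩
      factorial (length S) * (ξ * (Q · F) (length S))
        ≈⟨ *-congˡ (X-const (Q · F) (length S)) ⟨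
      factorial (length S) * (X · (Q · F)) (length S)
        ≈⟨ *-congˡ (·-assoc X Q F (length S)) ⟨
      factorial (length S) * (X · Q · F) (length S)
        ≈⟨ *-congˡ (F′ (length S)) ⟨
      egf (D F) (length S)
        ≈⟨ egf-suc F (length S) ⟨
      egf F (suc (length S)) ∎
      where open SetoidReasoning setoid

    sum-weight : ∀ S → Ascending S → sumL (arr S) (weight ξ) ≈ egf F (length S)
    sum-weight S = sum-weight≤ (length S) S ℕₚ.≤-refl

-- The polynomials U

module LatticePaths where
  open import Data.Nat.Combinatorics using (_C_; nCk+nC[k+1]≡[n+1]C[k+1]; nCk≡nC[n∸k]; nC1≡n; k>n⇒nCk≡0)
  import Data.Nat.DivMod as DivMod
  open import Data.Nat.Solver using (module +-*-Solver)
  open import Data.Nat using (⌊_/2⌋)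
  open import Data.Integer as ℤ using (ℤ; +_)
  import Data.Integer.Properties as ℤₚ
  open ≡ using (refl; sym; trans; cong; cong₂; subst; module ≡-Reasoning)
  open ≡-Reasoning
  open +-*-Solver using (solve; _:+_; _:*_; _:=_; con)

  -- The rule (k + 1) C(n, k + 1) = (n - k) C(n, k), arranged so that no truncated subtraction
  -- occurs.
  absorption : ∀ n k → suc k ℕ.* (n C suc k) ℕ.+ k ℕ.* (n C k) ≡ n ℕ.* (n C k)
  absorption zero    k       = cong₂ ℕ._+_ (trans (cong (suc k ℕ.*_) (k>n⇒nCk≡0 {0} {suc k} (s≤s z≤n))) (ℕₚ.*-zeroʳ (suc k))) (zero-term k)
    where
    zero-term : ∀ k → k ℕ.* (0 C k) ≡ 0
    zero-term zero    = refl
    zero-term (suc k) = trans (cong (suc k ℕ.*_) (k>n⇒nCk≡0 {0} {suc k} (s≤s z≤n))) (ℕₚ.*-zeroʳ (suc k))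
  absorption (suc n) zero    = trans (cong (λ z → 1 ℕ.* z ℕ.+ 0) (nC1≡n (suc n)))
    (solve 1 (λ n → con 1 :* n :+ con 0 := n :* con 1) refl (suc n))
  absorption (suc n) (suc k) = begin
    (2 ℕ.+ k) ℕ.* (suc n C (2 ℕ.+ k)) ℕ.+ (1 ℕ.+ k) ℕ.* (suc n C suc k)
      ≡⟨ cong₂ (λ p q → (2 ℕ.+ k) ℕ.* p ℕ.+ (1 ℕ.+ k) ℕ.* q) (nCk+nC[k+1]≡[n+1]C[k+1] n (suc k)) (nCk+nC[k+1]≡[n+1]C[k+1] n k) ⟨
    (2 ℕ.+ k) ℕ.* (b ℕ.+ c) ℕ.+ (1 ℕ.+ k) ℕ.* (a ℕ.+ b)
      ≡⟨ solve 4 (λ k a b c → (con 2 :+ k) :* (b :+ c) :+ (con 1 :+ k) :* (a :+ b)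
           := ((con 2 :+ k) :* c :+ (con 1 :+ k) :* b) :+ ((con 1 :+ k) :* b :+ k :* a) :+ (a :+ b)) refl k a b c ⟩
    ((2 ℕ.+ k) ℕ.* c ℕ.+ (1 ℕ.+ k) ℕ.* b) ℕ.+ ((1 ℕ.+ k) ℕ.* b ℕ.+ k ℕ.* a) ℕ.+ (a ℕ.+ b)
      ≡⟨ cong₂ (λ p q → p ℕ.+ q ℕ.+ (a ℕ.+ b)) (absorption n (suc k)) (absorption n k) ⟩
    n ℕ.* b ℕ.+ n ℕ.* a ℕ.+ (a ℕ.+ b)
      ≡⟨ solve 3 (λ n a b → n :* b :+ n :* a :+ (a :+ b) := (con 1 :+ n) :* (a :+ b)) refl n a b ⟩
    suc n ℕ.* (a ℕ.+ b)
      ≡⟨ cong (suc n ℕ.*_) (nCk+nC[k+1]≡[n+1]C[k+1] n k) ⟩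
    suc n ℕ.* (suc n C suc k) ∎
    where
    a = n C k
    b = n C suc k
    c = n C suc (suc k)

  -- Number of lattice paths from height d + 1 to height 0 with j up-steps that
  -- reach 0 only at the end.
  ballot : ℕ → ℕ → ℕ
  ballot d       zero    = 1
  ballot zero    (suc j) = ballot 1 j
  ballot (suc d) (suc j) = ballot d (suc j) ℕ.+ ballot (suc (suc d)) j

  infix 7 _C₋₁_
  -- C(n, k - 1) with value 0 at k = 0, where truncated subtraction would give C(n, 0) = 1.
  _C₋₁_ : ℕ → ℕ → ℕ
  n C₋₁ zero  = 0
  n C₋₁ suc k = n C k

  pascal : ∀ n k → suc n C k ≡ n C₋₁ k ℕ.+ n C k
  pascal n zero    = refl
  pascal n (suc k) = sym (nCk+nC[k+1]≡[n+1]C[k+1] n k)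

  central : ∀ j → suc (j ℕ.+ j) C j ≡ suc (j ℕ.+ j) C suc j
  central j = trans (nCk≡nC[n∸k] {j} {suc (j ℕ.+ j)} (ℕₚ.m≤n⇒m≤1+n (ℕₚ.m≤m+n j j)))
    (cong (suc (j ℕ.+ j) C_) (ℕₚ.m+n∸n≡m (suc j) j))

  -- The reflection formula C(d + 2j, j) - C(d + 2j, j - 1), verified along the recursion by
  -- Pascal's rule. For d = 0 a down-step would end the path too early, and the symmetry `central`
  -- provides the missing summand.
  ballot-C : ∀ d j → ballot d j ℕ.+ (d ℕ.+ (j ℕ.+ j)) C₋₁ j ≡ (d ℕ.+ (j ℕ.+ j)) C j
  ballot-C d       zero    = refl
  ballot-C zero    (suc j) = begin
    b ℕ.+ (suc (j ℕ.+ suc j)) C j   ≡⟨ cong (λ z → b ℕ.+ suc z C j) (ℕₚ.+-suc j j) ⟩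
    b ℕ.+ suc n C j                 ≡⟨ cong (b ℕ.+_) (pascal n j) ⟩
    b ℕ.+ (n C₋₁ j ℕ.+ n C j)       ≡⟨ ℕₚ.+-assoc b _ _ ⟨
    b ℕ.+ n C₋₁ j ℕ.+ n C j         ≡⟨ cong₂ ℕ._+_ (ballot-C 1 j) (central j) ⟩
    n C j ℕ.+ n C suc j             ≡⟨ nCk+nC[k+1]≡[n+1]C[k+1] n j ⟩
    suc n C suc j                   ≡⟨ cong (λ z → suc z C suc j) (ℕₚ.+-suc j j) ⟨
    suc (j ℕ.+ suc j) C suc j       ∎
    where
    b = ballot 1 j
    n = suc (j ℕ.+ j)
  ballot-C (suc d) (suc j) = begin
    b₁ ℕ.+ b₂ ℕ.+ suc n C j                      ≡⟨ cong (b₁ ℕ.+ b₂ ℕ.+_) (pascal n j) ⟩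
    b₁ ℕ.+ b₂ ℕ.+ (n C₋₁ j ℕ.+ n C j)            ≡⟨ solve 4 (λ p q r s → p :+ q :+ (r :+ s) := (q :+ r) :+ (p :+ s)) refl b₁ b₂ _ _ ⟩
    (b₂ ℕ.+ n C₋₁ j) ℕ.+ (b₁ ℕ.+ n C j)          ≡⟨ cong₂ ℕ._+_ ih₂ (ballot-C d (suc j)) ⟩
    n C j ℕ.+ n C suc j                          ≡⟨ nCk+nC[k+1]≡[n+1]C[k+1] n j ⟩
    suc n C suc j                                ∎
    where
    n = d ℕ.+ (suc j ℕ.+ suc j)
    b₁ = ballot d (suc j)
    b₂ = ballot (suc (suc d)) j
    ih₂ : b₂ ℕ.+ n C₋₁ j ≡ n C j
    ih₂ = subst (λ m → b₂ ℕ.+ m C₋₁ j ≡ m C j)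
      (solve 2 (λ d j → con 2 :+ d :+ (j :+ j) := d :+ (con 1 :+ j :+ (con 1 :+ j))) refl d j) (ballot-C (suc (suc d)) j)

  suc-ballot : ∀ j → ballot 0 j ℕ.* suc j ≡ (j ℕ.+ j) C j
  suc-ballot zero    = refl
  suc-ballot (suc i) = ℕₚ.+-cancelʳ-≡ (suc i ℕ.* (n C suc i)) _ _ (begin
    b ℕ.* suc (suc i) ℕ.+ suc i ℕ.* (n C suc i)
      ≡⟨ cong (b ℕ.* suc (suc i) ℕ.+_) absorbed ⟩
    b ℕ.* suc (suc i) ℕ.+ suc (suc i) ℕ.* (n C i)
      ≡⟨ solve 3 (λ b k c → b :* k :+ k :* c := k :* (b :+ c)) refl b (suc (suc i)) (n C i) ⟩
    suc (suc i) ℕ.* (b ℕ.+ n C i)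
      ≡⟨ cong (suc (suc i) ℕ.*_) (ballot-C 0 (suc i)) ⟩
    n C suc i ℕ.+ suc i ℕ.* (n C suc i) ∎)
    where
    n = suc i ℕ.+ suc i
    b = ballot 0 (suc i)
    -- Absorption with n - i = i + 2, as n = 2 (i + 1).
    absorbed : suc i ℕ.* (n C suc i) ≡ suc (suc i) ℕ.* (n C i)
    absorbed = ℕₚ.+-cancelʳ-≡ (i ℕ.* (n C i)) _ _ (trans (absorption n i)
      (solve 2 (λ i c → (con 1 :+ i :+ (con 1 :+ i)) :* c := (con 2 :+ i) :* c :+ i :* c) refl i (n C i)))

  catalan-ballot : ∀ j → catalan j ≡ ballot 0 j
  catalan-ballot j = begin
    ((2 ℕ.* j) C j) ℕ./ suc j       ≡⟨ cong (λ m → ((j ℕ.+ m) C j) ℕ./ suc j) (ℕₚ.+-identityʳ j) ⟩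
    ((j ℕ.+ j) C j) ℕ./ suc j       ≡⟨ cong (ℕ._/ suc j) (suc-ballot j) ⟨
    (ballot 0 j ℕ.* suc j) ℕ./ suc j ≡⟨ DivMod.m*n/n≡m (ballot 0 j) (suc j) ⟩
    ballot 0 j                      ∎

  ≗-trans : {p q r : Poly} → p ≗ q → q ≗ r → p ≗ r
  ≗-trans p q b = trans (p b) (q b)

  ⊞-cong : ∀ {p p′ q q′ : Poly} → p ≗ p′ → q ≗ q′ → p ⊞ q ≗ p′ ⊞ q′
  ⊞-cong e f b = cong₂ ℤ._+_ (e b) (f b)

  negY-cong : ∀ {p q : Poly} → p ≗ q → negY p ≗ negY q
  negY-cong e zero    = refl
  negY-cong e (suc b) = cong ℤ.-_ (e b)

  negY-⊞ : ∀ p q → negY (p ⊞ q) ≗ negY p ⊞ negY q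
  negY-⊞ p q zero    = refl
  negY-⊞ p q (suc b) = ℤₚ.neg-distrib-+ (p b) (q b)

  negY-zero : negY zeroP ≗ zeroP
  negY-zero zero    = refl
  negY-zero (suc b) = refl

  negY^-cong : ∀ k {p q : Poly} → p ≗ q → negY^ k p ≗ negY^ k q
  negY^-cong zero    e = e
  negY^-cong (suc k) e = negY-cong (negY^-cong k e)

  negY^-⊞ : ∀ k p q → negY^ k (p ⊞ q) ≗ negY^ k p ⊞ negY^ k q
  negY^-⊞ zero    p q b = refl
  negY^-⊞ (suc k) p q   = ≗-trans (negY-cong (negY^-⊞ k p q)) (negY-⊞ _ _)

  negY^-zero : ∀ k → negY^ k zeroP ≗ zeroP
  negY^-zero zero    b = refl
  negY^-zero (suc k)   = ≗-trans (negY-cong (negY^-zero k)) negY-zero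

  term : ℕ → ℕ → Poly → Poly
  term k c p = negY^ k (scaleP c p)

  term-cong : ∀ k {c c′ p p′} → c ≡ c′ → p ≗ p′ → term k c p ≗ term k c′ p′
  term-cong k {c} refl e = negY^-cong k (λ b → cong (+ c ℤ.*_) (e b))

  term-zero : ∀ k c {p} → p ≗ zeroP → term k c p ≗ zeroP
  term-zero k c e = ≗-trans (negY^-cong k (λ b → trans (cong (+ c ℤ.*_) (e b)) (ℤₚ.*-zeroʳ (+ c)))) (negY^-zero k)

  term-+ : ∀ k c c′ p → term k (c ℕ.+ c′) p ≗ term k c p ⊞ term k c′ p
  term-+ k c c′ p = ≗-trans
    (negY^-cong k (λ b → trans (cong (ℤ._* p b) (ℤₚ.pos-+ c c′)) (ℤₚ.*-distribʳ-+ (p b) (+ c) (+ c′))))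
    (negY^-⊞ k (scaleP c p) (scaleP c′ p))

  sumP : ℕ → (ℕ → Poly) → Poly
  sumP zero    f = f 0
  sumP (suc n) f = sumP n f ⊞ f (suc n)

  sumP-cong : ∀ n {f g : ℕ → Poly} → (∀ j → f j ≗ g j) → sumP n f ≗ sumP n g
  sumP-cong zero    e = e 0
  sumP-cong (suc n) e = ⊞-cong (sumP-cong n e) (e (suc n))

  sumP-⊞ : ∀ n f g → sumP n (λ j → f j ⊞ g j) ≗ sumP n f ⊞ sumP n g
  sumP-⊞ zero    f g b = refl
  sumP-⊞ (suc n) f g b = begin
    sumP n (λ j → f j ⊞ g j) b ℤ.+ (f (suc n) b ℤ.+ g (suc n) b)
      ≡⟨ cong (ℤ._+ (f (suc n) b ℤ.+ g (suc n) b)) (sumP-⊞ n f g b) ⟩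
    (sumP n f b ℤ.+ sumP n g b) ℤ.+ (f (suc n) b ℤ.+ g (suc n) b)
      ≡⟨ interchange (sumP n f b) (sumP n g b) _ _ ⟩
    (sumP n f b ℤ.+ f (suc n) b) ℤ.+ (sumP n g b ℤ.+ g (suc n) b) ∎
    where
    open import Algebra.Properties.CommutativeSemigroup ℤₚ.+-commutativeSemigroup using (interchange)

  sumP-head : ∀ n f → sumP (suc n) f ≗ f 0 ⊞ sumP n (f ∘ suc)
  sumP-head zero    f b = refl
  sumP-head (suc n) f b = trans (cong (ℤ._+ f (suc (suc n)) b) (sumP-head n f b)) (ℤₚ.+-assoc (f 0 b) _ _)

  negY-sumP : ∀ n f → negY (sumP n f) ≗ sumP n (negY ∘ f)
  negY-sumP zero    f b = refl
  negY-sumP (suc n) f   = ≗-trans (negY-⊞ (sumP n f) (f (suc n))) (⊞-cong (negY-sumP n f) (λ _ → refl))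

  sumP-extend : ∀ {n N} f → n ≤ N → (∀ j → n < j → f j ≗ zeroP) → sumP N f ≗ sumP n f
  sumP-extend {zero} {zero} f z≤n z b = refl
  sumP-extend {n} {suc N} f n≤ z b with ℕₚ.m≤n⇒m<n∨m≡n n≤
  ... | inj₂ refl      = refl
  ... | inj₁ n<1+N = trans (cong₂ ℤ._+_ (sumP-extend f (ℕₚ.≤-pred n<1+N) z b) (z (suc N) n<1+N b)) (ℤₚ.+-identityʳ _)

  -- The recursion of `paths` over integer polynomials, where the recurrence of the statement lives;
  -- `ι-paths` carries it to the coefficient ring.
  pathsP : ℕ → ℕ → Poly
  pathsP zero    zero    = oneP
  pathsP (suc d) zero    = zeroP
  pathsP zero    (suc n) = negY (pathsP 0 n) ⊞ negY (pathsP 1 n)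
  pathsP (suc d) (suc n) = pathsP d n ⊞ negY (pathsP (suc (suc d)) n)

  -- shift f n c = f (n - c), and zeroP for c > n.
  shift : (ℕ → Poly) → ℕ → ℕ → Poly
  shift f n       zero    = f n
  shift f zero    (suc c) = zeroP
  shift f (suc n) (suc c) = shift f n c

  shift-zero : ∀ f {n c} → n < c → shift f n c ≗ zeroP
  shift-zero f {zero}  (s≤s _) b = refl
  shift-zero f {suc n} (s≤s p)   = shift-zero f p

  shift-cong : ∀ {f g} n c → (∀ k → k ≤ n → f k ≗ g k) → shift f n c ≗ shift g n c
  shift-cong n       zero    e   = e n ℕₚ.≤-refl
  shift-cong zero    (suc c) e b = refl
  shift-cong (suc n) (suc c) e   = shift-cong n c (λ k k≤n → e k (ℕₚ.m≤n⇒m≤1+n k≤n))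

  -- Cut at the first visit to height 0.
  firstVisit : ℕ → ℕ → ℕ → Poly
  firstVisit d n j = term j (ballot d j) (shift (pathsP 0) n (suc d ℕ.+ (j ℕ.+ j)))

  shift-step : ∀ n d j → shift (pathsP 0) n (suc d ℕ.+ (suc j ℕ.+ suc j)) ≗ shift (pathsP 0) n (suc (suc (suc d)) ℕ.+ (j ℕ.+ j))
  shift-step n d j b = cong (λ c → shift (pathsP 0) n c b)
    (solve 2 (λ d j → con 1 :+ d :+ (con 1 :+ j :+ (con 1 :+ j)) := con 3 :+ d :+ (j :+ j)) refl d j)

  -- The first step goes down or up, and the recursion of `ballot` divides the terms in the same
  -- way. The summation bound is generous: `shift` annihilates the terms whose first visit would
  -- come after step n.
  paths-firstVisit : ∀ d n → pathsP (suc d) n ≗ sumP n (firstVisit d n)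
  paths-firstVisit d       zero    b = sym (term-zero 0 1 {shift (pathsP 0) 0 (suc d ℕ.+ 0)} (λ _ → refl) b)
  paths-firstVisit zero    (suc n) b = sym (begin
    sumP (suc n) (firstVisit 0 (suc n)) b
      ≡⟨ sumP-head n (firstVisit 0 (suc n)) b ⟩
    firstVisit 0 (suc n) 0 b ℤ.+ sumP n (firstVisit 0 (suc n) ∘ suc) b
      ≡⟨ cong₂ ℤ._+_ (ℤₚ.*-identityˡ (pathsP 0 n b))
           (sumP-cong n (λ j → negY-cong (term-cong j {ballot 1 j} refl
             (λ b → cong (λ c → shift (pathsP 0) n (suc c) b) (ℕₚ.+-suc j j)))) b) ⟩
    pathsP 0 n b ℤ.+ sumP n (negY ∘ firstVisit 1 n) b
      ≡⟨ cong (ℤ._+_ (pathsP 0 n b)) (negY-sumP n (firstVisit 1 n) b) ⟨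
    pathsP 0 n b ℤ.+ negY (sumP n (firstVisit 1 n)) b
      ≡⟨ cong (ℤ._+_ (pathsP 0 n b)) (negY-cong (paths-firstVisit 1 n) b) ⟨
    pathsP 0 n b ℤ.+ negY (pathsP 2 n) b ∎)
  paths-firstVisit (suc d) (suc n) b = sym (begin
    sumP (suc n) (firstVisit (suc d) (suc n)) b
      ≡⟨ sumP-cong (suc n) decompose b ⟩
    sumP (suc n) (λ j → firstVisit d n j ⊞ rest j) b
      ≡⟨ sumP-⊞ (suc n) (firstVisit d n) rest b ⟩
    sumP (suc n) (firstVisit d n) b ℤ.+ sumP (suc n) rest b
      ≡⟨ cong₂ ℤ._+_ (sumP-extend (firstVisit d n) (ℕₚ.n≤1+n n) beyond b) (sumP-head n rest b) ⟩
    sumP n (firstVisit d n) b ℤ.+ (+ 0 ℤ.+ sumP n (negY ∘ firstVisit (suc (suc d)) n) b)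
      ≡⟨ cong (λ z → sumP n (firstVisit d n) b ℤ.+ z) (trans (ℤₚ.+-identityˡ _) (sym (negY-sumP n (firstVisit (suc (suc d)) n) b))) ⟩
    sumP n (firstVisit d n) b ℤ.+ negY (sumP n (firstVisit (suc (suc d)) n)) b
      ≡⟨ cong₂ ℤ._+_ (paths-firstVisit d n b) (negY-cong (paths-firstVisit (suc (suc d)) n) b) ⟨
    pathsP (suc d) n b ℤ.+ negY (pathsP (suc (suc (suc d))) n) b ∎)
    where
    -- An initial up-step is one of the counted up-steps, so index j + 1 leaves j of them for the
    -- remaining path, and index 0 gets nothing.
    rest : ℕ → Poly
    rest zero    = zeroP
    rest (suc j) = negY (firstVisit (suc (suc d)) n j)

    decompose : ∀ j → firstVisit (suc d) (suc n) j ≗ firstVisit d n j ⊞ rest j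
    decompose zero    b = sym (ℤₚ.+-identityʳ _)
    decompose (suc j)   = ≗-trans (term-+ (suc j) (ballot d (suc j)) (ballot (suc (suc d)) j) _)
      (⊞-cong {firstVisit d n (suc j)} (λ _ → refl) (term-cong (suc j) {ballot (suc (suc d)) j} refl (shift-step n d j)))

    beyond : ∀ j → n < j → firstVisit d n j ≗ zeroP
    beyond j n<j = term-zero j (ballot d j) (shift-zero (pathsP 0)
      (ℕₚ.<-≤-trans n<j (ℕₚ.≤-trans (ℕₚ.m≤m+n j j) (ℕₚ.m≤n+m (j ℕ.+ j) (suc d)))))

  at-Us : ∀ n j → at (Us n) j ≡ shift U n j
  at-Us n             zero    = refl
  at-Us zero          (suc j) = refl
  at-Us (suc zero)    (suc j) = at-Us zero j
  at-Us (suc (suc n)) (suc j) = at-Us (suc n) j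

  -- Because C_0 = 1, the separate summand -y U_(n-2) of the recurrence is the term k = 1 missing
  -- from its sum.
  ΣP-sumP : ∀ h f → f 1 ⊞ ΣP 2 (suc h) f ≗ sumP h (f ∘ suc)
  ΣP-sumP zero    f b = ℤₚ.+-identityʳ _
  ΣP-sumP (suc h) f b = trans (sym (ℤₚ.+-assoc (f 1 b) _ _)) (cong (ℤ._+ f (suc (suc h)) b) (ΣP-sumP h f b))

  ⌊n/2⌋<j⇒n<j+j : ∀ n {j} → ⌊ n /2⌋ < j → n < j ℕ.+ j
  ⌊n/2⌋<j⇒n<j+j zero          {suc j} _       = s≤s z≤n
  ⌊n/2⌋<j⇒n<j+j (suc zero)    {suc j} _       = subst (1 <_) (sym (cong suc (ℕₚ.+-suc j j))) (s≤s (s≤s z≤n))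
  ⌊n/2⌋<j⇒n<j+j (suc (suc n)) {suc j} (s≤s p) = subst (suc (suc n) <_) (sym (cong suc (ℕₚ.+-suc j j))) (s≤s (s≤s (⌊n/2⌋<j⇒n<j+j n p)))

  U-rec : ∀ m → U (suc (suc m)) ≗ negY (U (suc m)) ⊞ sumP ⌊ m /2⌋ (λ j → term (suc j) (catalan j) (shift U m (j ℕ.+ j)))
  U-rec m b = begin
    negY (U (suc m)) b ℤ.+ negY (at L 1) b ℤ.+ ΣP 2 (suc ⌊ m /2⌋) f b
      ≡⟨ ℤₚ.+-assoc (negY (U (suc m)) b) _ _ ⟩
    negY (U (suc m)) b ℤ.+ (negY (at L 1) b ℤ.+ ΣP 2 (suc ⌊ m /2⌋) f b)
      ≡⟨ cong (λ z → negY (U (suc m)) b ℤ.+ (z ℤ.+ ΣP 2 (suc ⌊ m /2⌋) f b)) (negY-cong (λ b → sym (ℤₚ.*-identityˡ (at L 1 b))) b) ⟩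
    negY (U (suc m)) b ℤ.+ (f 1 b ℤ.+ ΣP 2 (suc ⌊ m /2⌋) f b)
      ≡⟨ cong (ℤ._+_ (negY (U (suc m)) b)) (ΣP-sumP ⌊ m /2⌋ f b) ⟩
    negY (U (suc m)) b ℤ.+ sumP ⌊ m /2⌋ (f ∘ suc) b
      ≡⟨ cong (ℤ._+_ (negY (U (suc m)) b)) (sumP-cong ⌊ m /2⌋ (λ j → term-cong (suc j) {catalan j} refl (λ b → cong (λ p → p b)
           (trans (at-Us (suc m) _) (cong (shift U (suc m)) (trans (ℕₚ.+-suc j (j ℕ.+ 0)) (cong (λ z → suc (j ℕ.+ z)) (ℕₚ.+-identityʳ j))))))) b) ⟩
    negY (U (suc m)) b ℤ.+ sumP ⌊ m /2⌋ (λ j → term (suc j) (catalan j) (shift U m (j ℕ.+ j))) b ∎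
    where
    L = Us (suc m)
    f : ℕ → Poly
    f k = negY^ k (scaleP (catalan (k ℕ.∸ 1)) (at L (2 ℕ.* k ℕ.∸ 1)))

  -- A path at height 0 starts with a level step, or with an up-step followed by a first return with
  -- j further up-steps. By `catalan-ballot` the latter contributes the factor C_j, with k = j + 1
  -- in the recurrence. The bound `n` makes the induction a strong one.
  U-paths≤ : ∀ n k → k ≤ n → U k ≗ pathsP 0 k
  U-paths≤ n       zero          _ b = refl
  U-paths≤ (suc n) (suc zero)    _ b = sym (trans (cong (ℤ._+_ (negY oneP b)) (negY-zero b)) (ℤₚ.+-identityʳ _))
  U-paths≤ (suc n) (suc (suc m)) (s≤s m<n) b = begin
    U (suc (suc m)) b
      ≡⟨ U-rec m b ⟩
    negY (U (suc m)) b ℤ.+ sumP ⌊ m /2⌋ (λ j → term (suc j) (catalan j) (shift U m (j ℕ.+ j))) b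
      ≡⟨ cong₂ ℤ._+_ (negY-cong (U-paths≤ n (suc m) m<n) b)
           (sumP-cong ⌊ m /2⌋ (λ j → term-cong (suc j) (catalan-ballot j)
              (shift-cong m (j ℕ.+ j) (λ k k≤m → U-paths≤ n k (ℕₚ.≤-trans k≤m (ℕₚ.<⇒≤ m<n))))) b) ⟩
    negY (pathsP 0 (suc m)) b ℤ.+ sumP ⌊ m /2⌋ (negY ∘ firstVisit 0 (suc m)) b
      ≡⟨ cong (ℤ._+_ (negY (pathsP 0 (suc m)) b)) (negY-sumP ⌊ m /2⌋ (firstVisit 0 (suc m)) b) ⟨
    negY (pathsP 0 (suc m)) b ℤ.+ negY (sumP ⌊ m /2⌋ (firstVisit 0 (suc m))) b
      ≡⟨ cong (ℤ._+_ (negY (pathsP 0 (suc m)) b)) (negY-cong (sumP-extend (firstVisit 0 (suc m))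
           (ℕₚ.≤-trans (ℕₚ.⌊n/2⌋≤n m) (ℕₚ.n≤1+n m)) beyond) b) ⟨
    negY (pathsP 0 (suc m)) b ℤ.+ negY (sumP (suc m) (firstVisit 0 (suc m))) b
      ≡⟨ cong (ℤ._+_ (negY (pathsP 0 (suc m)) b)) (negY-cong (paths-firstVisit 0 (suc m)) b) ⟨
    negY (pathsP 0 (suc m)) b ℤ.+ negY (pathsP 1 (suc m)) b ∎
    where
    beyond : ∀ j → ⌊ m /2⌋ < j → firstVisit 0 (suc m) j ≗ zeroP
    beyond j p = term-zero j (ballot 0 j) (shift-zero (pathsP 0) (⌊n/2⌋<j⇒n<j+j m p))

  U-paths : ∀ n → U n ≗ pathsP 0 n
  U-paths n = U-paths≤ n n ℕₚ.≤-refl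

-- Rational coefficients

module Evaluation (R : Ring₀) where
  open CommutativeRing R
  open PowerSeries R
  open NaturalMultiples R
  private
    module FP = FiniteSums commutativeRing
    module NP = NaturalMultiples commutativeRing
    module LP = ListSums commutativeRing
    module F = FiniteSums R
    module L = ListSums R

  ∑-eval : ∀ n f k → FP.∑ n f k ≡ F.∑ n (λ i → f i k)
  ∑-eval zero    f k = ≡.refl
  ∑-eval (suc n) f k = ≡.cong (_+ f (suc n) k) (∑-eval n f k)

  sumL-eval : ∀ {A : Set} (xs : List A) f k → LP.sumL xs f k ≡ L.sumL xs (λ x → f x k)
  sumL-eval []       f k = ≡.refl
  sumL-eval (x ∷ xs) f k = ≡.cong (_+_ (f x k)) (sumL-eval xs f k)

  constant-· : ∀ {F} G → (∀ n → F (suc n) ≈ 0#) → F · G ≋ (λ n → F 0 * G n)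
  constant-· G z zero    = refl
  constant-· {F} G z (suc n) = trans (+-congˡ (trans (·-cong {F ∘ suc} {λ _ → 0#} z (λ _ → refl) n) (·-zeroˡ G n))) (+-identityʳ _)

  nat-· : ∀ k G → NP.nat k · G ≋ (λ n → nat k * G n)
  nat-· zero    G n = trans (·-zeroˡ G n) (sym (zeroˡ _))
  nat-· (suc k) G n = begin
    ((λ i → one i + NP.nat k i) · G) n  ≈⟨ ·-distribʳ G one (NP.nat k) n ⟩
    (one · G) n + (NP.nat k · G) n      ≈⟨ +-cong (·-identityˡ G n) (nat-· k G n) ⟩
    G n + nat k * G n                   ≈⟨ +-congʳ (*-identityˡ _) ⟨
    1# * G n + nat k * G n              ≈⟨ distribʳ _ _ _ ⟨
    (1# + nat k) * G n                  ∎
    where open SetoidReasoning setoid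

open import Algebra.Structures using (IsCommutativeRing)
import Algebra.Properties.Group as GroupProperties
import Algebra.Properties.Ring as RingProperties
open import Data.Integer as ℤ using (ℤ; +_)
import Data.Integer.Properties as ℤₚ
open import Data.Nat using (_!)
open import Data.Nat.Properties using (_!≢0)
open import Data.Rational as ℚ using (ℚ; 0ℚ; 1ℚ; toℚᵘ)
import Data.Rational.Properties as ℚₚ
import Data.Rational.Unnormalised as ℚᵘ
import Data.Rational.Unnormalised.Properties as ℚᵘₚ

toℚᵘ-/ : ∀ z m .{{_ : ℕ.NonZero m}} → toℚᵘ (z ℚ./ m) ℚᵘ.≃ (z ℚᵘ./ m)
toℚᵘ-/ z (suc m) = ℚₚ.toℚᵘ-fromℚᵘ (ℚᵘ.mkℚᵘ z m)

-- Fractions are stored in lowest terms; on unnormalised ones the identity is a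
-- cross-multiplication.
/1-+ : ∀ p q → (p ℤ.+ q) ℚ./ 1 ≡ (p ℚ./ 1) ℚ.+ (q ℚ./ 1)
/1-+ p q = ℚₚ.toℚᵘ-injective (begin
  toℚᵘ ((p ℤ.+ q) ℚ./ 1)                   ≈⟨ toℚᵘ-/ (p ℤ.+ q) 1 ⟩
  (p ℤ.+ q) ℚᵘ./ 1                         ≈⟨ ℚᵘ.*≡* (≡.cong (ℤ._* + 1) (≡.cong₂ ℤ._+_ (≡.sym (ℤₚ.*-identityʳ p)) (≡.sym (ℤₚ.*-identityʳ q)))) ⟩
  (p ℚᵘ./ 1) ℚᵘ.+ (q ℚᵘ./ 1)               ≈⟨ ℚᵘₚ.+-cong (toℚᵘ-/ p 1) (toℚᵘ-/ q 1) ⟨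
  toℚᵘ (p ℚ./ 1) ℚᵘ.+ toℚᵘ (q ℚ./ 1)       ≈⟨ ℚₚ.toℚᵘ-homo-+ (p ℚ./ 1) (q ℚ./ 1) ⟨
  toℚᵘ ((p ℚ./ 1) ℚ.+ (q ℚ./ 1))           ∎)
  where open SetoidReasoning ℚᵘₚ.≃-setoid

/1-* : ∀ p z m .{{_ : ℕ.NonZero m}} → (p ℚ./ 1) ℚ.* (z ℚ./ m) ≡ (p ℤ.* z) ℚ./ m
/1-* p z m@(suc _) = ℚₚ.toℚᵘ-injective (begin
  toℚᵘ ((p ℚ./ 1) ℚ.* (z ℚ./ m))           ≈⟨ ℚₚ.toℚᵘ-homo-* (p ℚ./ 1) (z ℚ./ m) ⟩
  toℚᵘ (p ℚ./ 1) ℚᵘ.* toℚᵘ (z ℚ./ m)       ≈⟨ ℚᵘₚ.*-cong (toℚᵘ-/ p 1) (toℚᵘ-/ z m) ⟩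
  (p ℚᵘ./ 1) ℚᵘ.* (z ℚᵘ./ m)               ≈⟨ ℚᵘ.*≡* (≡.cong (λ k → (p ℤ.* z) ℤ.* + k) (≡.sym (ℕₚ.*-identityˡ m))) ⟩
  (p ℤ.* z) ℚᵘ./ m                         ≈⟨ toℚᵘ-/ (p ℤ.* z) m ⟨
  toℚᵘ ((p ℤ.* z) ℚ./ m)                   ∎)
  where open SetoidReasoning ℚᵘₚ.≃-setoid

*-/-cancel : ∀ z m k .{{_ : ℕ.NonZero m}} .{{_ : ℕ.NonZero k}} .{{_ : ℕ.NonZero (k ℕ.* m)}} →
  (+ k ℤ.* z) ℚ./ (k ℕ.* m) ≡ z ℚ./ m
*-/-cancel z m@(suc _) k@(suc _) = ℚₚ.toℚᵘ-injective (begin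
  toℚᵘ ((+ k ℤ.* z) ℚ./ (k ℕ.* m)) ≈⟨ toℚᵘ-/ (+ k ℤ.* z) (k ℕ.* m) ⟩
  (+ k ℤ.* z) ℚᵘ./ (k ℕ.* m)       ≈⟨ ℚᵘ.*≡* cross ⟩
  z ℚᵘ./ m                         ≈⟨ toℚᵘ-/ z m ⟨
  toℚᵘ (z ℚ./ m)                   ∎)
  where
  open SetoidReasoning ℚᵘₚ.≃-setoid
  cross : (+ k ℤ.* z) ℤ.* + m ≡ z ℤ.* + (k ℕ.* m)
  cross = ≡.trans (≡.cong (ℤ._* + m) (ℤₚ.*-comm (+ k) z)) (≡.trans (ℤₚ.*-assoc z (+ k) (+ m)) (≡.cong (z ℤ.*_) (≡.sym (ℤₚ.pos-* k m))))

-- Opaque, so that equality checking never normalises fractions.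
infixl 6 _+ℚ_
infixl 7 _*ℚ_
opaque
  _+ℚ_ _*ℚ_ : ℚ → ℚ → ℚ
  _+ℚ_ = ℚ._+_
  _*ℚ_ = ℚ._*_

  -ℚ_ : ℚ → ℚ
  -ℚ_ = ℚ.-_

  +ℚ-≡ : ∀ p q → p +ℚ q ≡ p ℚ.+ q
  +ℚ-≡ p q = ≡.refl

  *ℚ-≡ : ∀ p q → p *ℚ q ≡ p ℚ.* q
  *ℚ-≡ p q = ≡.refl

  -ℚ-≡ : ∀ p → -ℚ p ≡ ℚ.- p
  -ℚ-≡ p = ≡.refl

  ℚ-isCommutativeRing : IsCommutativeRing _≡_ _+ℚ_ _*ℚ_ -ℚ_ 0ℚ 1ℚ
  ℚ-isCommutativeRing = ℚₚ.+-*-isCommutativeRing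

ℚ-ring : Ring₀
ℚ-ring = record { isCommutativeRing = ℚ-isCommutativeRing }

open NaturalMultiples ℚ-ring using () renaming (nat to natℚ)

/1-+ℚ : ∀ p q → (p ℤ.+ q) ℚ./ 1 ≡ (p ℚ./ 1) +ℚ (q ℚ./ 1)
/1-+ℚ p q = ≡.trans (/1-+ p q) (≡.sym (+ℚ-≡ _ _))

/1-*ℚ : ∀ p z m .{{_ : ℕ.NonZero m}} → (p ℚ./ 1) *ℚ (z ℚ./ m) ≡ (p ℤ.* z) ℚ./ m
/1-*ℚ p z m = ≡.trans (*ℚ-≡ _ _) (/1-* p z m)

natℚ-/1 : ∀ k → natℚ k ≡ + k ℚ./ 1
natℚ-/1 zero    = ≡.refl
natℚ-/1 (suc k) = ≡.trans (≡.cong (1ℚ +ℚ_) (natℚ-/1 k)) (≡.sym (/1-+ℚ (+ 1) (+ k)))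

factorialℚ : ℕ → ℚ
factorialℚ = EgfProducts.factorial ℚ-ring

factorialℚ-/1 : ∀ n → factorialℚ n ≡ + (n !) ℚ./ 1
factorialℚ-/1 zero    = ≡.refl
factorialℚ-/1 (suc n) = begin
  factorialℚ n *ℚ natℚ (suc n)           ≡⟨ ≡.cong₂ _*ℚ_ (factorialℚ-/1 n) (natℚ-/1 (suc n)) ⟩
  (+ (n !) ℚ./ 1) *ℚ (+ suc n ℚ./ 1)     ≡⟨ /1-*ℚ (+ (n !)) (+ suc n) 1 ⟩
  (+ (n !) ℤ.* + suc n) ℚ./ 1            ≡⟨ ≡.cong (ℚ._/ 1) (≡.trans (≡.sym (ℤₚ.pos-* (n !) (suc n))) (≡.cong +_ (ℕₚ.*-comm (n !) (suc n)))) ⟩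
  + (suc n !) ℚ./ 1                      ∎
  where open ≡.≡-Reasoning

factorialℚ-* : ∀ n z → factorialℚ n *ℚ (z ℚ./ (n !)) {{n !≢0}} ≡ z ℚ./ 1
factorialℚ-* n z = begin
  factorialℚ n *ℚ (z ℚ./ (n !))          ≡⟨ ≡.cong (_*ℚ (z ℚ./ (n !))) (factorialℚ-/1 n) ⟩
  (+ (n !) ℚ./ 1) *ℚ (z ℚ./ (n !))       ≡⟨ /1-*ℚ (+ (n !)) z (n !) ⟩
  (+ (n !) ℤ.* z) ℚ./ (n !)              ≡⟨ ℚₚ./-cong {+ (n !) ℤ.* z} ≡.refl (≡.sym (ℕₚ.*-identityʳ (n !))) ⟩
  (+ (n !) ℤ.* z) ℚ./ (n ! ℕ.* 1)        ≡⟨ *-/-cancel z 1 (n !) ⟩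
  z ℚ./ 1                                ∎
  where
  open ≡.≡-Reasoning
  instance
    _ = n !≢0
    _ = ℕₚ.m*n≢0 (n !) 1

factorialℚ-inverse : ∀ n → factorialℚ n *ℚ (+ 1 ℚ./ (n !)) {{n !≢0}} ≡ 1ℚ
factorialℚ-inverse n = factorialℚ-* n (+ 1)

factorialℚ-cancel : ∀ n {p q} → factorialℚ n *ℚ p ≡ factorialℚ n *ℚ q → p ≡ q
factorialℚ-cancel n {p} {q} e = begin
  p                          ≡⟨ undo p ⟨
  r *ℚ (factorialℚ n *ℚ p)   ≡⟨ ≡.cong (r *ℚ_) e ⟩
  r *ℚ (factorialℚ n *ℚ q)   ≡⟨ undo q ⟩
  q                          ∎
  where
  open ≡.≡-Reasoning
  open CommutativeRing ℚ-ring using (*-assoc; *-comm; *-identityˡ)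
  r = (+ 1 ℚ./ (n !)) {{n !≢0}}
  undo : ∀ p → r *ℚ (factorialℚ n *ℚ p) ≡ p
  undo p = ≡.trans (≡.sym (*-assoc r (factorialℚ n) p)) (≡.trans
    (≡.cong (_*ℚ p) (≡.trans (*-comm r (factorialℚ n)) (factorialℚ-inverse n))) (*-identityˡ p))

-- The series of the statement

open ≡ using (refl; sym; trans; cong; cong₂; module ≡-Reasoning)
open LatticePaths using (pathsP; U-paths)

-- `Series` is by definition the carrier of power series in t over series in x over series in y, so
-- the series of the statement need no translation into this tower.
y-ring : Ring₀
y-ring = PowerSeries.commutativeRing ℚ-ring

xy-ring : Ring₀
xy-ring = PowerSeries.commutativeRing y-ring

private
  module P₀ = PowerSeries ℚ-ring
  module P₁ = PowerSeries y-ring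
  module E₀ = Evaluation ℚ-ring
  module E₁ = Evaluation y-ring
  module R₀ = CommutativeRing ℚ-ring
  module K = CommutativeRing xy-ring
  module F₀ = FiniteSums ℚ-ring
  module L₀ = ListSums ℚ-ring
  module L = ListSums xy-ring
  module N = NaturalMultiples xy-ring
open PowerSeries xy-ring
open Exponential xy-ring
open EgfProducts xy-ring
open NaturalMultiples commutativeRing using () renaming (nat to natₛ)

Σ≤-∑ : ∀ n f → Σ≤ n f ≡ F₀.∑ n f
Σ≤-∑ zero    f = refl
Σ≤-∑ (suc n) f = trans (cong (ℚ._+ f (suc n)) (Σ≤-∑ n f)) (sym (+ℚ-≡ _ _))

∑-evalₓᵧ : ∀ n f a b → FiniteSums.∑ xy-ring n f a b ≡ Σ≤ n (λ i → f i a b)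
∑-evalₓᵧ n f a b = begin
  FiniteSums.∑ xy-ring n f a b          ≡⟨ cong (λ g → g b) (E₁.∑-eval n f a) ⟩
  FiniteSums.∑ y-ring n (λ i → f i a) b ≡⟨ E₀.∑-eval n (λ i → f i a) b ⟩
  F₀.∑ n (λ i → f i a b)                ≡⟨ Σ≤-∑ n _ ⟨
  Σ≤ n (λ i → f i a b)                  ∎
  where open ≡-Reasoning

Σ≤-cong : ∀ n {f g} → (∀ i → f i ≡ g i) → Σ≤ n f ≡ Σ≤ n g
Σ≤-cong zero    e = e 0
Σ≤-cong (suc n) e = cong₂ ℚ._+_ (Σ≤-cong n e) (e (suc n))

⊛≋· : ∀ F G → F ⊛ G ≋ F · G
⊛≋· F G n a b = sym (begin
  (F · G) n a b
    ≡⟨ ·-∑ F G n a b ⟩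
  FiniteSums.∑ xy-ring n (λ i → F i P₁.· G (n ∸ i)) a b
    ≡⟨ ∑-evalₓᵧ n _ a b ⟩
  Σ≤ n (λ i → (F i P₁.· G (n ∸ i)) a b)
    ≡⟨ Σ≤-cong n (λ i → trans (P₁.·-∑ (F i) (G (n ∸ i)) a b) (trans (E₀.∑-eval a _ b) (trans (sym (Σ≤-∑ a _))
         (Σ≤-cong a (λ j → trans (P₀.·-∑ (F i j) (G (n ∸ i) (a ∸ j)) b) (trans (sym (Σ≤-∑ b _)) (Σ≤-cong b (λ k → *ℚ-≡ _ _)))))))) ⟩
  (F ⊛ G) n a b ∎)
  where open ≡-Reasoning

oneS≋one : oneS ≋ one
oneS≋one zero    zero    zero    = refl
oneS≋one zero    zero    (suc b) = refl
oneS≋one zero    (suc a) b       = refl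
oneS≋one (suc n) a       b       = refl

^S≋^ : ∀ {F G} → F ≋ G → ∀ k → F ^S k ≋ G ^ k
^S≋^ e zero    = oneS≋one
^S≋^ {F} {G} e (suc k) = S.trans {F ⊛ (F ^S k)} (⊛≋· F (F ^S k)) (·-cong e (^S≋^ e k))

⊖-≡ : ∀ F G → F ⊖ G ≋ F S.+ (S.- G)
⊖-≡ F G n a b = sym (trans (+ℚ-≡ _ _) (cong (F n a b ℚ.+_) (-ℚ-≡ (G n a b))))

inv≋geometric : ∀ F (F₀ : F 0 K.≈ K.1#) → inv F ≋ geometric {F} F₀
inv≋geometric F F₀ n a b = trans (Σ≤-cong n (λ k → ^S≋^ diff k n a b)) (sym (∑-evalₓᵧ n (λ k → (H ^ k) n) a b))
  where
  H : Series
  H = one S.+ (S.- F)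
  diff : oneS ⊖ F ≋ H
  diff n a b = trans (⊖-≡ oneS F n a b) (cong (_+ℚ (-ℚ F n a b)) (oneS≋one n a b))

-- Free of t. The binomial coefficients in x have this property, hence `D` annihilates them.
constant : Series → Set
constant F = ∀ n → F (suc n) K.≈ K.0#

constant-const : ∀ c → constant (const c)
constant-const c n a b = refl

constant-X : constant X
constant-X n a b = refl

constant-⊛ : ∀ F G → constant F → constant G → constant (F ⊛ G)
constant-⊛ F G cF cG n = K.trans (⊛≋· F G (suc n))
  (K.trans (Evaluation.constant-· xy-ring {F} G cF (suc n)) (K.trans (K.*-congˡ {F 0} (cG n)) (K.zeroʳ (F 0))))

constant-⊖ : ∀ F G → constant F → constant G → constant (F ⊖ G)
constant-⊖ F G cF cG n a b = cong₂ ℚ._-_ (cF n a b) (cG n a b)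

constant-falling : ∀ k → constant (fallingX k)
constant-falling zero    = constant-const 1ℚ
constant-falling (suc k) = constant-⊛ (fallingX k) (X ⊖ const (+ k ℚ./ 1)) (constant-falling k)
  (constant-⊖ X (const (+ k ℚ./ 1)) constant-X (constant-const (+ k ℚ./ 1)))

constant-binom : ∀ k → constant (binomX k)
constant-binom k = constant-⊛ (const ((+ 1 ℚ./ (k !)) {{k !≢0}})) (fallingX k) (constant-const ((+ 1 ℚ./ (k !)) {{k !≢0}})) (constant-falling k)

const-+ : ∀ p q → const p S.+ const q ≋ const (p +ℚ q)
const-+ p q zero    zero    zero    = refl
const-+ p q zero    zero    (suc b) = R₀.+-identityˡ 0ℚ
const-+ p q zero    (suc a) b       = R₀.+-identityˡ 0ℚ
const-+ p q (suc n) a       b       = R₀.+-identityˡ 0ℚ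

const-0 : const 0ℚ ≋ S.0#
const-0 zero    zero    zero    = refl
const-0 zero    zero    (suc b) = refl
const-0 zero    (suc a) b       = refl
const-0 (suc n) a       b       = refl

natₛ≋const : ∀ k → natₛ k ≋ const (natℚ k)
natₛ≋const zero    n a b = sym (const-0 n a b)
natₛ≋const (suc k) n a b =
  trans (cong₂ _+ℚ_ (sym (oneS≋one n a b)) (natₛ≋const k n a b)) (const-+ 1ℚ (natℚ k) n a b)

natₛ-· : ∀ k F n a b → (natₛ k · F) n a b ≡ natℚ k *ℚ F n a b
natₛ-· k F n a b = trans (Evaluation.nat-· xy-ring k F n a b) (trans (E₁.nat-· k (F n) a b) (E₀.nat-· k (F n a) b))

egf-eval : ∀ F n a b → egf F n a b ≡ factorialℚ n *ℚ F n a b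
egf-eval F n a b = go n (F n)
  where
  go : ∀ n (G : K.Carrier) → (factorial n K.* G) a b ≡ factorialℚ n *ℚ G a b
  go zero    G = trans (K.*-identityˡ G a b) (sym (R₀.*-identityˡ (G a b)))
  go (suc n) G = begin
    ((factorial n K.* N.nat (suc n)) K.* G) a b  ≡⟨ K.*-assoc (factorial n) (N.nat (suc n)) G a b ⟩
    (factorial n K.* (N.nat (suc n) K.* G)) a b  ≡⟨ go n (N.nat (suc n) K.* G) ⟩
    factorialℚ n *ℚ (N.nat (suc n) P₁.· G) a b  ≡⟨ cong (factorialℚ n *ℚ_) (trans (E₁.nat-· (suc n) G a b) (E₀.nat-· (suc n) (G a) b)) ⟩
    factorialℚ n *ℚ (NaturalMultiples.nat ℚ-ring (suc n) *ℚ G a b) ≡⟨ R₀.*-assoc (factorialℚ n) _ (G a b) ⟨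
    factorialℚ (suc n) *ℚ G a b                 ∎
    where open ≡-Reasoning

coefficient : ℕ → Series
coefficient k = const ((+ 1 ℚ./ (k !)) {{k !≢0}})

coefficient-suc : ∀ k → natₛ (suc k) · coefficient (suc k) ≋ coefficient k
coefficient-suc k n a b = trans (natₛ-· (suc k) (coefficient (suc k)) n a b) (pointwise n a b)
  where
  pointwise : ∀ n a b → natℚ (suc k) *ℚ coefficient (suc k) n a b ≡ coefficient k n a b
  pointwise zero zero zero = factorialℚ-cancel k (trans (sym (R₀.*-assoc (factorialℚ k) (natℚ (suc k)) _))
    (trans (factorialℚ-inverse (suc k)) (sym (factorialℚ-inverse k))))
  pointwise zero    zero    (suc b) = R₀.zeroʳ (natℚ (suc k))
  pointwise zero    (suc a) b       = R₀.zeroʳ (natℚ (suc k))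
  pointwise (suc n) a       b       = R₀.zeroʳ (natℚ (suc k))

fallingX-suc : ∀ k → fallingX (suc k) ≋ fallingX k · (X S.+ (S.- natₛ k))
fallingX-suc k n = K.trans (⊛≋· (fallingX k) (X ⊖ const (+ k ℚ./ 1)) n) (·-cong (S.refl {fallingX k}) factor n)
  where
  factor : X ⊖ const (+ k ℚ./ 1) ≋ X S.+ (S.- natₛ k)
  factor n a b = trans (⊖-≡ X (const (+ k ℚ./ 1)) n a b)
    (cong (λ q → X n a b +ℚ (-ℚ q)) (sym (trans (natₛ≋const k n a b) (cong (λ q → const q n a b) (natℚ-/1 k)))))

-- From the factor x - k that the next falling factorial gains, and (k + 1)/(k + 1)! = 1/k!; adding
-- k times the binomial coefficient cancels the subtraction.
binomX-rec : ∀ k → natₛ (suc k) · binomX (suc k) S.+ natₛ k · binomX k ≋ X · binomX k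
binomX-rec k = begin
  natₛ (suc k) · binomX (suc k) S.+ natₛ k · binomX k
    ≈⟨ S.+-cong (·-cong (S.refl {natₛ (suc k)}) (S.trans (⊛≋· (coefficient (suc k)) (fallingX (suc k)))
         (·-cong (S.refl {coefficient (suc k)}) (fallingX-suc k))))
       (·-cong (S.refl {natₛ k}) (⊛≋· (coefficient k) (fallingX k))) ⟩
  natₛ (suc k) · (coefficient (suc k) · (fallingX k · (X S.+ (S.- natₛ k)))) S.+ natₛ k · (coefficient k · fallingX k)
    ≈⟨ S.+-congʳ {natₛ k · (coefficient k · fallingX k)} (S.trans (S.sym (·-assoc (natₛ (suc k)) (coefficient (suc k)) _))
         (·-cong (coefficient-suc k) (S.refl {fallingX k · (X S.+ (S.- natₛ k))}))) ⟩
  coefficient k · (fallingX k · (X S.+ (S.- natₛ k))) S.+ natₛ k · (coefficient k · fallingX k)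
    ≈⟨ solve 5 (λ c f x m n → c :* (f :* (x :+ m)) :+ n :* (c :* f) := x :* (c :* f) :+ (m :+ n) :* (c :* f)) S.refl
         (coefficient k) (fallingX k) X (S.- natₛ k) (natₛ k) ⟩
  X · (coefficient k · fallingX k) S.+ ((S.- natₛ k) S.+ natₛ k) · (coefficient k · fallingX k)
    ≈⟨ S.+-congˡ {X · (coefficient k · fallingX k)} (S.trans (·-cong (S.-‿inverseˡ (natₛ k)) (S.refl {coefficient k · fallingX k}))
         (S.zeroˡ (coefficient k · fallingX k))) ⟩
  X · (coefficient k · fallingX k) S.+ S.0#
    ≈⟨ S.+-identityʳ (X · (coefficient k · fallingX k)) ⟩
  X · (coefficient k · fallingX k)
    ≈⟨ ·-cong (S.refl {X}) (⊛≋· (coefficient k) (fallingX k)) ⟨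
  X · binomX k ∎
  where
  open SetoidReasoning S.setoid
  open SSolver using (solve; _:*_; _:+_; _:=_)

binomX-0 : binomX 0 ≋ one
binomX-0 n = K.trans (⊛≋· (const 1ℚ) oneS n) (K.trans (·-cong oneS≋one oneS≋one n) (·-identityˡ one n))

binomX-D : ∀ k → D (binomX k) ≋ S.0#
binomX-D k n = K.trans (K.*-congˡ {NaturalMultiples.nat xy-ring (suc n)} (constant-binom k n)) (K.zeroʳ _)

U₀ : USeries 0 K.≈ K.1#
U₀ = oneS≋one 0

invU : Series
invU = geometric {USeries} U₀

open Binomial X binomX binomX-0 binomX-D binomX-rec {invU} K.refl using (power; power-log-derivative)

powX≋power : powX (inv USeries) ≋ power
powX≋power n a b = trans
  (Σ≤-cong n (λ k → trans (⊛≋· (binomX k) _ n a b) (·-cong (S.refl {binomX k}) (^S≋^ diff k) n a b)))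
  (sym (∑-evalₓᵧ n (λ k → (binomX k · H ^ k) n) a b))
  where
  H : Series
  H = invU S.+ (S.- one)
  diff : inv USeries ⊖ oneS ≋ H
  diff n a b = trans (⊖-≡ (inv USeries) oneS n a b)
    (cong₂ (λ p q → p +ℚ (-ℚ q)) (inv≋geometric USeries U₀ n a b) (oneS≋one n a b))

power₀ : power 0 K.≈ K.1#
power₀ = K.trans (K.*-identityʳ (binomX 0 0)) (binomX-0 0)

-- The variable x as a scalar of the coefficient ring, where the weights of words live.
ξ : K.Carrier
ξ = X 0

ξ-zero : ∀ G b → (ξ K.* G) 0 b ≡ 0ℚ
ξ-zero G b = P₀.·-zeroˡ (G 0) b

ξ-suc : ∀ G a b → (ξ K.* G) (suc a) b ≡ G a b
ξ-suc G a b = begin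
  (ξ 0 P₀.· G (suc a)) b +ℚ ((ξ ∘ suc) P₁.· G) a b ≡⟨ cong₂ _+ℚ_ (P₀.·-zeroˡ (G (suc a)) b) (E₁.constant-· {ξ ∘ suc} G (λ _ _ → refl) a b) ⟩
  0ℚ +ℚ (ξ 1 P₀.· G a) b                           ≡⟨ R₀.+-identityˡ _ ⟩
  (ξ 1 P₀.· G a) b                                 ≡⟨ P₀.·-cong {G = G a} ξ₁ (λ _ → refl) b ⟩
  (P₀.one P₀.· G a) b                              ≡⟨ P₀.·-identityˡ (G a) b ⟩
  G a b                                            ∎
  where
  open ≡-Reasoning
  ξ₁ : ξ 1 P₀.≋ P₀.one
  ξ₁ zero    = refl
  ξ₁ (suc _) = refl

yₖ : K.Carrier
yₖ zero    (suc zero) = 1ℚ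
yₖ _       _          = 0ℚ

yₖ-· : ∀ G a b → (yₖ K.* G) a b ≡ (yₖ 0 P₀.· G a) b
yₖ-· G a b = E₁.constant-· {yₖ} G (λ _ _ → refl) a b

yₖ-zero : ∀ G a → (yₖ K.* G) a 0 ≡ 0ℚ
yₖ-zero G a = trans (yₖ-· G a 0) (R₀.zeroˡ _)

yₖ-suc : ∀ G a b → (yₖ K.* G) a (suc b) ≡ G a b
yₖ-suc G a b = trans (yₖ-· G a (suc b)) (trans (cong₂ _+ℚ_ (R₀.zeroˡ _)
  (trans (E₀.constant-· {yₖ 0 ∘ suc} (G a) (λ _ → refl) b) (R₀.*-identityˡ _))) (R₀.+-identityˡ _))

open Bricks xy-ring yₖ
open ChainCount xy-ring yₖ
open Counting xy-ring yₖ ξ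
open import Algebra.Properties.Semiring.Exp K.semiring using () renaming (_^_ to _^ₖ_)

ι : Poly → K.Carrier
ι p zero    b = p b ℚ./ 1
ι p (suc _) _ = 0ℚ

ι-cong : ∀ {p q} → p ≗ q → ι p K.≈ ι q
ι-cong e zero    b = cong (ℚ._/ 1) (e b)
ι-cong e (suc a) b = refl

ι-⊞ : ∀ p q → ι (p ⊞ q) K.≈ ι p K.+ ι q
ι-⊞ p q zero    b = /1-+ℚ (p b) (q b)
ι-⊞ p q (suc a) b = sym (R₀.+-identityˡ 0ℚ)

neg-/1 : ∀ z → (ℤ.- z) ℚ./ 1 ≡ -ℚ (z ℚ./ 1)
neg-/1 z = GroupProperties.inverseʳ-unique R₀.+-group (z ℚ./ 1) ((ℤ.- z) ℚ./ 1)
  (trans (sym (/1-+ℚ z (ℤ.- z))) (cong (ℚ._/ 1) (ℤₚ.+-inverseʳ z)))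

neg-0ℚ : -ℚ 0ℚ ≡ 0ℚ
neg-0ℚ = GroupProperties.ε⁻¹≈ε R₀.+-group

ι-negY : ∀ p → ι (negY p) K.≈ (K.- yₖ) K.* ι p
ι-negY p a b = trans (pointwise a b) (RingProperties.-‿distribˡ-* K.ring yₖ (ι p) a b)
  where
  pointwise : ∀ a b → ι (negY p) a b ≡ -ℚ (yₖ K.* ι p) a b
  pointwise zero    zero    = sym (trans (cong -ℚ_ (yₖ-zero (ι p) 0)) neg-0ℚ)
  pointwise zero    (suc b) = trans (neg-/1 (p b)) (cong -ℚ_ (sym (yₖ-suc (ι p) 0 b)))
  pointwise (suc a) zero    = sym (trans (cong -ℚ_ (yₖ-zero (ι p) (suc a))) neg-0ℚ)
  pointwise (suc a) (suc b) = sym (trans (cong -ℚ_ (yₖ-suc (ι p) (suc a) b)) neg-0ℚ)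

ι-paths : ∀ d n → ι (pathsP d n) K.≈ paths d n
ι-paths zero    zero    zero    zero    = refl
ι-paths zero    zero    zero    (suc b) = refl
ι-paths zero    zero    (suc a) b       = refl
ι-paths (suc d) zero    zero    b       = refl
ι-paths (suc d) zero    (suc a) b       = refl
ι-paths zero    (suc n) = K.trans (ι-⊞ (negY (pathsP 0 n)) (negY (pathsP 1 n)))
  (K.+-cong (K.trans (ι-negY (pathsP 0 n)) (K.*-congˡ {K.- yₖ} (ι-paths 0 n)))
            (K.trans (ι-negY (pathsP 1 n)) (K.*-congˡ {K.- yₖ} (ι-paths 1 n))))
ι-paths (suc d) (suc n) = K.trans (ι-⊞ (pathsP d n) (negY (pathsP (suc (suc d)) n)))
  (K.+-cong (ι-paths d n) (K.trans (ι-negY (pathsP (suc (suc d)) n)) (K.*-congˡ {K.- yₖ} (ι-paths (suc (suc d)) n))))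

egf-U : ∀ n → egf USeries n K.≈ paths 0 n
egf-U n = K.trans {egf USeries n} {ι (U n)} (λ a b → trans (egf-eval USeries n a b) (pointwise n a b))
  (K.trans (ι-cong (U-paths n)) (ι-paths 0 n))
  where
  pointwise : ∀ n a b → factorialℚ n *ℚ USeries n a b ≡ ι (U n) a b
  pointwise zero    zero    zero    = R₀.*-identityˡ _
  pointwise zero    zero    (suc b) = R₀.*-identityˡ _
  pointwise zero    (suc a) b       = R₀.*-identityˡ _
  pointwise (suc n) zero    b       = factorialℚ-* (suc n) (U (suc n) b)
  pointwise (suc n) (suc a) b       = R₀.zeroʳ _

y-monomial : ∀ j a b → (yₖ ^ₖ j) a b ≡ L₀.⟦ (0 ≡ᵇ a) ∧ (j ≡ᵇ b) ⟧
y-monomial zero    zero    zero    = refl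
y-monomial zero    zero    (suc b) = refl
y-monomial zero    (suc a) b       = refl
y-monomial (suc j) a       zero    = trans (yₖ-zero (yₖ ^ₖ j) a) (cong L₀.⟦_⟧ (sym (Boolₚ.∧-zeroʳ (0 ≡ᵇ a))))
y-monomial (suc j) a       (suc b) = trans (yₖ-suc (yₖ ^ₖ j) a b) (y-monomial j a b)

-- With a single nonzero coefficient per monomial, extracting x^a y^b from a sum of weights counts
-- the words with these statistics.
monomial : ∀ i j a b → (ξ ^ₖ i K.* yₖ ^ₖ j) a b ≡ L₀.⟦ (i ≡ᵇ a) ∧ (j ≡ᵇ b) ⟧
monomial zero    j a       b = trans (K.*-identityˡ (yₖ ^ₖ j) a b) (y-monomial j a b)
monomial (suc i) j zero    b = trans (K.*-assoc ξ (ξ ^ₖ i) (yₖ ^ₖ j) 0 b) (ξ-zero (ξ ^ₖ i K.* yₖ ^ₖ j) b)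
monomial (suc i) j (suc a) b = trans (K.*-assoc ξ (ξ ^ₖ i) (yₖ ^ₖ j) (suc a) b)
  (trans (ξ-suc (ξ ^ₖ i K.* yₖ ^ₖ j) a b) (monomial i j a b))

hasStatsᵇ : ℕ → ℕ → List ℕ → Bool
hasStatsᵇ a b σ = (LRmin σ ≡ᵇ a) ∧ (suc (des σ) ≡ᵇ b)

-- Restricted to nonempty words, since the empty word has weight 1 although 1 + des is 1 for it.
weight-eval : ∀ s w a b →
  weight ξ (s ∷ w) a b ≡ L₀.⟦ not (hasMatchᵇ Γ (s ∷ w)) ⟧ *ℚ L₀.⟦ hasStatsᵇ a b (s ∷ w) ⟧
weight-eval s w a b rewrite hasMatch-matches (s ∷ w) with matchesᵇ (s ∷ w)
... | true  = trans (K.*-congˡ {ξ ^ₖ i} {K.0# K.* yₖ ^ₖ j} {K.0#} (K.zeroˡ (yₖ ^ₖ j)) a b)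
                (trans (K.zeroʳ (ξ ^ₖ i) a b) (sym (R₀.zeroˡ _)))
  where
  i = LRmin (s ∷ w)
  j = suc (des (s ∷ w))
... | false = trans (K.*-congˡ {ξ ^ₖ i} {K.1# K.* yₖ ^ₖ j} {yₖ ^ₖ j} (K.*-identityˡ (yₖ ^ₖ j)) a b)
                (trans (monomial i j a b) (sym (R₀.*-identityˡ _)))
  where
  i = LRmin (s ∷ w)
  j = suc (des (s ∷ w))

count-/1 : ∀ {A : Set} (p : A → Bool) xs → + length (filterᵇ p xs) ℚ./ 1 ≡ L₀.sumL xs (λ x → L₀.⟦ p x ⟧)
count-/1 p []       = refl
count-/1 p (x ∷ xs) with p x
... | true  = trans (/1-+ℚ (+ 1) (+ length (filterᵇ p xs))) (cong (1ℚ +ℚ_) (count-/1 p xs))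
... | false = trans (count-/1 p xs) (sym (R₀.+-identityˡ _))

ascending-upTo : ∀ n → Ascending (applyUpTo suc n)
ascending-upTo n = AllPairsₚ.applyUpTo⁺₁ suc n (λ i<j _ → s≤s i<j) , Allₚ.applyUpTo⁺₁ suc n (λ _ → s≤s z≤n)

count-weight : ∀ n a b →
  + length (filterᵇ (hasStatsᵇ a b) (NM Γ (suc n))) ℚ./ 1 ≡ L.sumL (arr (applyUpTo suc (suc n))) (weight ξ) a b
count-weight n a b = begin
  + length (filterᵇ (hasStatsᵇ a b) (NM Γ (suc n))) ℚ./ 1
    ≡⟨ count-/1 (hasStatsᵇ a b) (NM Γ (suc n)) ⟩
  L₀.sumL (NM Γ (suc n)) (λ σ → L₀.⟦ hasStatsᵇ a b σ ⟧)
    ≡⟨ L₀.sumL-filterᵇ (λ σ → not (hasMatchᵇ Γ σ)) (Perms (suc n)) _ ⟩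
  L₀.sumL (Perms (suc n)) f
    ≡⟨ WordSums.sum-Perms ℚ-ring (suc n) f ⟩
  L₀.sumL (arr S₀) f
    ≡⟨ L₀.sumL-congᴬ (All.map (λ {w} e → eval w (↭-length e)) (arr-↭ S₀)) ⟨
  L₀.sumL (arr S₀) (λ w → weight ξ w a b)
    ≡⟨ trans (cong (λ g → g b) (E₁.sumL-eval (arr S₀) (weight ξ) a)) (E₀.sumL-eval (arr S₀) (λ w → weight ξ w a) b) ⟨
  L.sumL (arr S₀) (weight ξ) a b ∎
  where
  open ≡-Reasoning
  S₀ : List ℕ
  S₀ = applyUpTo suc (suc n)
  f : List ℕ → ℚ
  f σ = L₀.⟦ not (hasMatchᵇ Γ σ) ⟧ *ℚ L₀.⟦ hasStatsᵇ a b σ ⟧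
  eval : ∀ w → length w ≡ length S₀ → weight ξ w a b ≡ f w
  eval (s ∷ w) _ = weight-eval s w a b

sum-weight-power : ∀ n → L.sumL (arr (applyUpTo suc n)) (weight ξ) K.≈ egf power n
sum-weight-power n = K.trans
  (sum-weight {USeries} {invU} {power} {X} egf-U (geometric-inverse {USeries} U₀) power₀
    (power-log-derivative (geometric-inverse {USeries} U₀)) (λ G → Evaluation.constant-· xy-ring {X} G constant-X)
    (applyUpTo suc n) (ascending-upTo n))
  (λ a b → cong (λ k → egf power k a b) (length-applyUpTo suc n))

theorem1 : ∀ (n a b : ℕ) → NMSeries Γ n a b ≡ powX (inv USeries) n a b
theorem1 zero    a b = trans (oneS≋one 0 a b) (sym (trans (powX≋power 0 a b) (power₀ a b)))
-- Multiplying by (n + 1)! turns the left side into a number of permutations and the right side into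
-- an `egf` value.
theorem1 (suc n) a b = factorialℚ-cancel (suc n) (begin
  factorialℚ (suc n) *ℚ NMSeries Γ (suc n) a b
    ≡⟨ factorialℚ-* (suc n) (+ length (filterᵇ (hasStatsᵇ a b) (NM Γ (suc n)))) ⟩
  + length (filterᵇ (hasStatsᵇ a b) (NM Γ (suc n))) ℚ./ 1
    ≡⟨ count-weight n a b ⟩
  L.sumL (arr (applyUpTo suc (suc n))) (weight ξ) a b
    ≡⟨ sum-weight-power (suc n) a b ⟩
  egf power (suc n) a b
    ≡⟨ egf-eval power (suc n) a b ⟩
  factorialℚ (suc n) *ℚ power (suc n) a b
    ≡⟨ cong (factorialℚ (suc n) *ℚ_) (powX≋power (suc n) a b) ⟨
  factorialℚ (suc n) *ℚ powX (inv USeries) (suc n) a b ∎)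
  where open ≡-Reasoning
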